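{- Every retract of a hyper-median partial cube is a hyper-median partial cube.
   Context: For a connected graph $G$, $d_G$ is the shortest-path distance and $I_G(x,y)$ the set of vertices on shortest $(x,y)$-paths; $A\subseteq V(G)$ is convex if $I_G(x,y)\subseteq A$ for $x,y\in A$; $co_G(A)$ the smallest convex set containing $A$; a convex subgraph is one induced by a convex set. A partial cube is a graph isomorphic to an isometric subgraph of a (possibly infinite) hypercube. $\mathcal I_G(A)=\bigcup_{x,y\in A}I_G(x,y)$ with iterates $\mathcal I_G^n$; a copoint at $x$ is a convex set maximal with respect to not containing $x$; $ph(G)$ is the least $n$ with $co_G(C\cup\{x\})=\mathcal I_G^n(C\cup\{x\})$ for all vertices $x$ and copoints $C$ at $x$. A Peano partial cube is a partial cube all of whose finite convex subgraphs have pre-hull number at most $1$. A hypertorus is a Cartesian product of finitely many even cycles at least one of length greater than $4$. For vertices $u,v,w$: a median is a vertex of $I_G(u,v)\cap I_G(v,w)\cap I_G(w,u)$; a metric triangle is a triple whose pairwise intervals intersect only in common endvertices; a quasi-median of $(u,v,w)$ is a metric triangle $(x,y,z)$ with $d_G(u,v)=d_G(u,x)+d_G(x,y)+d_G(y,v)$, $d_G(v,w)=d_G(v,y)+d_G(y,z)+d_G(z,w)$, $d_G(w,u)=d_G(w,z)+d_G(z,x)+d_G(x,u)$; a hyper-median is a quasi-median $(x,y,z)$ with $G[co_G(\{x,y,z\})]$ a hypertorus. A hyper-median partial cube is a Peano partial cube in which every triple of vertices has a median or a hyper-median. A contraction is a map $f$ with $d(f(x),f(y))\le d(x,y)$; an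 induced subgraph $H$ of $G$ is a retract if there is a contraction $V(G)\to V(H)$ that is the identity on $V(H)$. -}

module Defs where

open import Level using (0ℓ)
open import Data.Nat using (ℕ; zero; suc; _+_; _*_; _≤_; _%_)
open import Data.Fin using (Fin; toℕ)
open import Data.Bool using (Bool)
open import Data.Unit using (⊤)
open import Data.Empty using (⊥)
open import Data.List using (List; []; _∷_)
open import Data.List.Membership.Propositional using (_∈_)
open import Data.List.Relation.Unary.Any using (Any)
open import Data.Product using (Σ; ∃; ∃-syntax; _×_; _,_)
open import Data.Sum using (_⊎_)
open import Relation.Nullary using (¬_)
open import Relation.Binary.PropositionalEquality using (_≡_; _≢_)

-- Graphs.  A graph is a carrier type V, a vertex predicate Vx (the
-- vertex set, a subset of V) and an adjacency relation E.  Induced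
-- subgraphs are obtained by restricting Vx and E (no Σ-types, so that
-- vertex identity stays ≡ on V).

record Graph : Set₁ where
  field
    V  : Set
    Vx : V → Set
    E  : V → V → Set
open Graph public

Subset : Graph → Set₁
Subset G = V G → Set

_⊆_ : {A : Set} → (A → Set) → (A → Set) → Set
P ⊆ Q = ∀ v → P v → Q v

SimpleGraph : Graph → Set
SimpleGraph G =
  (∀ x y → E G x y → Vx G x × Vx G y)
  × (∀ x y → E G x y → E G y x)
  × (∀ x → ¬ E G x x)

Induced : (G : Graph) → Subset G → Graph
Induced G A = record
  { V  = V G
  ; Vx = λ v → Vx G v × A v
  ; E  = λ x y → A x × A y × E G x y }

module _ (G : Graph) where

  data Walk : V G → V G → ℕ → Set where
    nil  : ∀ {x} → Walk x x 0
    step : ∀ {x y z n} → E G x y → Walk y z n → Walk x z (suc n)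

  Connected : Set
  Connected = ∀ x y → Vx G x → Vx G y → ∃[ n ] Walk x y n

  Dist : V G → V G → ℕ → Set
  Dist x y n = Walk x y n × (∀ m → Walk x y m → n ≤ m)

  InI : V G → V G → V G → Set
  InI x y z = ∃[ a ] ∃[ b ] (Dist x z a × Dist z y b × Dist x y (a + b))

  Convex : Subset G → Set
  Convex A = (A ⊆ Vx G) × (∀ x y z → A x → A y → InI x y z → A z)

  data Co (A : Subset G) : V G → Set where
    inc : ∀ {z} → A z → Co A z
    int : ∀ {x y z} → Co A x → Co A y → InI x y z → Co A z

  𝓘 : Subset G → Subset G
  𝓘 A z = ∃[ x ] ∃[ y ] (A x × A y × InI x y z)

  𝓘^ : ℕ → Subset G → Subset G
  𝓘^ zero    A = A
  𝓘^ (suc n) A = 𝓘 (𝓘^ n A)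

  Copoint : Subset G → V G → Set₁
  Copoint C x =
    Convex C × ¬ C x
    × (∀ (D : Subset G) → Convex D → C ⊆ D → ¬ D x → D ⊆ C)

  PreHullAtMost : ℕ → Set₁
  PreHullAtMost n =
    ∃[ m ] (m ≤ n ×
      (∀ x (C : Subset G) → Vx G x → Copoint C x →
        let Cx = λ v → C v ⊎ v ≡ x in
        (Co Cx ⊆ 𝓘^ m Cx) × (𝓘^ m Cx ⊆ Co Cx)))

  Median : V G → V G → V G → V G → Set
  Median u v w m = Vx G m × InI u v m × InI v w m × InI w u m

  MetricTriangle : V G → V G → V G → Set
  MetricTriangle x y z =
    (∀ v → InI x y v → InI y z v → v ≡ y)
    × (∀ v → InI y z v → InI z x v → v ≡ z)
    × (∀ v → InI z x v → InI x y v → v ≡ x)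

  Split3 : V G → V G → V G → V G → Set
  Split3 p a b q = ∃[ i ] ∃[ j ] ∃[ k ]
    (Dist p a i × Dist a b j × Dist b q k × Dist p q (i + j + k))

  QuasiMedian : V G → V G → V G → V G → V G → V G → Set
  QuasiMedian u v w x y z =
    MetricTriangle x y z
    × Split3 u x y v × Split3 v y z w × Split3 w z x u

-- Hypercubes (possibly infinite): vertices I → Bool (pointwise
-- equality), adjacency = differ in exactly one coordinate.

module _ (I : Set) where

  CubeAdj : (I → Bool) → (I → Bool) → Set
  CubeAdj f g = ∃[ i ] (f i ≢ g i × (∀ j → j ≢ i → f j ≡ g j))

  data CubeWalk : (I → Bool) → (I → Bool) → ℕ → Set where
    nil  : ∀ {f g} → (∀ i → f i ≡ g i) → CubeWalk f g 0
    step : ∀ {f g h n} → CubeAdj f g → CubeWalk g h n → CubeWalk f h (suc n)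

  CubeDist : (I → Bool) → (I → Bool) → ℕ → Set
  CubeDist f g n = CubeWalk f g n × (∀ m → CubeWalk f g m → n ≤ m)

PartialCube : Graph → Set₁
PartialCube G =
  SimpleGraph G × Connected G ×
  (∃[ I ] Σ (V G → I → Bool) λ φ →
     ∀ x y → Vx G x → Vx G y → ∀ n →
       (Dist G x y n → CubeDist I (φ x) (φ y) n)
       × (CubeDist I (φ x) (φ y) n → Dist G x y n))

Finite : {A : Set} → (A → Set) → Set
Finite {A} P = ∃[ xs ] (∀ (v : A) → P v → v ∈ xs)

PeanoPartialCube : Graph → Set₁
PeanoPartialCube G =
  PartialCube G ×
  (∀ (A : Subset G) → Convex G A → Finite A →
     PreHullAtMost (Induced G A) 1)

-- Hypertori: Cartesian products of the even cycles C_(4+2m), m ∈ ms,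
-- ms nonempty, at least one m ≥ 1 (cycle of length > 4).

cycLen : ℕ → ℕ
cycLen m = 4 + 2 * m

CycAdj : (m : ℕ) → Fin (cycLen m) → Fin (cycLen m) → Set
CycAdj m a b = (toℕ b ≡ suc (toℕ a) % cycLen m) ⊎ (toℕ a ≡ suc (toℕ b) % cycLen m)

TorusV : List ℕ → Set
TorusV []       = ⊤
TorusV (m ∷ ms) = Fin (cycLen m) × TorusV ms

TorusE : (ms : List ℕ) → TorusV ms → TorusV ms → Set
TorusE []       _       _       = ⊥
TorusE (m ∷ ms) (a , u) (b , v) = (CycAdj m a b × u ≡ v) ⊎ (a ≡ b × TorusE ms u v)

IsoTorus : Graph → List ℕ → Set
IsoTorus G ms =
  Σ (V G → TorusV ms) λ f → Σ (TorusV ms → V G) λ g →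
    (∀ v → Vx G v → g (f v) ≡ v)
    × (∀ t → Vx G (g t) × f (g t) ≡ t)
    × (∀ u v → Vx G u → Vx G v → (E G u v → TorusE ms (f u) (f v)) × (TorusE ms (f u) (f v) → E G u v))

IsHypertorus : Graph → Set
IsHypertorus G =
  ∃[ ms ] ((ms ≢ []) × Any (λ m → 1 ≤ m) ms × IsoTorus G ms)

HyperMedian : (G : Graph) → V G → V G → V G → V G → V G → V G → Set
HyperMedian G u v w x y z =
  Vx G x × Vx G y × Vx G z ×
  QuasiMedian G u v w x y z ×
  IsHypertorus (Induced G (Co G (λ t → t ≡ x ⊎ t ≡ y ⊎ t ≡ z)))

HyperMedianPartialCube : Graph → Set₁
HyperMedianPartialCube G =
  PeanoPartialCube G ×
  (∀ u v w → Vx G u → Vx G v → Vx G w →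
     (∃[ m ] Median G u v w m)
     ⊎ (∃[ x ] ∃[ y ] ∃[ z ] HyperMedian G u v w x y z))

Retract : (G : Graph) → Subset G → Set
Retract G B =
  (B ⊆ Vx G) ×
  Σ (V G → V G) λ f →
    (∀ v → Vx G v → B (f v))
    × (∀ v → B v → f v ≡ v)
    × (∀ x y n → Vx G x → Vx G y → Dist G x y n →
         ∃[ k ] (Dist (Induced G B) (f x) (f y) k × k ≤ n))

{-# OPTIONS --safe #-}
module Submission where

-- Let r be the retraction of G onto H.  Triples: given a triple of vertices of H, take a median or a
-- hyper-median of it in G and apply r.  The image of a median is a median.  The image of a hyper-median
-- (x,y,z) again splits the distances of the triple, so one may pass to (r x, r y, r z) and repeat; the
-- perimeter decreases until the triple is its own hyper-median (a,b,c).  The hypertorus T spanned by a, b, c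
-- then lies in H: moving a inside H towards b until one of its coordinates is antipodal to that of c, one
-- finds that r must fix three points of a fibre in that coordinate, hence three parallel fibres, and the
-- remaining coordinates follow by induction on the distance of a and b.
--
-- Pre-hull numbers: it suffices that H satisfies Peano's axiom (x between u and v, y between w and x give
-- z between v and w with y between u and z), since this makes convex hulls of C ∪ {x} unions of
-- intervals from x.  If v, w, y have a median, it serves as z.  Otherwise they have a hyper-median spanning
-- a hypertorus T, and Peano's axiom in T, where it can be checked on each even cycle, is transported to u
-- and x through their gates in T.  That T is gated is the only place where the pre-hull numbers of finite
-- convex subgraphs of G enter: a failure of gatedness in a fibre cycle would contradict 𝓘-closure for a
-- copoint cut out by an edge of the cycle.

open import Defs
open import Data.Bool using (Bool; true; false; not; if_then_else_)
import Data.Bool as Bool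
open import Data.Bool.Properties using (not-¬; ¬-not)
open import Data.Empty using (⊥; ⊥-elim)
open import Data.Fin using (Fin; zero; suc; toℕ; fromℕ<; #_)
import Data.Fin as Fin
open import Data.Fin.Properties using (toℕ<n; toℕ-injective; toℕ-fromℕ<)
import Data.Fin.Properties as Fin
open import Data.List using (List; []; _∷_; length; _++_; filterᵇ; allFin) renaming (lookup to _!_)
import Data.List as List
open import Data.List.Properties using (length-++; length-map)
open import Data.List.Membership.Propositional using (_∈_)
open import Data.List.Membership.Propositional.Properties using (∈-∃++; ∈-++⁻; ∈-++⁺ˡ; ∈-++⁺ʳ)
open import Data.List.Relation.Unary.All using (All; []; _∷_)
import Data.List.Relation.Unary.All as All
open import Data.List.Relation.Unary.AllPairs using ([]; _∷_)
open import Data.List.Relation.Unary.Any using (here; there)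
open import Data.List.Relation.Unary.Unique.Propositional using (Unique)
open import Data.Nat
open import Data.Nat.DivMod using (m<n⇒m%n≡m; n%n≡0)
open import Data.Nat.Properties
open import Algebra.Properties.CommutativeSemigroup +-commutativeSemigroup using (interchange)
open import Data.Product using (∃-syntax; Σ; _×_; _,_; proj₁; proj₂)
open import Data.Sum using (_⊎_; inj₁; inj₂)
open import Data.Unit using (tt)
open import Data.Vec using (Vec; []; _∷_)
open import Relation.Binary.Definitions using (Tri; tri<; tri≈; tri>)
open import Relation.Binary.PropositionalEquality
open import Relation.Nullary
open import Relation.Nullary.Decidable using (_×-dec_; _⊎-dec_; _→-dec_; decidable-stable; map′)

-- Linear arithmetic over ℕ by Fourier–Motzkin elimination

-- Neither the vertices nor the coordinates of the ambient graph need have decidable equality; only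
-- Boolean coordinate values and numbers do. Betweenness is therefore read off the coordinates, as
-- one equation of Booleans implied by another. Such statements are stable under double negation, so
-- their proofs may use classical case distinctions and a finiteness known only up to double
-- negation. On an even cycle, a fact about distances splits into many cases according to which arcs
-- pass the origin. Distances are therefore written as alternatives of linear equations between
-- positions, and a verified refutation procedure goes through the cases. That the spanned
-- hypertorus lies in H serves twice: it makes the triple a hyper-median in H itself, and it puts
-- the vertex that Peano's axiom asks for into H.

module LinearArithmetic where

  open import Data.Bool using (T) renaming (_∧_ to _&&_; _∨_ to _||_)
  open import Data.Vec using (lookup; zipWith; map; replicate)

  infix  9 ′_
  infixl 7 _⊕_
  infix  6 _≤ᶠ_ _<ᶠ_ _≡ᶠ_
  infixr 5 _∧ᶠ_
  infixr 4 _∨ᶠ_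
  infixr 3 _⇒ᶠ_

  data Term (k : ℕ) : Set where
    ′_  : Fin k → Term k
    lit : ℕ → Term k
    _⊕_ : Term k → Term k → Term k

  data Formula (k : ℕ) : Set where
    _≤ᶠ_ _≡ᶠ_      : Term k → Term k → Formula k
    _∧ᶠ_ _∨ᶠ_ _⇒ᶠ_ : Formula k → Formula k → Formula k
    ⊥ᶠ             : Formula k

  _<ᶠ_ : ∀ {k} → Term k → Term k → Formula k
  s <ᶠ t = lit 1 ⊕ s ≤ᶠ t

  eval : ∀ {k} → Term k → Vec ℕ k → ℕ
  eval (′ i)   ρ = lookup ρ i
  eval (lit c) ρ = c
  eval (s ⊕ t) ρ = eval s ρ + eval t ρ

  ⟦_⟧ : ∀ {k} → Formula k → Vec ℕ k → Set
  ⟦ s ≤ᶠ t ⟧ ρ = eval s ρ ≤ eval t ρ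
  ⟦ s ≡ᶠ t ⟧ ρ = eval s ρ ≡ eval t ρ
  ⟦ f ∧ᶠ g ⟧ ρ = ⟦ f ⟧ ρ × ⟦ g ⟧ ρ
  ⟦ f ∨ᶠ g ⟧ ρ = ⟦ f ⟧ ρ ⊎ ⟦ g ⟧ ρ
  ⟦ f ⇒ᶠ g ⟧ ρ = ⟦ f ⟧ ρ → ⟦ g ⟧ ρ
  ⟦ ⊥ᶠ ⟧     ρ = ⊥

  ⟦_⟧? : ∀ {k} (f : Formula k) ρ → Dec (⟦ f ⟧ ρ)
  ⟦ s ≤ᶠ t ⟧? ρ = eval s ρ ≤? eval t ρ
  ⟦ s ≡ᶠ t ⟧? ρ = eval s ρ ≟ eval t ρ
  ⟦ f ∧ᶠ g ⟧? ρ = ⟦ f ⟧? ρ ×-dec ⟦ g ⟧? ρ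
  ⟦ f ∨ᶠ g ⟧? ρ = ⟦ f ⟧? ρ ⊎-dec ⟦ g ⟧? ρ
  ⟦ f ⇒ᶠ g ⟧? ρ = ⟦ f ⟧? ρ →-dec ⟦ g ⟧? ρ
  ⟦ ⊥ᶠ ⟧?     ρ = no λ ()

  -- The head of the vector is the constant term; a constraint (l , r) means l ≤ r.
  Linear : ℕ → Set
  Linear k = Vec ℕ (suc k)

  value : ∀ {k} → Vec ℕ k → Vec ℕ k → ℕ
  value []       []      = 0
  value (c ∷ cs) (x ∷ ρ) = c * x + value cs ρ

  data Relation : Set where
    equal atMost : Relation

  Constraint : ℕ → Set
  Constraint k = Relation × Linear k × Linear k

  Holds : ∀ {k} → Vec ℕ k → Constraint k → Set
  Holds ρ (equal  , l , r) = value l (1 ∷ ρ) ≡ value r (1 ∷ ρ)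
  Holds ρ (atMost , l , r) = value l (1 ∷ ρ) ≤ value r (1 ∷ ρ)

  add : ∀ {k} → Vec ℕ k → Vec ℕ k → Vec ℕ k
  add = zipWith _+_

  scale : ∀ {k} → ℕ → Vec ℕ k → Vec ℕ k
  scale c = map (c *_)

  value-add : ∀ {k} (u v ρ : Vec ℕ k) → value (add u v) ρ ≡ value u ρ + value v ρ
  value-add []      []      []      = refl
  value-add (a ∷ u) (b ∷ v) (x ∷ ρ) rewrite value-add u v ρ = lem a b x (value u ρ) (value v ρ)
    where
    lem : ∀ a b x y z → (a + b) * x + (y + z) ≡ a * x + y + (b * x + z)
    lem a b x y z = trans (cong (_+ (y + z)) (*-distribʳ-+ x a b)) (interchange (a * x) (b * x) y z)

  value-scale : ∀ {k} c (u ρ : Vec ℕ k) → value (scale c u) ρ ≡ c * value u ρ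
  value-scale c []      []      = sym (*-zeroʳ c)
  value-scale c (a ∷ u) (x ∷ ρ) rewrite value-scale c u ρ = lem c a x (value u ρ)
    where
    lem : ∀ c a x y → c * a * x + c * y ≡ c * (a * x + y)
    lem c a x y = trans (cong (_+ c * y) (*-assoc c a x)) (sym (*-distribˡ-+ c (a * x) y))

  zeros : ∀ {k} → Vec ℕ k
  zeros = replicate _ 0

  value-zeros : ∀ {k} (ρ : Vec ℕ k) → value zeros ρ ≡ 0
  value-zeros []      = refl
  value-zeros (x ∷ ρ) = value-zeros ρ

  unit : ∀ {k} → Fin k → Vec ℕ k
  unit zero    = 1 ∷ zeros
  unit (suc i) = 0 ∷ unit i

  value-unit : ∀ {k} (i : Fin k) ρ → value (unit i) ρ ≡ lookup ρ i
  value-unit zero    (x ∷ ρ) rewrite value-zeros ρ | +-identityʳ (x + 0) = +-identityʳ x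
  value-unit (suc i) (x ∷ ρ) = value-unit i ρ

  linear : ∀ {k} → Term k → Linear k
  linear (′ i)   = 0 ∷ unit i
  linear (lit c) = c ∷ zeros
  linear (s ⊕ t) = add (linear s) (linear t)

  value-linear : ∀ {k} (t : Term k) ρ → value (linear t) (1 ∷ ρ) ≡ eval t ρ
  value-linear (′ i)   ρ = value-unit i ρ
  value-linear (lit c) ρ rewrite value-zeros ρ | *-identityʳ c = +-identityʳ c
  value-linear (s ⊕ t) ρ = trans (value-add (linear s) (linear t) (1 ∷ ρ))
                                 (cong₂ _+_ (value-linear s ρ) (value-linear t ρ))

  cancel : ∀ {k} → Vec ℕ k → Vec ℕ k → Vec ℕ k
  cancel = zipWith _∸_

  common : ∀ {k} → Vec ℕ k → Vec ℕ k → Vec ℕ k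
  common = zipWith _⊓_

  value-cancel : ∀ {k} (u v ρ : Vec ℕ k) → value u ρ ≡ value (cancel u v) ρ + value (common u v) ρ
  value-cancel []      []      []      = refl
  value-cancel (a ∷ u) (b ∷ v) (x ∷ ρ) = begin
    a * x + value u ρ
      ≡⟨ cong₂ (λ p q → p * x + q) (sym (m∸n+m⊓n≡m a b)) (value-cancel u v ρ) ⟩
    (a ∸ b + a ⊓ b) * x + (value (cancel u v) ρ + value (common u v) ρ)
      ≡⟨ lem (a ∸ b) (a ⊓ b) x (value (cancel u v) ρ) (value (common u v) ρ) ⟩
    (a ∸ b) * x + value (cancel u v) ρ + ((a ⊓ b) * x + value (common u v) ρ) ∎
    where
    open ≡-Reasoning
    m∸n+m⊓n≡m : ∀ m n → m ∸ n + m ⊓ n ≡ m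
    m∸n+m⊓n≡m m n = trans (cong (m ∸ n +_) (⊓-comm m n)) (trans (+-comm (m ∸ n) (n ⊓ m)) (m⊓n+n∸m≡n n m))
    lem : ∀ a b x y z → (a + b) * x + (y + z) ≡ a * x + y + (b * x + z)
    lem a b x y z = trans (cong (_+ (y + z)) (*-distribʳ-+ x a b)) (interchange (a * x) (b * x) y z)

  common-comm : ∀ {k} (u v : Vec ℕ k) → common u v ≡ common v u
  common-comm []      []      = refl
  common-comm (a ∷ u) (b ∷ v) = cong₂ _∷_ (⊓-comm a b) (common-comm u v)

  -- Coefficients are natural numbers, so a variable on both sides is cancelled by truncated
  -- subtraction; afterwards it occurs on one side at most.
  reduce : ∀ {k} → Constraint k → Constraint k
  reduce (R , l , r) = R , cancel l r , cancel r l

  reduce-holds : ∀ {k} (ρ : Vec ℕ k) c → Holds ρ c → Holds ρ (reduce c)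
  reduce-holds ρ (R , l , r) h = go R h
    where
    ρ′ = 1 ∷ ρ
    el = value-cancel l r ρ′
    er = trans (value-cancel r l ρ′) (cong (λ w → value (cancel r l) ρ′ + value w ρ′) (common-comm r l))
    go : ∀ R → Holds ρ (R , l , r) → Holds ρ (R , cancel l r , cancel r l)
    go equal  h = +-cancelʳ-≡ (value (common l r) ρ′) _ _ (trans (sym el) (trans h er))
    go atMost h = +-cancelʳ-≤ (value (common l r) ρ′) _ _ (subst₂ _≤_ el er h)

  meet : Relation → Relation → Relation
  meet equal  R = R
  meet atMost R = atMost

  combine : ∀ {k} → ℕ → Constraint k → ℕ → Constraint k → Constraint k
  combine p (R , l , r) q (R′ , l′ , r′) =
    reduce (meet R R′ , add (scale p l) (scale q l′) , add (scale p r) (scale q r′))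

  combine-holds : ∀ {k} (ρ : Vec ℕ k) p c q d → Holds ρ c → Holds ρ d → Holds ρ (combine p c q d)
  combine-holds ρ p (R , l , r) q (R′ , l′ , r′) h h′ = reduce-holds ρ
    (meet R R′ , add (scale p l) (scale q l′) , add (scale p r) (scale q r′)) (go R R′ h h′)
    where
    eq : ∀ u v → value (add (scale p u) (scale q v)) (1 ∷ ρ) ≡ p * value u (1 ∷ ρ) + q * value v (1 ∷ ρ)
    eq u v = trans (value-add (scale p u) (scale q v) (1 ∷ ρ))
                   (cong₂ _+_ (value-scale p u (1 ∷ ρ)) (value-scale q v (1 ∷ ρ)))
    le : value l (1 ∷ ρ) ≤ value r (1 ∷ ρ) → value l′ (1 ∷ ρ) ≤ value r′ (1 ∷ ρ) →
      value (add (scale p l) (scale q l′)) (1 ∷ ρ) ≤ value (add (scale p r) (scale q r′)) (1 ∷ ρ)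
    le h h′ = subst₂ _≤_ (sym (eq l l′)) (sym (eq r r′)) (+-mono-≤ (*-monoʳ-≤ p h) (*-monoʳ-≤ q h′))
    go : ∀ R R′ → Holds ρ (R , l , r) → Holds ρ (R′ , l′ , r′) →
      Holds ρ (meet R R′ , add (scale p l) (scale q l′) , add (scale p r) (scale q r′))
    go equal  equal  h h′ = trans (eq l l′) (trans (cong₂ (λ x y → p * x + q * y) h h′) (sym (eq r r′)))
    go equal  atMost h h′ = le (≤-reflexive h) h′
    go atMost equal  h h′ = le h (≤-reflexive h′)
    go atMost atMost h h′ = le h h′

  isZero : ∀ {k} → Vec ℕ k → Bool
  isZero []       = true
  isZero (c ∷ cs) = (c ≡ᵇ 0) && isZero cs

  value-isZero : ∀ {k} (u ρ : Vec ℕ k) → isZero u ≡ true → value u ρ ≡ 0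
  value-isZero []          []      _ = refl
  value-isZero (zero ∷ u)  (x ∷ ρ) e = value-isZero u ρ e

  exceeds : ∀ {k} → Linear k → Linear k → Bool
  exceeds (c ∷ _) (d ∷ r) = (d <ᵇ c) && isZero r

  absurd : ∀ {k} → Constraint k → Bool
  absurd (equal  , l , r) = exceeds l r || exceeds r l
  absurd (atMost , l , r) = exceeds l r

  ∧-true : ∀ {a b} → (a && b) ≡ true → a ≡ true × b ≡ true
  ∧-true {true} {true} _ = refl , refl

  exceeds-holds : ∀ {k} (ρ : Vec ℕ k) l r → exceeds l r ≡ true → value l (1 ∷ ρ) ≤ value r (1 ∷ ρ) → ⊥
  exceeds-holds ρ (c ∷ l) (d ∷ r) e h with ∧-true {d <ᵇ c} e
  ... | lt , z rewrite value-isZero r ρ z | *-identityʳ c | *-identityʳ d | +-identityʳ d =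
    <⇒≱ (<ᵇ⇒< d c (subst T (sym lt) _)) (≤-trans (m≤m+n c _) h)

  absurd-holds : ∀ {k} (ρ : Vec ℕ k) c → absurd c ≡ true → Holds ρ c → ⊥
  absurd-holds ρ (atMost , l , r) e h = exceeds-holds ρ l r e h
  absurd-holds ρ (equal  , l , r) e h with exceeds l r in eq
  ... | true  = exceeds-holds ρ l r eq (≤-reflexive h)
  ... | false = exceeds-holds ρ r l e (≤-reflexive (sym h))

  anyAbsurd : ∀ {k} → List (Constraint k) → Bool
  anyAbsurd []       = false
  anyAbsurd (c ∷ cs) = absurd c || anyAbsurd cs

  anyAbsurd-holds : ∀ {k} (ρ : Vec ℕ k) cs → anyAbsurd cs ≡ true → All (Holds ρ) cs → ⊥
  anyAbsurd-holds ρ (c ∷ cs) e (h ∷ hs) with absurd c in eq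
  ... | true  = absurd-holds ρ c eq h
  ... | false = anyAbsurd-holds ρ cs e hs

  trivial : ∀ {k} → Constraint k → Bool
  trivial (equal  , l , r) = isZero l && isZero r
  trivial (atMost , l , r) = isZero l

  keep : ∀ {k} → Constraint k → List (Constraint k) → List (Constraint k)
  keep c cs = if trivial c then cs else c ∷ cs

  keep-holds : ∀ {k} (ρ : Vec ℕ k) c cs → Holds ρ c → All (Holds ρ) cs → All (Holds ρ) (keep c cs)
  keep-holds ρ c cs h hs with trivial c
  ... | true  = hs
  ... | false = h ∷ hs

  -- Elimination of a variable

  net : ∀ {k} → Fin k → Constraint k → ℕ × ℕ
  net i (_ , _ ∷ l , _ ∷ r) = lookup l i , lookup r i

  flip : ∀ {k} → Constraint k → Constraint k
  flip (R , l , r) = R , r , l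

  -- e is an equation in which the variable i occurs.
  substitute : ∀ {k} → Fin k → Constraint k → List (Constraint k) → List (Constraint k)
  substitute i e []       = []
  substitute i e (c ∷ cs) with net i e | net i c
  ... | a , b | zero  , zero  = c ∷ substitute i e cs
  -- In the reduced equation one of `a`, `b` is 0, so `a + b` is the coefficient of `i`. The
  -- equation is turned around if necessary, so that `i` stands on the side opposite to its side in
  -- `c` and cancels.
  ... | a , b | suc p , _     = keep (combine (a + b) c (suc p) (if a ≡ᵇ 0 then e else flip e)) (substitute i e cs)
  ... | a , b | zero  , suc q = keep (combine (a + b) c (suc q) (if b ≡ᵇ 0 then e else flip e)) (substitute i e cs)

  orient-holds : ∀ {k} (ρ : Vec ℕ k) b (l r : Linear k) → Holds ρ (equal , l , r) →
    Holds ρ (if b then (equal , l , r) else flip (equal , l , r))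
  orient-holds ρ true  l r h = h
  orient-holds ρ false l r h = sym h

  substitute-holds : ∀ {k} (ρ : Vec ℕ k) i l r cs → Holds ρ (equal , l , r) → All (Holds ρ) cs →
    All (Holds ρ) (substitute i (equal , l , r) cs)
  substitute-holds ρ i l r []       h []        = []
  substitute-holds ρ i l r (c ∷ cs) h (h′ ∷ hs) with net i (equal , l , r) | net i c
  ... | a , b | zero  , zero  = h′ ∷ substitute-holds ρ i l r cs h hs
  ... | a , b | suc p , _     =
    keep-holds ρ (combine (a + b) c (suc p) _) _
      (combine-holds ρ (a + b) c (suc p) _ h′ (orient-holds ρ (a ≡ᵇ 0) l r h)) (substitute-holds ρ i l r cs h hs)
  ... | a , b | zero  , suc q =
    keep-holds ρ (combine (a + b) c (suc q) _) _
      (combine-holds ρ (a + b) c (suc q) _ h′ (orient-holds ρ (b ≡ᵇ 0) l r h)) (substitute-holds ρ i l r cs h hs)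

  record Split (k : ℕ) : Set where
    constructor split
    field upper lower : List (ℕ × Constraint k)
          other : List (Constraint k)

  data Solved (k : ℕ) : Set where
    equation : Linear k → Linear k → Solved k
    bounds   : Split k → Solved k

  insert : ∀ {k} → Fin k → Constraint k → Split k → Solved k
  insert i c S with net i c
  insert i c                (split U L O) | zero  , zero  = bounds (split U L (c ∷ O))
  insert i (equal , l , r)  S             | suc a , _     = equation l r
  insert i c@(atMost , _)   (split U L O) | suc a , _     = bounds (split ((suc a , c) ∷ U) L O)
  insert i (equal , l , r)  S             | zero  , suc b = equation l r
  insert i c@(atMost , _)   (split U L O) | zero  , suc b = bounds (split U ((suc b , c) ∷ L) O)

  classify : ∀ {k} → Fin k → List (Constraint k) → Solved k
  classify i []       = bounds (split [] [] [])
  classify i (c ∷ cs) with classify i cs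
  ... | equation l r = equation l r
  ... | bounds S     = insert i c S

  HoldsAll : ∀ {k} → Vec ℕ k → List (ℕ × Constraint k) → Set
  HoldsAll ρ = All (λ x → Holds ρ (proj₂ x))

  SplitHolds : ∀ {k} → Vec ℕ k → Solved k → Set
  SplitHolds ρ (equation l r)         = Holds ρ (equal , l , r)
  SplitHolds ρ (bounds (split U L O)) = HoldsAll ρ U × HoldsAll ρ L × All (Holds ρ) O

  insert-holds : ∀ {k} (ρ : Vec ℕ k) i c S → Holds ρ c → SplitHolds ρ (bounds S) → SplitHolds ρ (insert i c S)
  insert-holds ρ i c S h s with net i c
  insert-holds ρ i c              S h (u , l , o) | zero  , zero  = u , l , h ∷ o
  insert-holds ρ i (equal , _)    S h s           | suc a , _     = h
  insert-holds ρ i (atMost , _)   S h (u , l , o) | suc a , _     = h ∷ u , l , o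
  insert-holds ρ i (equal , _)    S h s           | zero  , suc b = h
  insert-holds ρ i (atMost , _)   S h (u , l , o) | zero  , suc b = u , h ∷ l , o

  classify-holds : ∀ {k} (ρ : Vec ℕ k) i cs → All (Holds ρ) cs → SplitHolds ρ (classify i cs)
  classify-holds ρ i []       []       = [] , [] , []
  classify-holds ρ i (c ∷ cs) (h ∷ hs) with classify i cs | classify-holds ρ i cs hs
  ... | equation l r | e = e
  ... | bounds S     | s = insert-holds ρ i c S h s

  pairWith : ∀ {k} → ℕ × Constraint k → List (ℕ × Constraint k) → List (Constraint k) → List (Constraint k)
  pairWith (p , c) []             acc = acc
  pairWith (p , c) ((q , d) ∷ ds) acc = keep (combine q c p d) (pairWith (p , c) ds acc)

  pairs : ∀ {k} → List (ℕ × Constraint k) → List (ℕ × Constraint k) → List (Constraint k) → List (Constraint k)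
  pairs []       L acc = acc
  pairs (u ∷ us) L acc = pairWith u L (pairs us L acc)

  pairWith-holds : ∀ {k} (ρ : Vec ℕ k) pc L acc → Holds ρ (proj₂ pc) → HoldsAll ρ L → All (Holds ρ) acc →
    All (Holds ρ) (pairWith pc L acc)
  pairWith-holds ρ (p , c) []            acc h []       ha = ha
  pairWith-holds ρ (p , c) ((q , d) ∷ L) acc h (l ∷ ls) ha =
    keep-holds ρ (combine q c p d) _ (combine-holds ρ q c p d h l) (pairWith-holds ρ (p , c) L acc h ls ha)

  pairs-holds : ∀ {k} (ρ : Vec ℕ k) U L acc → HoldsAll ρ U → HoldsAll ρ L → All (Holds ρ) acc →
    All (Holds ρ) (pairs U L acc)
  pairs-holds ρ []      L acc []       ls ha = ha
  pairs-holds ρ (u ∷ U) L acc (h ∷ hs) ls ha =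
    pairWith-holds ρ u L _ h ls (pairs-holds ρ U L acc hs ls ha)

  clear : ∀ {k} → Fin k → Vec ℕ k → Vec ℕ k
  clear zero    (_ ∷ u) = 0 ∷ u
  clear (suc i) (a ∷ u) = a ∷ clear i u

  value-clear : ∀ {k} (i : Fin k) u ρ → value (clear i u) ρ ≤ value u ρ
  value-clear zero    (a ∷ u) (x ∷ ρ) = m≤n+m _ (a * x)
  value-clear (suc i) (a ∷ u) (x ∷ ρ) = +-monoʳ-≤ (a * x) (value-clear i u ρ)

  -- An upper bound for a natural number stays valid when the number is replaced by 0.
  atZero : ∀ {k} → Fin k → List (ℕ × Constraint k) → List (Constraint k) → List (Constraint k)
  atZero i []                         acc = acc
  atZero i ((_ , atMost , l , r) ∷ cs) acc = keep (atMost , clear (suc i) l , r) (atZero i cs acc)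
  atZero i ((_ , equal  , l , r) ∷ cs) acc = atZero i cs acc

  atZero-holds : ∀ {k} (ρ : Vec ℕ k) i cs acc → HoldsAll ρ cs → All (Holds ρ) acc → All (Holds ρ) (atZero i cs acc)
  atZero-holds ρ i []                          acc []       ha = ha
  atZero-holds ρ i ((_ , atMost , l , r) ∷ cs) acc (h ∷ hs) ha =
    keep-holds ρ (atMost , clear (suc i) l , r) _ (≤-trans (value-clear (suc i) l (1 ∷ ρ)) h)
      (atZero-holds ρ i cs acc hs ha)
  atZero-holds ρ i ((_ , equal , l , r) ∷ cs) acc (h ∷ hs) ha = atZero-holds ρ i cs acc hs ha

  nonneg : ∀ {k} → Fin k → Constraint k
  nonneg i = atMost , zeros , 0 ∷ unit i

  eliminate : ∀ {k} → Fin k → List (Constraint k) → List (Constraint k)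
  eliminate i cs with classify i cs
  -- Solving for `i` would lose that `i` is nonnegative, so this is first recorded as a constraint.
  ... | equation l r         = substitute i (equal , l , r) (nonneg i ∷ cs)
  ... | bounds (split U L O) = pairs U L (atZero i U O)

  eliminate-holds : ∀ {k} (ρ : Vec ℕ k) i cs → All (Holds ρ) cs → All (Holds ρ) (eliminate i cs)
  eliminate-holds ρ i cs hs with classify i cs | classify-holds ρ i cs hs
  ... | equation l r         | e         =
    substitute-holds ρ i l r (nonneg i ∷ cs) e (≤-trans (≤-reflexive (value-zeros (1 ∷ ρ))) z≤n ∷ hs)
  ... | bounds (split U L O) | u , l , o = pairs-holds ρ U L _ u l (atZero-holds ρ i U O u o)

  infeasible : ∀ {k} → List (Fin k) → List (Constraint k) → Bool
  infeasible []       cs = anyAbsurd cs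
  infeasible (i ∷ is) cs = anyAbsurd cs || infeasible is (eliminate i cs)

  infeasible-holds : ∀ {k} (ρ : Vec ℕ k) is cs → infeasible is cs ≡ true → All (Holds ρ) cs → ⊥
  infeasible-holds ρ []       cs e hs = anyAbsurd-holds ρ cs e hs
  infeasible-holds ρ (i ∷ is) cs e hs with anyAbsurd cs in eq
  ... | true  = anyAbsurd-holds ρ cs eq hs
  ... | false = infeasible-holds ρ is (eliminate i cs) e (eliminate-holds ρ i cs hs)

  -- Refutation of formulas by case distinction

  module _ {k : ℕ} where

    order : List (Fin k)
    order = allFin k

    Branch : Set
    Branch = List (Constraint k) → Bool

    assertLe : Term k → Term k → List (Constraint k) → List (Constraint k)
    assertLe s t cs = reduce (atMost , linear s , linear t) ∷ cs

    assertEq : Term k → Term k → List (Constraint k) → List (Constraint k)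
    assertEq s t cs = reduce (equal , linear s , linear t) ∷ cs

    -- Constraints that are already contradictory are detected before splitting, which prevents
    -- exponentially many dead branches.
    both : Branch → Branch → Branch
    both p q cs = infeasible order cs || (p cs && q cs)

    -- refute true f p closes the branches on which f holds, refute false f p those on which f fails.
    refute : Bool → Formula k → Branch → Branch
    refute true  (s ≤ᶠ t) p cs = p (assertLe s t cs)
    refute false (s ≤ᶠ t) p cs = p (assertLe (lit 1 ⊕ t) s cs)
    refute true  (s ≡ᶠ t) p cs = p (assertEq s t cs)
    refute false (s ≡ᶠ t) p    = both (λ cs → p (assertLe (lit 1 ⊕ s) t cs)) (λ cs → p (assertLe (lit 1 ⊕ t) s cs))
    refute true  (f ∧ᶠ g) p    = refute true f (refute true g p)
    refute false (f ∧ᶠ g) p    = both (refute false f p) (refute false g p)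
    refute true  (f ∨ᶠ g) p    = both (refute true f p) (refute true g p)
    refute false (f ∨ᶠ g) p    = refute false f (refute false g p)
    refute true  (f ⇒ᶠ g) p    = both (refute false f p) (refute true g p)
    refute false (f ⇒ᶠ g) p    = refute true f (refute false g p)
    refute true  ⊥ᶠ       p cs = true
    refute false ⊥ᶠ       p    = p

    module _ (ρ : Vec ℕ k) where

      Sound : Branch → Set
      Sound p = ∀ cs → p cs ≡ true → All (Holds ρ) cs → ⊥

      Signed : Bool → Formula k → Set
      Signed true  f = ⟦ f ⟧ ρ
      Signed false f = ¬ ⟦ f ⟧ ρ

      assertLe-holds : ∀ s t cs → eval s ρ ≤ eval t ρ → All (Holds ρ) cs → All (Holds ρ) (assertLe s t cs)
      assertLe-holds s t cs h hs =
        reduce-holds ρ (atMost , linear s , linear t)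
          (subst₂ _≤_ (sym (value-linear s ρ)) (sym (value-linear t ρ)) h) ∷ hs

      -- The goal is a contradiction, so a doubly negated alternative suffices and formulas can be
      -- split classically.
      both-sound : ∀ p q {P Q : Set} → (P → Sound p) → (Q → Sound q) → ¬ ¬ (P ⊎ Q) → Sound (both p q)
      both-sound p q sp sq pq cs e hs with infeasible order cs in eq
      ... | true  = infeasible-holds ρ order cs eq hs
      ... | false with ∧-true {p cs} e
      ... | e₁ , e₂ = pq λ { (inj₁ x) → sp x cs e₁ hs ; (inj₂ y) → sq y cs e₂ hs }

      refute-sound : ∀ b f p → (Sound p) → Signed b f → Sound (refute b f p)
      refute-sound true  (s ≤ᶠ t) p sp h cs e hs = sp _ e (assertLe-holds s t cs h hs)
      refute-sound false (s ≤ᶠ t) p sp h cs e hs = sp _ e (assertLe-holds (lit 1 ⊕ t) s cs (≰⇒> h) hs)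
      refute-sound true  (s ≡ᶠ t) p sp h cs e hs =
        sp _ e (reduce-holds ρ (equal , linear s , linear t)
                 (trans (value-linear s ρ) (trans h (sym (value-linear t ρ)))) ∷ hs)
      refute-sound false (s ≡ᶠ t) p sp h =
        both-sound (λ cs → p (assertLe (lit 1 ⊕ s) t cs)) (λ cs → p (assertLe (lit 1 ⊕ t) s cs))
          (λ lt cs e hs → sp _ e (assertLe-holds (lit 1 ⊕ s) t cs lt hs))
          (λ lt cs e hs → sp _ e (assertLe-holds (lit 1 ⊕ t) s cs lt hs))
          λ k → k (≢⇒<⊎> h)
        where
        ≢⇒<⊎> : ∀ {m n} → m ≢ n → m < n ⊎ n < m
        ≢⇒<⊎> {m} {n} ne with m <? n
        ... | yes lt = inj₁ lt
        ... | no ¬lt = inj₂ (≤∧≢⇒< (≮⇒≥ ¬lt) (λ eq → ne (sym eq)))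
      refute-sound true  (f ∧ᶠ g) p sp (h , h′) = refute-sound true f _ (refute-sound true g p sp h′) h
      refute-sound false (f ∧ᶠ g) p sp h =
        both-sound _ _ (refute-sound false f p sp) (refute-sound false g p sp)
          λ k → k (inj₁ λ x → k (inj₂ λ y → h (x , y)))
      refute-sound true  (f ∨ᶠ g) p sp h =
        both-sound _ _ (refute-sound true f p sp) (refute-sound true g p sp) λ k → k h
      refute-sound false (f ∨ᶠ g) p sp h =
        refute-sound false f _ (refute-sound false g p sp (λ y → h (inj₂ y))) (λ x → h (inj₁ x))
      refute-sound true  (f ⇒ᶠ g) p sp h =
        both-sound _ _ (refute-sound false f p sp) (refute-sound true g p sp)
          λ k → k (inj₁ λ x → k (inj₂ (h x)))
      refute-sound false (f ⇒ᶠ g) p sp h cs e hs =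
        h λ x → ⊥-elim (refute-sound true f _ (refute-sound false g p sp (λ y → h λ _ → y)) x cs e hs)
      refute-sound true  ⊥ᶠ p sp ()
      refute-sound false ⊥ᶠ p sp h = sp

    valid : Formula k → Bool
    valid f = refute false f (infeasible order) []

    -- The refutation is sound but incomplete: apart from reading `s < t` as `1 + s ≤ t` it reasons
    -- over the rationals. Each use supplies `refl`, so type checking runs it.
    linarith : ∀ f → valid f ≡ true → ∀ ρ → ⟦ f ⟧ ρ
    linarith f e ρ = decidable-stable (⟦ f ⟧? ρ) λ ¬h →
      refute-sound ρ false f (infeasible order) (infeasible-holds ρ order) ¬h [] e []

-- Even cycles

module CyclePositions where

  open LinearArithmetic public
    using (Term; ′_; lit; _⊕_; Formula; _≤ᶠ_; _<ᶠ_; _≡ᶠ_; _∧ᶠ_; _∨ᶠ_; _⇒ᶠ_; ⊥ᶠ; linarith)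

  x₀ : ∀ {k} → Term (1 + k)
  x₀ = ′ zero
  x₁ : ∀ {k} → Term (2 + k)
  x₁ = ′ suc zero
  x₂ : ∀ {k} → Term (3 + k)
  x₂ = ′ suc (suc zero)
  x₃ : ∀ {k} → Term (4 + k)
  x₃ = ′ suc (suc (suc zero))
  x₄ : ∀ {k} → Term (5 + k)
  x₄ = ′ suc (suc (suc (suc zero)))
  x₅ : ∀ {k} → Term (6 + k)
  x₅ = ′ suc (suc (suc (suc (suc zero))))
  x₆ : ∀ {k} → Term (7 + k)
  x₆ = ′ suc (suc (suc (suc (suc (suc zero)))))

  -- Positions x and y on the cycle of length n + n are at distance d.
  Apart : ℕ → ℕ → ℕ → ℕ → Set
  Apart n x y d = d ≤ n × (x + d ≡ y ⊎ y + d ≡ x ⊎ x + d ≡ y + (n + n) ⊎ y + d ≡ x + (n + n))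

  apartᶠ : ∀ {k} → Term k → Term k → Term k → Term k → Formula k
  apartᶠ n x y d = d ≤ᶠ n ∧ᶠ (x ⊕ d ≡ᶠ y ∨ᶠ y ⊕ d ≡ᶠ x ∨ᶠ x ⊕ d ≡ᶠ y ⊕ (n ⊕ n) ∨ᶠ y ⊕ d ≡ᶠ x ⊕ (n ⊕ n))

  onCycle : ∀ {k} → Term k → Term k → Formula k
  onCycle n x = x <ᶠ n ⊕ n

  apart-unique : ∀ n x y d e → x < n + n → y < n + n → Apart n x y d → Apart n x y e → d ≡ e
  apart-unique n x y d e = linarith
    (onCycle x₀ x₁ ⇒ᶠ onCycle x₀ x₂ ⇒ᶠ apartᶠ x₀ x₁ x₂ x₃ ⇒ᶠ apartᶠ x₀ x₁ x₂ x₄ ⇒ᶠ x₃ ≡ᶠ x₄)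
    refl (n ∷ x ∷ y ∷ d ∷ e ∷ [])

  apart-sym : ∀ n x y d → Apart n x y d → Apart n y x d
  apart-sym n x y d = linarith (apartᶠ x₀ x₁ x₂ x₃ ⇒ᶠ apartᶠ x₀ x₂ x₁ x₃) refl (n ∷ x ∷ y ∷ d ∷ [])

  apart-triangle : ∀ n x y z a b c → Apart n x y a → Apart n y z b → Apart n x z c → c ≤ a + b
  apart-triangle n x y z a b c = linarith
    (apartᶠ x₀ x₁ x₂ x₄ ⇒ᶠ apartᶠ x₀ x₂ x₃ x₅ ⇒ᶠ apartᶠ x₀ x₁ x₃ x₆ ⇒ᶠ x₆ ≤ᶠ x₄ ⊕ x₅)
    refl (n ∷ x ∷ y ∷ z ∷ a ∷ b ∷ c ∷ [])

  apart-zero : ∀ n x y → x < n + n → y < n + n → Apart n x y 0 → x ≡ y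
  apart-zero n x y = linarith
    (onCycle x₀ x₁ ⇒ᶠ onCycle x₀ x₂ ⇒ᶠ apartᶠ x₀ x₁ x₂ (lit 0) ⇒ᶠ x₁ ≡ᶠ x₂) refl (n ∷ x ∷ y ∷ [])

  -- s′ is the position of s after rotating p to the origin.
  Rotated : ℕ → ℕ → ℕ → ℕ → Set
  Rotated n p s s′ = s′ < n + n × (s′ + p ≡ s ⊎ s′ + p ≡ s + (n + n))

  rotatedᶠ : ∀ {k} → Term k → Term k → Term k → Term k → Formula k
  rotatedᶠ n p s s′ = onCycle n s′ ∧ᶠ (s′ ⊕ p ≡ᶠ s ∨ᶠ s′ ⊕ p ≡ᶠ s ⊕ (n ⊕ n))

  apart-rotate : ∀ n p s t s′ t′ d → s < n + n → t < n + n → Rotated n p s s′ → Rotated n p t t′ →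
    Apart n s t d → Apart n s′ t′ d
  apart-rotate n p s t s′ t′ d = linarith
    (onCycle x₀ x₂ ⇒ᶠ onCycle x₀ x₃ ⇒ᶠ rotatedᶠ x₀ x₁ x₂ x₄ ⇒ᶠ rotatedᶠ x₀ x₁ x₃ x₅ ⇒ᶠ
      apartᶠ x₀ x₂ x₃ x₆ ⇒ᶠ apartᶠ x₀ x₄ x₅ x₆)
    refl (n ∷ p ∷ s ∷ t ∷ s′ ∷ t′ ∷ d ∷ [])

  -- Negation modulo `n + n`; 0 is a case of its own because its image is 0 and not `n + n`.
  Reflected : ℕ → ℕ → ℕ → Set
  Reflected n s s′ = (s ≡ 0 × s′ ≡ 0) ⊎ (1 ≤ s × 1 ≤ s′ × s + s′ ≡ n + n)

  reflectedᶠ : ∀ {k} → Term k → Term k → Term k → Formula k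
  reflectedᶠ n s s′ = (s ≡ᶠ lit 0 ∧ᶠ s′ ≡ᶠ lit 0) ∨ᶠ (lit 1 ≤ᶠ s ∧ᶠ lit 1 ≤ᶠ s′ ∧ᶠ s ⊕ s′ ≡ᶠ n ⊕ n)

  apart-reflect : ∀ n s t s′ t′ d → Reflected n s s′ → Reflected n t t′ → Apart n s t d → Apart n s′ t′ d
  apart-reflect n s t s′ t′ d = linarith
    (reflectedᶠ x₀ x₁ x₃ ⇒ᶠ reflectedᶠ x₀ x₂ x₄ ⇒ᶠ apartᶠ x₀ x₁ x₂ x₅ ⇒ᶠ apartᶠ x₀ x₃ x₄ x₅)
    refl (n ∷ s ∷ t ∷ s′ ∷ t′ ∷ d ∷ [])

  betweenᶠ : ∀ {k} → Term k → Term k → Term k → Term k → Term k → Term k → Term k → Formula k → Formula k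
  betweenᶠ n x y z a b c f =
    onCycle n x ⇒ᶠ onCycle n y ⇒ᶠ onCycle n z ⇒ᶠ apartᶠ n x z a ⇒ᶠ apartᶠ n z y b ⇒ᶠ apartᶠ n x y c ⇒ᶠ f

  Between : ℕ → (ℕ → ℕ → ℕ → ℕ → ℕ → ℕ → Set) → Set
  Between n P = ∀ x y z a b c → x < n + n → y < n + n → z < n + n →
    Apart n x z a → Apart n z y b → Apart n x y c → P x y z a b c

  -- The bound on `y` is strict because between antipodal vertices both arcs are geodesics; the
  -- converse `short-arc⇐` holds for antipodal ones too.
  short-arc⇒ : ∀ n → Between n λ x y z a b c → x ≤ y → y < x + n → a + b ≡ c → x ≤ z × z ≤ y
  short-arc⇒ n x y z a b c = linarith
    (betweenᶠ x₀ x₁ x₂ x₃ x₄ x₅ x₆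
      (x₁ ≤ᶠ x₂ ⇒ᶠ x₂ <ᶠ x₁ ⊕ x₀ ⇒ᶠ x₄ ⊕ x₅ ≡ᶠ x₆ ⇒ᶠ x₁ ≤ᶠ x₃ ∧ᶠ x₃ ≤ᶠ x₂))
    refl (n ∷ x ∷ y ∷ z ∷ a ∷ b ∷ c ∷ [])

  short-arc⇐ : ∀ n → Between n λ x y z a b c → y ≤ x + n → x ≤ z → z ≤ y → a + b ≡ c
  short-arc⇐ n x y z a b c = linarith
    (betweenᶠ x₀ x₁ x₂ x₃ x₄ x₅ x₆
      (x₂ ≤ᶠ x₁ ⊕ x₀ ⇒ᶠ x₁ ≤ᶠ x₃ ⇒ᶠ x₃ ≤ᶠ x₂ ⇒ᶠ x₄ ⊕ x₅ ≡ᶠ x₆))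
    refl (n ∷ x ∷ y ∷ z ∷ a ∷ b ∷ c ∷ [])

  long-arc⇒ : ∀ n → Between n λ x y z a b c → x + n < y → a + b ≡ c → z ≤ x ⊎ y ≤ z
  long-arc⇒ n x y z a b c = linarith
    (betweenᶠ x₀ x₁ x₂ x₃ x₄ x₅ x₆ (x₁ ⊕ x₀ <ᶠ x₂ ⇒ᶠ x₄ ⊕ x₅ ≡ᶠ x₆ ⇒ᶠ x₃ ≤ᶠ x₁ ∨ᶠ x₂ ≤ᶠ x₃))
    refl (n ∷ x ∷ y ∷ z ∷ a ∷ b ∷ c ∷ [])

  long-arc⇐ : ∀ n → Between n λ x y z a b c → x + n ≤ y → z ≤ x ⊎ y ≤ z → a + b ≡ c
  long-arc⇐ n x y z a b c = linarith
    (betweenᶠ x₀ x₁ x₂ x₃ x₄ x₅ x₆ (x₁ ⊕ x₀ ≤ᶠ x₂ ⇒ᶠ x₃ ≤ᶠ x₁ ∨ᶠ x₂ ≤ᶠ x₃ ⇒ᶠ x₄ ⊕ x₅ ≡ᶠ x₆))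
    refl (n ∷ x ∷ y ∷ z ∷ a ∷ b ∷ c ∷ [])

  fold : ℕ → ℕ → ℕ
  fold n e with n ≤? e
  ... | yes _ = (n + n) ∸ e
  ... | no  _ = e

  gap : ∀ x y → x + ∣ x - y ∣ ≡ y ⊎ y + ∣ x - y ∣ ≡ x
  gap x y with ≤-total x y
  ... | inj₁ le = inj₁ (trans (cong (x +_) (m≤n⇒∣m-n∣≡n∸m le)) (m+[n∸m]≡n le))
  ... | inj₂ le = inj₂ (trans (cong (y +_) (m≤n⇒∣n-m∣≡n∸m le)) (m+[n∸m]≡n le))

  circular : ℕ → ℕ → ℕ → ℕ
  circular n x y = fold n ∣ x - y ∣

  apart-circular : ∀ n x y → x < n + n → y < n + n → Apart n x y (circular n x y)
  apart-circular n x y x< y< with n ≤? ∣ x - y ∣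
  ... | no ¬p = near n x y ∣ x - y ∣ (<⇒≤ (≰⇒> ¬p)) (gap x y)
    where
    near : ∀ n x y e → e ≤ n → x + e ≡ y ⊎ y + e ≡ x → Apart n x y e
    near n x y e = linarith
      (x₃ ≤ᶠ x₀ ⇒ᶠ x₁ ⊕ x₃ ≡ᶠ x₂ ∨ᶠ x₂ ⊕ x₃ ≡ᶠ x₁ ⇒ᶠ apartᶠ x₀ x₁ x₂ x₃) refl (n ∷ x ∷ y ∷ e ∷ [])
  ... | yes p = far n x y ∣ x - y ∣ _ p (gap x y) (m+[n∸m]≡n (bound n x y ∣ x - y ∣ x< y< (gap x y)))
    where
    bound : ∀ n x y e → x < n + n → y < n + n → x + e ≡ y ⊎ y + e ≡ x → e ≤ n + n
    bound n x y e = linarith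
      (onCycle x₀ x₁ ⇒ᶠ onCycle x₀ x₂ ⇒ᶠ x₁ ⊕ x₃ ≡ᶠ x₂ ∨ᶠ x₂ ⊕ x₃ ≡ᶠ x₁ ⇒ᶠ x₃ ≤ᶠ x₀ ⊕ x₀)
      refl (n ∷ x ∷ y ∷ e ∷ [])
    far : ∀ n x y e d → n ≤ e → x + e ≡ y ⊎ y + e ≡ x → e + d ≡ n + n → Apart n x y d
    far n x y e d = linarith
      (x₀ ≤ᶠ x₃ ⇒ᶠ x₁ ⊕ x₃ ≡ᶠ x₂ ∨ᶠ x₂ ⊕ x₃ ≡ᶠ x₁ ⇒ᶠ x₃ ⊕ x₄ ≡ᶠ x₀ ⊕ x₀ ⇒ᶠ apartᶠ x₀ x₁ x₂ x₄)
      refl (n ∷ x ∷ y ∷ e ∷ d ∷ [])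

module Cycle (m : ℕ) where

  open CyclePositions

  C : Set
  C = Fin (cycLen m)

  n : ℕ
  n = 2 + m

  cycLen≡n+n : cycLen m ≡ n + n
  cycLen≡n+n = eq m
    where
    eq : ∀ m → 4 + (m + (m + 0)) ≡ (2 + m) + (2 + m)
    eq m = linarith (lit 4 ⊕ (x₀ ⊕ (x₀ ⊕ lit 0)) ≡ᶠ (lit 2 ⊕ x₀) ⊕ (lit 2 ⊕ x₀)) refl (m ∷ [])

  toℕ<n+n : (a : C) → toℕ a < n + n
  toℕ<n+n a = subst (toℕ a <_) cycLen≡n+n (toℕ<n a)

  -- All later facts about `cd` rest on `apart` alone.
  abstract

    cd : C → C → ℕ
    cd a b = circular n (toℕ a) (toℕ b)

    apart : ∀ a b → Apart n (toℕ a) (toℕ b) (cd a b)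
    apart a b = apart-circular n (toℕ a) (toℕ b) (toℕ<n+n a) (toℕ<n+n b)

  cd-sym : ∀ a b → cd a b ≡ cd b a
  cd-sym a b = apart-unique n (toℕ a) (toℕ b) _ _ (toℕ<n+n a) (toℕ<n+n b) (apart a b)
    (apart-sym n _ _ _ (apart b a))

  cd-triangle : ∀ a b c → cd a c ≤ cd a b + cd b c
  cd-triangle a b c = apart-triangle n _ _ _ _ _ _ (apart a b) (apart b c) (apart a c)

  cd-refl : ∀ a → cd a a ≡ 0
  cd-refl a = apart-unique n (toℕ a) (toℕ a) _ _ (toℕ<n+n a) (toℕ<n+n a) (apart a a)
    (z≤n , inj₁ (+-identityʳ _))

  cd-zero : ∀ a b → cd a b ≡ 0 → a ≡ b
  cd-zero a b e = toℕ-injective (apart-zero n (toℕ a) (toℕ b) (toℕ<n+n a) (toℕ<n+n b)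
    (subst (Apart n (toℕ a) (toℕ b)) e (apart a b)))

  -- Charts and metric triangles on an even cycle

  bt : C → C → C → Set
  bt a b t = cd a t + cd t b ≡ cd a b

  bt-sym : ∀ {a b t} → bt a b t → bt b a t
  bt-sym {a} {b} {t} e = trans (cong₂ _+_ (cd-sym b t) (cd-sym t a)) (trans (+-comm (cd t b) (cd a t))
    (trans e (cd-sym a b)))

  bt-left : ∀ a b → bt a b a
  bt-left a b = cong (_+ cd a b) (cd-refl a)

  bt-right : ∀ a b → bt a b b
  bt-right a b = trans (cong (cd a b +_) (cd-refl b)) (+-identityʳ _)

  -- Starting point and direction of the numbering are left open, so that a triangle may be assumed
  -- to start at position 0 and to run upwards; `forward` and `backward` provide both directions.
  record Chart (p : C) : Set where
    field
      pos      : C → ℕ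
      pos<     : ∀ a → pos a < n + n
      pos-inj  : ∀ {a b} → pos a ≡ pos b → a ≡ b
      pos-surj : ∀ k → k < n + n → ∃[ a ] pos a ≡ k
      pos-base : pos p ≡ 0
      pos-cd   : ∀ a b → Apart n (pos a) (pos b) (cd a b)

    short⇒ : ∀ {a b t} → pos a ≤ pos b → pos b < pos a + n → bt a b t → pos a ≤ pos t × pos t ≤ pos b
    short⇒ {a} {b} {t} = short-arc⇒ n _ _ _ _ _ _ (pos< a) (pos< b) (pos< t) (pos-cd a t) (pos-cd t b) (pos-cd a b)

    short⇐ : ∀ {a b t} → pos b ≤ pos a + n → pos a ≤ pos t → pos t ≤ pos b → bt a b t
    short⇐ {a} {b} {t} = short-arc⇐ n _ _ _ _ _ _ (pos< a) (pos< b) (pos< t) (pos-cd a t) (pos-cd t b) (pos-cd a b)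

    long⇒ : ∀ {a b t} → pos a + n < pos b → bt a b t → pos t ≤ pos a ⊎ pos b ≤ pos t
    long⇒ {a} {b} {t} = long-arc⇒ n _ _ _ _ _ _ (pos< a) (pos< b) (pos< t) (pos-cd a t) (pos-cd t b) (pos-cd a b)

    long⇐ : ∀ {a b t} → pos a + n ≤ pos b → pos t ≤ pos a ⊎ pos b ≤ pos t → bt a b t
    long⇐ {a} {b} {t} = long-arc⇐ n _ _ _ _ _ _ (pos< a) (pos< b) (pos< t) (pos-cd a t) (pos-cd t b) (pos-cd a b)

  at-ℕ : ∀ k → k < n + n → ∃[ a ] toℕ {cycLen m} a ≡ k
  at-ℕ k k< = fromℕ< lt , toℕ-fromℕ< lt
    where lt = subst (k <_) (sym cycLen≡n+n) k<

  rotate : ∀ p s → p < n + n → s < n + n → ∃[ s′ ] Rotated n p s s′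
  rotate p s p< s< with p ≤? s
  ... | yes le = s ∸ p , ≤-<-trans (m∸n≤m s p) s< , inj₁ (m∸n+n≡m le)
  ... | no ¬le = (n + n ∸ p) + s , lt n p s _ (≰⇒> ¬le) e , inj₂ (eq n p s _ e)
    where
    e : p + (n + n ∸ p) ≡ n + n
    e = m+[n∸m]≡n (<⇒≤ p<)
    lt : ∀ n p s d → s < p → p + d ≡ n + n → d + s < n + n
    lt n p s d = linarith (x₂ <ᶠ x₁ ⇒ᶠ x₁ ⊕ x₃ ≡ᶠ x₀ ⊕ x₀ ⇒ᶠ x₃ ⊕ x₂ <ᶠ x₀ ⊕ x₀) refl (n ∷ p ∷ s ∷ d ∷ [])
    eq : ∀ n p s d → p + d ≡ n + n → d + s + p ≡ s + (n + n)
    eq n p s d = linarith (x₁ ⊕ x₃ ≡ᶠ x₀ ⊕ x₀ ⇒ᶠ x₃ ⊕ x₂ ⊕ x₁ ≡ᶠ x₂ ⊕ (x₀ ⊕ x₀)) refl (n ∷ p ∷ s ∷ d ∷ [])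

  unrotate : ∀ p k → p < n + n → k < n + n → ∃[ s ] (s < n + n × Rotated n p s k)
  unrotate p k p< k< with k + p <? n + n
  ... | yes lt = k + p , lt , k< , inj₁ refl
  ... | no ¬lt = k + p ∸ (n + n) , lt n p k _ k< p< e , k< , inj₂ (sym e)
    where
    e : k + p ∸ (n + n) + (n + n) ≡ k + p
    e = m∸n+n≡m (≮⇒≥ ¬lt)
    lt : ∀ n p k d → k < n + n → p < n + n → d + (n + n) ≡ k + p → d < n + n
    lt n p k d = linarith (onCycle x₀ x₂ ⇒ᶠ onCycle x₀ x₁ ⇒ᶠ x₃ ⊕ (x₀ ⊕ x₀) ≡ᶠ x₂ ⊕ x₁ ⇒ᶠ onCycle x₀ x₃)
      refl (n ∷ p ∷ k ∷ d ∷ [])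

  rotated-unique : ∀ n p s t s′ → s < n + n → t < n + n → Rotated n p s s′ → Rotated n p t s′ → s ≡ t
  rotated-unique n p s t s′ = linarith
    (onCycle x₀ x₂ ⇒ᶠ onCycle x₀ x₃ ⇒ᶠ rotatedᶠ x₀ x₁ x₂ x₄ ⇒ᶠ rotatedᶠ x₀ x₁ x₃ x₄ ⇒ᶠ x₂ ≡ᶠ x₃)
    refl (n ∷ p ∷ s ∷ t ∷ s′ ∷ [])

  rotated-functional : ∀ n p s s′ s″ → s < n + n → Rotated n p s s′ → Rotated n p s s″ → s′ ≡ s″
  rotated-functional n p s s′ s″ = linarith
    (onCycle x₀ x₂ ⇒ᶠ rotatedᶠ x₀ x₁ x₂ x₃ ⇒ᶠ rotatedᶠ x₀ x₁ x₂ x₄ ⇒ᶠ x₃ ≡ᶠ x₄)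
    refl (n ∷ p ∷ s ∷ s′ ∷ s″ ∷ [])

  forward : ∀ p → Chart p
  forward p = record
    { pos      = pos
    ; pos<     = λ a → proj₁ (rotated a)
    ; pos-inj  = λ {a} {b} e → toℕ-injective (rotated-unique n _ _ _ (pos b) (toℕ<n+n a) (toℕ<n+n b)
                   (subst (Rotated n (toℕ p) (toℕ a)) e (rotated a)) (rotated b))
    ; pos-surj = λ k k< → let (s , s< , r) = unrotate (toℕ p) k (toℕ<n+n p) k<
                              (a , e) = at-ℕ s s<
                          in a , rotated-functional n (toℕ p) (toℕ a) _ _ (toℕ<n+n a) (rotated a)
                                   (subst (λ s → Rotated n (toℕ p) s k) (sym e) r)
    ; pos-base = rotated-functional n (toℕ p) (toℕ p) _ _ (toℕ<n+n p) (rotated p) (s≤s z≤n , inj₁ refl)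
    ; pos-cd   = λ a b → apart-rotate n (toℕ p) _ _ _ _ _ (toℕ<n+n a) (toℕ<n+n b) (rotated a) (rotated b) (apart a b)
    }
    where
    pos : C → ℕ
    pos a = proj₁ (rotate (toℕ p) (toℕ a) (toℕ<n+n p) (toℕ<n+n a))
    rotated : ∀ a → Rotated n (toℕ p) (toℕ a) (pos a)
    rotated a = proj₂ (rotate (toℕ p) (toℕ a) (toℕ<n+n p) (toℕ<n+n a))

  reflectℕ : ∀ k → k < n + n → ∃[ k′ ] (k′ < n + n × Reflected n k k′)
  reflectℕ zero    k< = 0 , k< , inj₁ (refl , refl)
  reflectℕ (suc k) k< = n + n ∸ suc k , ∸-monoʳ-< (s≤s z≤n) (<⇒≤ k<) ,
    inj₂ (s≤s z≤n , m<n⇒0<n∸m k< , m+[n∸m]≡n (<⇒≤ k<))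

  reflected-sym : ∀ {n s t} → Reflected n s t → Reflected n t s
  reflected-sym (inj₁ (a , b)) = inj₁ (b , a)
  reflected-sym {n} {s} {t} (inj₂ (a , b , c)) = inj₂ (b , a , trans (+-comm t s) c)

  reflected-functional : ∀ n s t t′ → Reflected n s t → Reflected n s t′ → t ≡ t′
  reflected-functional n s t t′ = linarith
    (reflectedᶠ x₀ x₁ x₂ ⇒ᶠ reflectedᶠ x₀ x₁ x₃ ⇒ᶠ x₂ ≡ᶠ x₃) refl (n ∷ s ∷ t ∷ t′ ∷ [])

  backward : ∀ {p} → Chart p → Chart p
  backward {p} ch = record
    { pos      = pos′
    ; pos<     = λ a → proj₁ (proj₂ (refl′ a))
    ; pos-inj  = λ {a} {b} e → pos-inj (reflected-functional n (pos′ b) _ _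
                   (subst (λ k → Reflected n k (pos a)) e (reflected-sym {n} (reflected a))) (reflected-sym {n} (reflected b)))
    ; pos-surj = λ k k< → let (k′ , k′< , r) = reflectℕ k k<
                              (a , e) = pos-surj k′ k′<
                          in a , reflected-functional n (pos a) _ _ (reflected a)
                                   (subst (λ s → Reflected n s k) (sym e) (reflected-sym {n} r))
    ; pos-base = reflected-functional n (pos p) _ _ (reflected p) (inj₁ (pos-base , refl))
    ; pos-cd   = λ a b → apart-reflect n _ _ _ _ _ (reflected a) (reflected b) (pos-cd a b)
    }
    where
    open Chart ch
    refl′ : ∀ a → ∃[ k′ ] (k′ < n + n × Reflected n (pos a) k′)
    refl′ a = reflectℕ (pos a) (pos< a)
    pos′ : C → ℕ
    pos′ a = proj₁ (refl′ a)
    reflected : ∀ a → Reflected n (pos a) (pos′ a)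
    reflected a = proj₂ (proj₂ (refl′ a))

  Metric : C → C → C → Set
  Metric a b c = (∀ t → bt a b t → bt b c t → t ≡ b)
               × (∀ t → bt b c t → bt c a t → t ≡ c)
               × (∀ t → bt c a t → bt a b t → t ≡ a)

  metric-rotate : ∀ {a b c} → Metric a b c → Metric b c a
  metric-rotate (f , g , h) = g , h , f

  metric-collapse : ∀ {a b c} → Metric a b c → a ≡ b → b ≡ c
  metric-collapse {a} {c = c} (_ , g , _) refl = g a (bt-left a c) (bt-right c a)

  metric-distinct : ∀ {a b c} → Metric a b c → a ≢ b → b ≢ c
  metric-distinct {b = b} M a≢b refl = a≢b (sym (metric-collapse (metric-rotate M) refl))

  -- Each of the three arcs, including the one from `c` to `a` past the origin, is shorter than `n`:
  -- no half of the cycle contains all three vertices. This characterises the metric triangles with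
  -- distinct vertices.
  Ordered : ∀ {p} → Chart p → C → C → C → Set
  Ordered ch a b c = pos a < pos b × pos b < pos a + n × pos a + n < pos c × pos c < pos b + n
    where open Chart ch

  ordered⇒metric : ∀ {p} (ch : Chart p) {a b c} → Ordered ch a b c → Metric a b c
  ordered⇒metric ch {a} {b} {c} (a<b , b< , <c , c<) =
      (λ t ab bc → pos-inj (≤-antisym (proj₂ (inAB ab)) (proj₁ (inBC bc))))
    , (λ t bc ca → pos-inj (case-ca (inCA ca) (λ le → ⊥-elim (<⇒≱ a<b (≤-trans (proj₁ (inBC bc)) le)))
                                             (λ le → ≤-antisym (proj₂ (inBC bc)) le)))
    , (λ t ca ab → pos-inj (case-ca (inCA ca) (λ le → ≤-antisym le (proj₁ (inAB ab)))
                                             (λ le → ⊥-elim (<⇒≱ (<-trans b< <c) (≤-trans le (proj₂ (inAB ab)))))))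
    where
    open Chart ch
    b<c = <-trans b< <c
    inAB : ∀ {t} → bt a b t → pos a ≤ pos t × pos t ≤ pos b
    inAB = short⇒ (<⇒≤ a<b) b<
    inBC : ∀ {t} → bt b c t → pos b ≤ pos t × pos t ≤ pos c
    inBC = short⇒ (<⇒≤ b<c) c<
    inCA : ∀ {t} → bt c a t → pos t ≤ pos a ⊎ pos c ≤ pos t
    inCA h = long⇒ <c (bt-sym h)
    case-ca : ∀ {A B R : Set} → A ⊎ B → (A → R) → (B → R) → R
    case-ca (inj₁ x) f g = f x
    case-ca (inj₂ y) f g = g y

  -- If an arc between two of the vertices had length at least `n`, the complementary arc would be a
  -- geodesic through the third vertex, which the metric condition would then identify with an end.
  -- The chart is reversed if `c` precedes `b`.
  metric⇒ordered : ∀ {a b c} → Metric a b c → a ≢ b → Σ (Chart a) λ ch → Ordered ch a b c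
  metric⇒ordered {a} {b} {c} M a≢b = orient (forward a)
    where
    b≢c = metric-distinct M a≢b
    c≢a = metric-distinct (metric-rotate M) b≢c
    order : (ch : Chart a) → Chart.pos ch b < Chart.pos ch c → Ordered ch a b c
    order ch b<c = a<b , b<n , n<c , c<
      where
      open Chart ch
      a<b : pos a < pos b
      a<b = ≤∧≢⇒< (subst (_≤ pos b) (sym pos-base) z≤n) (λ e → a≢b (pos-inj e))
      b<n : pos b < pos a + n
      b<n with pos b <? pos a + n
      ... | yes p = p
      ... | no ¬p = ⊥-elim (b≢c (sym (proj₁ M c (long⇐ (≮⇒≥ ¬p) (inj₂ (<⇒≤ b<c))) (bt-right b c))))
      n<c : pos a + n < pos c
      n<c with pos a + n <? pos c
      ... | yes p = p
      ... | no ¬p = ⊥-elim (b≢c (proj₁ (proj₂ M) b (bt-left b c)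
                      (bt-sym (short⇐ (≮⇒≥ ¬p) (<⇒≤ a<b) (<⇒≤ b<c)))))
      c< : pos c < pos b + n
      c< with pos c <? pos b + n
      ... | yes p = p
      ... | no ¬p = ⊥-elim (a≢b (proj₁ M a (bt-left a b) (long⇐ (≮⇒≥ ¬p) (inj₁ (<⇒≤ a<b)))))
    orient : Chart a → Σ (Chart a) λ ch → Ordered ch a b c
    orient ch with <-cmp (Chart.pos ch b) (Chart.pos ch c)
    ... | tri< lt _ _ = ch , order ch lt
    ... | tri≈ _ e _  = ⊥-elim (b≢c (Chart.pos-inj ch e))
    ... | tri> _ _ gt = backward ch , order (backward ch) (reverse gt)
      where
      reverse : Chart.pos ch c < Chart.pos ch b → Chart.pos (backward ch) b < Chart.pos (backward ch) c
      reverse lt = reversed n _ _ _ _ (reflection b) (reflection c)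
        (≤∧≢⇒< z≤n (λ e → c≢a (Chart.pos-inj ch (trans (sym e) (sym (Chart.pos-base ch)))))) lt
        where
        reflection : ∀ t → Reflected n (Chart.pos ch t) (Chart.pos (backward ch) t)
        reflection t = proj₂ (proj₂ (reflectℕ (Chart.pos ch t) (Chart.pos< ch t)))
        reversed : ∀ n s t s′ t′ → Reflected n s s′ → Reflected n t t′ → 1 ≤ t → t < s → s′ < t′
        reversed n s t s′ t′ = linarith
          (reflectedᶠ x₀ x₁ x₃ ⇒ᶠ reflectedᶠ x₀ x₂ x₄ ⇒ᶠ lit 1 ≤ᶠ x₂ ⇒ᶠ x₂ <ᶠ x₁ ⇒ᶠ x₃ <ᶠ x₄)
          refl (n ∷ s ∷ t ∷ s′ ∷ t′ ∷ [])

  -- In the facts below positions are relative to the first vertex, which has position 0.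
  step-to-triangle : ∀ {a b c α} → Metric a b c → a ≢ b → cd a α ≡ 1 → bt a b α →
    (Metric α b c × α ≢ b) ⊎ bt α c b
  step-to-triangle {a} {b} {c} {α} M a≢b aα abα = go (proj₁ o) (proj₂ o)
    where
    o = metric⇒ordered M a≢b
    go : (ch : Chart a) → Ordered ch a b c → (Metric α b c × α ≢ b) ⊎ bt α c b
    go ch (a<b , b< , <c , c<) = split (pos c ≤? pos α + n)
      where
      open Chart ch
      α≤b = proj₂ (short⇒ (<⇒≤ a<b) b< abα)
      α≡1 : pos α ≡ 1
      α≡1 = one n (pos a) (pos α) (pos b) pos-base (pos< α) b< α≤b
              (subst (Apart n (pos a) (pos α)) aα (pos-cd a α))
        where
        one : ∀ n x y z → x ≡ 0 → y < n + n → z < x + n → y ≤ z → Apart n x y 1 → y ≡ 1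
        one n x y z = linarith
          (x₁ ≡ᶠ lit 0 ⇒ᶠ onCycle x₀ x₂ ⇒ᶠ x₃ <ᶠ x₁ ⊕ x₀ ⇒ᶠ x₂ ≤ᶠ x₃ ⇒ᶠ apartᶠ x₀ x₁ x₂ (lit 1) ⇒ᶠ x₂ ≡ᶠ lit 1)
          refl (n ∷ x ∷ y ∷ z ∷ [])
      α<b : pos α < pos b
      α<b = lem n (pos a) (pos α) (pos b) (pos c) pos-base α≡1 <c c<
        where
        lem : ∀ n a α b c → a ≡ 0 → α ≡ 1 → a + n < c → c < b + n → α < b
        lem n a α b c = linarith
          (x₁ ≡ᶠ lit 0 ⇒ᶠ x₂ ≡ᶠ lit 1 ⇒ᶠ x₁ ⊕ x₀ <ᶠ x₄ ⇒ᶠ x₄ <ᶠ x₃ ⊕ x₀ ⇒ᶠ x₂ <ᶠ x₃)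
          refl (n ∷ a ∷ α ∷ b ∷ c ∷ [])
      b<α+n : pos b < pos α + n
      b<α+n = ≤-trans b< (+-monoˡ-≤ n (≤-trans (≤-reflexive pos-base) z≤n))
      split : Dec (pos c ≤ pos α + n) → (Metric α b c × α ≢ b) ⊎ bt α c b
      -- As `pos α` is 1 and `pos c` exceeds `n`, this is the case in which `c` is antipodal to `α`.
      split (yes le) = inj₂ (short⇐ le α≤b (<⇒≤ (<-trans b< <c)))
      split (no ¬le) = inj₁ (ordered⇒metric ch (α<b , b<α+n , ≰⇒> ¬le , c<) , λ e → <⇒≢ α<b (cong pos e))

  triangle-cover : ∀ {a b c} → Metric a b c → a ≢ b → ∀ t → bt a b t ⊎ bt b c t ⊎ bt c a t
  triangle-cover {a} {b} {c} M a≢b t = go (proj₁ o) (proj₂ o)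
    where
    o = metric⇒ordered M a≢b
    go : (ch : Chart a) → Ordered ch a b c → bt a b t ⊎ bt b c t ⊎ bt c a t
    go ch (a<b , b< , <c , c<) = split (≤-total (pos t) (pos b)) (≤-total (pos t) (pos c))
      where
      open Chart ch
      split : pos t ≤ pos b ⊎ pos b ≤ pos t → pos t ≤ pos c ⊎ pos c ≤ pos t → bt a b t ⊎ bt b c t ⊎ bt c a t
      split (inj₁ le) _         = inj₁ (short⇐ (<⇒≤ b<) (subst (_≤ pos t) (sym pos-base) z≤n) le)
      split (inj₂ ge) (inj₁ le) = inj₂ (inj₁ (short⇐ (<⇒≤ c<) ge le))
      split (inj₂ _)  (inj₂ ge) = inj₂ (inj₂ (bt-sym (long⇐ (<⇒≤ <c) (inj₂ ge))))

  -- The arc from `a` to `b` is shorter than `n`, so the interval is a single path, on which the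
  -- distance from `a` determines the vertex.
  arc-unique : ∀ {a b c t t′} → Metric a b c → a ≢ b → bt a b t → bt a b t′ → cd a t ≡ cd a t′ → t ≡ t′
  arc-unique {a} {b} {c} {t} {t′} M a≢b h h′ e = go (proj₁ o) (proj₂ o)
    where
    o = metric⇒ordered M a≢b
    go : (ch : Chart a) → Ordered ch a b c → t ≡ t′
    go ch (a<b , b< , _ , _) = pos-inj (lem n (pos a) (pos b) (pos t) (pos t′) (cd a t)
          pos-base b< (proj₂ (short⇒ (<⇒≤ a<b) b< h)) (proj₂ (short⇒ (<⇒≤ a<b) b< h′))
          (pos-cd a t) (subst (Apart n (pos a) (pos t′)) (sym e) (pos-cd a t′)))
      where
      open Chart ch
      lem : ∀ n a b t t′ d → a ≡ 0 → b < a + n → t ≤ b → t′ ≤ b → Apart n a t d → Apart n a t′ d → t ≡ t′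
      lem n a b t t′ d = linarith
        (x₁ ≡ᶠ lit 0 ⇒ᶠ x₂ <ᶠ x₁ ⊕ x₀ ⇒ᶠ x₃ ≤ᶠ x₂ ⇒ᶠ x₄ ≤ᶠ x₂ ⇒ᶠ apartᶠ x₀ x₁ x₃ x₅ ⇒ᶠ apartᶠ x₀ x₁ x₄ x₅ ⇒ᶠ
          x₃ ≡ᶠ x₄) refl (n ∷ a ∷ b ∷ t ∷ t′ ∷ d ∷ [])

  -- Peano's axiom for a metric triangle y v w; the point it requires between v and w can be taken to be v or w.
  cycle-peano : ∀ {u v w x y} → Metric y v w → bt u v x → bt w x y → bt u v y ⊎ bt u w y
  cycle-peano {u} {v} {w} {x} {y} M uvx wxy = start (y Data.Fin.≟ v)
    where
    go : (ch : Chart y) → Ordered ch y v w → bt u v y ⊎ bt u w y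
    go ch (y<v , v< , <w , w<) = split (pos u + n ≤? pos w) (pos v + n ≤? pos u)
      where
      open Chart ch
      y≤ : ∀ t → pos y ≤ pos t
      y≤ t = subst (_≤ pos t) (sym pos-base) z≤n
      -- A geodesic from `w` to `x` through `y` runs upwards past the origin, so `x` comes at most
      -- `n` steps after `w`.
      x-near : pos x + n ≤ pos w
      x-near = cases (pos w ≤? pos x) (pos x + n ≤? pos w)
        where
        lem : ∀ n y w x → y ≡ 0 → y + n < w → x < n + n → x < w + n
        lem n y w x = linarith (x₁ ≡ᶠ lit 0 ⇒ᶠ x₁ ⊕ x₀ <ᶠ x₂ ⇒ᶠ onCycle x₀ x₃ ⇒ᶠ x₃ <ᶠ x₂ ⊕ x₀)
          refl (n ∷ y ∷ w ∷ x ∷ [])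
        cases : Dec (pos w ≤ pos x) → Dec (pos x + n ≤ pos w) → pos x + n ≤ pos w
        cases _         (yes p) = p
        cases (yes w≤x) (no _)  = ⊥-elim (<⇒≱ (≤-<-trans (m≤m+n (pos y) n) <w)
          (proj₁ (short⇒ w≤x (lem n (pos y) (pos w) (pos x) pos-base <w (pos< x)) wxy)))
        cases (no w≰x)  (no ¬p) = ≤-trans (+-monoˡ-≤ n
          (proj₁ (short⇒ (<⇒≤ (≰⇒> w≰x)) (≰⇒> ¬p) (bt-sym wxy)))) (<⇒≤ <w)
      split : Dec (pos u + n ≤ pos w) → Dec (pos v + n ≤ pos u) → bt u v y ⊎ bt u w y
      split (yes p) _       = inj₂ (long⇐ p (inj₁ (y≤ u)))
      split (no _)  (yes q) = inj₁ (bt-sym (long⇐ q (inj₁ (y≤ v))))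
      -- Now `u` and `v` both come after `x` and are less than `n` apart, so `x` cannot lie between
      -- them.
      split (no ¬p) (no ¬q) = ⊥-elim (contradict (≤-total (pos u) (pos v)))
        where
        x-before : ∀ n v x w → w < v + n → x + n ≤ w → x < v
        x-before n v x w = linarith (x₃ <ᶠ x₁ ⊕ x₀ ⇒ᶠ x₂ ⊕ x₀ ≤ᶠ x₃ ⇒ᶠ x₂ <ᶠ x₁) refl (n ∷ v ∷ x ∷ w ∷ [])
        contradict : pos u ≤ pos v ⊎ pos v ≤ pos u → ⊥
        contradict (inj₁ u≤v) = <⇒≱ (x-before n (pos u) (pos x) (pos w) (≰⇒> ¬p) x-near)
          (proj₁ (short⇒ u≤v (<-≤-trans v< (+-monoˡ-≤ n (y≤ u))) uvx))
        contradict (inj₂ v≤u) = <⇒≱ (x-before n (pos v) (pos x) (pos w) w< x-near)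
          (proj₁ (short⇒ v≤u (≰⇒> ¬q) (bt-sym uvx)))
    start : Dec (y ≡ v) → bt u v y ⊎ bt u w y
    start (yes refl) = inj₁ (bt-right u v)
    start (no y≢v)   = let (ch , o) = metric⇒ordered M y≢v in go ch o

  -- These are the vertices that `local-gate` asks for: the neighbours of `p`, the antipode `far` of
  -- `p`, and the antipode `beforeFar` of `prev`, which is the neighbour of `far` on the side of
  -- `next`.
  record Cross (p : C) : Set where
    field
      next prev far beforeFar : C
      next-adjacent : cd p next ≡ 1
      prev-adjacent : cd p prev ≡ 1
      all-far       : ∀ t → bt p far t
      before-next   : bt p beforeFar next
      all-before    : ∀ t → bt prev beforeFar t
      far-unique    : ∀ z → bt p z next → bt p z prev → z ≡ far
      towards       : ∀ b → p ≢ b → bt p b next ⊎ bt p b prev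

  2≤n : 2 ≤ n
  2≤n = s≤s (s≤s z≤n)

  module _ {p : C} (ch : Chart p) where

    open Chart ch

    private
      p≤ : ∀ t → pos p ≤ pos t
      p≤ t = subst (_≤ pos t) (sym pos-base) z≤n

    cross-at : ∀ next prev far beforeFar → pos next ≡ 1 → pos prev + 1 ≡ n + n → pos far ≡ n →
      pos beforeFar + 1 ≡ n → Cross p
    cross-at next prev far beforeFar next≡ prev≡ far≡ before≡ = record
      { next = next ; prev = prev ; far = far ; beforeFar = beforeFar
      ; next-adjacent = apart-unique n (pos p) (pos next) _ 1 (pos< p) (pos< next) (pos-cd p next)
          (near n (pos p) (pos next) 2≤n pos-base next≡)
      ; prev-adjacent = apart-unique n (pos p) (pos prev) _ 1 (pos< p) (pos< prev) (pos-cd p prev)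
          (near′ n (pos p) (pos prev) 2≤n pos-base prev≡)
      ; all-far       = λ t → all-far t (≤-total (pos t) (pos far))
      ; before-next   = short⇐ (proj₁ before) (p≤ next) (proj₂ before)
      ; all-before    = λ t → bt-sym (all-before t (≤-total (pos t) (pos beforeFar)))
      ; far-unique    = λ z h h′ → far-unique z h h′ (<-cmp (pos z) (pos far))
      ; towards       = λ b p≢b → towards b p≢b (≤-total (pos b) (pos p + n))
      }
      where
      near : ∀ n p x → 2 ≤ n → p ≡ 0 → x ≡ 1 → Apart n p x 1
      near n p x = linarith (lit 2 ≤ᶠ x₀ ⇒ᶠ x₁ ≡ᶠ lit 0 ⇒ᶠ x₂ ≡ᶠ lit 1 ⇒ᶠ apartᶠ x₀ x₁ x₂ (lit 1))
        refl (n ∷ p ∷ x ∷ [])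
      near′ : ∀ n p x → 2 ≤ n → p ≡ 0 → x + 1 ≡ n + n → Apart n p x 1
      near′ n p x = linarith (lit 2 ≤ᶠ x₀ ⇒ᶠ x₁ ≡ᶠ lit 0 ⇒ᶠ x₂ ⊕ lit 1 ≡ᶠ x₀ ⊕ x₀ ⇒ᶠ apartᶠ x₀ x₁ x₂ (lit 1))
        refl (n ∷ p ∷ x ∷ [])
      p+n≡far : pos p + n ≡ pos far
      p+n≡far = trans (cong (_+ n) pos-base) (sym far≡)
      before+n≡prev : pos beforeFar + n ≡ pos prev
      before+n≡prev = lem n (pos beforeFar) (pos prev) before≡ prev≡
        where
        lem : ∀ n b q → b + 1 ≡ n → q + 1 ≡ n + n → b + n ≡ q
        lem n b q = linarith (x₁ ⊕ lit 1 ≡ᶠ x₀ ⇒ᶠ x₂ ⊕ lit 1 ≡ᶠ x₀ ⊕ x₀ ⇒ᶠ x₁ ⊕ x₀ ≡ᶠ x₂) refl (n ∷ b ∷ q ∷ [])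
      before : pos beforeFar ≤ pos p + n × pos next ≤ pos beforeFar
      before = lem n (pos p) (pos next) (pos beforeFar) 2≤n next≡ before≡
        where
        lem : ∀ n p x b → 2 ≤ n → x ≡ 1 → b + 1 ≡ n → b ≤ p + n × x ≤ b
        lem n p x b = linarith
          (lit 2 ≤ᶠ x₀ ⇒ᶠ x₂ ≡ᶠ lit 1 ⇒ᶠ x₃ ⊕ lit 1 ≡ᶠ x₀ ⇒ᶠ x₃ ≤ᶠ x₁ ⊕ x₀ ∧ᶠ x₂ ≤ᶠ x₃) refl (n ∷ p ∷ x ∷ b ∷ [])
      prev-last : ∀ t → pos t ≤ pos prev
      prev-last t = lem n (pos t) (pos prev) (pos< t) prev≡
        where
        lem : ∀ n t q → t < n + n → q + 1 ≡ n + n → t ≤ q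
        lem n t q = linarith (onCycle x₀ x₁ ⇒ᶠ x₂ ⊕ lit 1 ≡ᶠ x₀ ⊕ x₀ ⇒ᶠ x₁ ≤ᶠ x₂) refl (n ∷ t ∷ q ∷ [])
      all-far : ∀ t → pos t ≤ pos far ⊎ pos far ≤ pos t → bt p far t
      all-far t (inj₁ le) = short⇐ (≤-reflexive (sym p+n≡far)) (p≤ t) le
      all-far t (inj₂ ge) = long⇐ (≤-reflexive p+n≡far) (inj₂ ge)
      all-before : ∀ t → pos t ≤ pos beforeFar ⊎ pos beforeFar ≤ pos t → bt beforeFar prev t
      all-before t (inj₁ le) = long⇐ (≤-reflexive before+n≡prev) (inj₁ le)
      all-before t (inj₂ ge) = short⇐ (≤-reflexive (sym before+n≡prev)) ge (prev-last t)
      far-unique : ∀ z → bt p z next → bt p z prev → Tri (pos z < pos far) (pos z ≡ pos far) (pos far < pos z) → z ≡ far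
      far-unique z h h′ (tri≈ _ e _)  = pos-inj e
      far-unique z h h′ (tri< lt _ _) = ⊥-elim (lem n (pos z) (pos far) (pos prev) 2≤n lt far≡ prev≡
        (proj₂ (short⇒ (p≤ z) (<-≤-trans lt (≤-reflexive (sym p+n≡far))) h′)))
        where
        lem : ∀ n z f q → 2 ≤ n → z < f → f ≡ n → q + 1 ≡ n + n → q ≤ z → ⊥
        lem n z f q = linarith
          (lit 2 ≤ᶠ x₀ ⇒ᶠ x₁ <ᶠ x₂ ⇒ᶠ x₂ ≡ᶠ x₀ ⇒ᶠ x₃ ⊕ lit 1 ≡ᶠ x₀ ⊕ x₀ ⇒ᶠ x₃ ≤ᶠ x₁ ⇒ᶠ ⊥ᶠ) refl (n ∷ z ∷ f ∷ q ∷ [])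
      far-unique z h h′ (tri> _ _ gt) = ⊥-elim (lem n (pos p) (pos z) (pos far) (pos next) 2≤n pos-base gt far≡ next≡
        (long⇒ (≤-<-trans (≤-reflexive p+n≡far) gt) h))
        where
        lem : ∀ n p z f x → 2 ≤ n → p ≡ 0 → f < z → f ≡ n → x ≡ 1 → x ≤ p ⊎ z ≤ x → ⊥
        lem n p z f x = linarith
          (lit 2 ≤ᶠ x₀ ⇒ᶠ x₁ ≡ᶠ lit 0 ⇒ᶠ x₃ <ᶠ x₂ ⇒ᶠ x₃ ≡ᶠ x₀ ⇒ᶠ x₄ ≡ᶠ lit 1 ⇒ᶠ x₄ ≤ᶠ x₁ ∨ᶠ x₂ ≤ᶠ x₄ ⇒ᶠ ⊥ᶠ)
          refl (n ∷ p ∷ z ∷ f ∷ x ∷ [])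
      towards : ∀ b → p ≢ b → pos b ≤ pos p + n ⊎ pos p + n ≤ pos b → bt p b next ⊎ bt p b prev
      towards b p≢b (inj₁ le) = inj₁ (short⇐ le (p≤ next) (≤-trans (≤-reflexive next≡)
                                  (≤∧≢⇒< z≤n (λ e → p≢b (pos-inj (trans pos-base e))))))
      towards b p≢b (inj₂ ge) = inj₂ (long⇐ ge (inj₂ (prev-last b)))

    chart⇒cross : Cross p
    chart⇒cross =
      let (next , next≡) = pos-surj 1 (<-≤-trans 2≤n (m≤m+n n n))
          -- Since `n` is `2 + m`, the last position `n + n - 1` is `suc m + n`, and `n - 1` is
          -- `suc m`.
          (prev , prev≡) = pos-surj (suc m + n) ≤-refl
          (far  , far≡)  = pos-surj n (m<m+n n (s≤s z≤n))
          (before , before≡) = pos-surj (suc m) (m≤m+n n n)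
      in cross-at next prev far before next≡ (trans (+-comm _ 1) (cong suc prev≡)) far≡ (trans (+-comm _ 1) (cong suc before≡))

  cross : ∀ p → Cross p
  cross p = chart⇒cross (forward p)

  step-towards : ∀ a b {k} → cd a b ≡ suc k → ∃[ a′ ] (cd a a′ ≡ 1 × cd a′ b ≡ k)
  step-towards a b {k} e = choose (towards b λ { refl → 0≢1+n (trans (sym (cd-refl a)) e) })
    where
    open Cross (cross a)
    closer : ∀ a′ → cd a a′ ≡ 1 → bt a b a′ → cd a′ b ≡ k
    closer a′ e′ h = suc-injective (trans (cong (_+ cd a′ b) (sym e′)) (trans h e))
    choose : bt a b next ⊎ bt a b prev → ∃[ a′ ] (cd a a′ ≡ 1 × cd a′ b ≡ k)
    choose (inj₁ h) = next , next-adjacent , closer next next-adjacent h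
    choose (inj₂ h) = prev , prev-adjacent , closer prev prev-adjacent h

  -- Adjacency in the cycle as distance one

  suc-cases : ∀ (a : C) → suc (toℕ a) % cycLen m ≡ suc (toℕ a) ⊎
    (suc (toℕ a) ≡ n + n × suc (toℕ a) % cycLen m ≡ 0)
  suc-cases a with suc (toℕ a) <? cycLen m
  ... | yes lt = inj₁ (m<n⇒m%n≡m lt)
  ... | no ¬lt = inj₂ (trans e cycLen≡n+n , trans (cong (_% cycLen m) e) (n%n≡0 (cycLen m)))
    where e = ≤-antisym (toℕ<n a) (≮⇒≥ ¬lt)

  succ⇒cd : ∀ a b → toℕ b ≡ suc (toℕ a) % cycLen m → cd a b ≡ 1
  succ⇒cd a b e = apart-unique n (toℕ a) (toℕ b) _ 1 (toℕ<n+n a) (toℕ<n+n b) (apart a b) (s≤s z≤n , go (suc-cases a))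
    where
    go : _ → toℕ a + 1 ≡ toℕ b ⊎ toℕ b + 1 ≡ toℕ a ⊎ toℕ a + 1 ≡ toℕ b + (n + n) ⊎ toℕ b + 1 ≡ toℕ a + (n + n)
    go (inj₁ e₁)        = inj₁ (trans (+-comm _ 1) (sym (trans e e₁)))
    go (inj₂ (e₁ , e₂)) = inj₂ (inj₂ (inj₁ (trans (+-comm _ 1) (trans e₁ (sym (cong (_+ (n + n)) (trans e e₂)))))))

  adjacent⇒cd : ∀ a b → CycAdj m a b → cd a b ≡ 1
  adjacent⇒cd a b (inj₁ e) = succ⇒cd a b e
  adjacent⇒cd a b (inj₂ e) = trans (cd-sym a b) (succ⇒cd b a e)

  position⇒succ : ∀ a b → toℕ a + 1 ≡ toℕ b ⊎ toℕ a + 1 ≡ toℕ b + (n + n) → toℕ b ≡ suc (toℕ a) % cycLen m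
  position⇒succ a b (inj₁ p) = sym (trans (m<n⇒m%n≡m (subst (_< cycLen m) (sym q) (toℕ<n b))) q)
    where q = trans (+-comm 1 _) p
  position⇒succ a b (inj₂ p) = trans (proj₂ e) (sym (trans (cong (_% cycLen m) (trans (proj₁ e) (sym cycLen≡n+n)))
                                 (n%n≡0 (cycLen m))))
    where
    lem : ∀ n a b → a < n + n → a + 1 ≡ b + (n + n) → 1 + a ≡ n + n × b ≡ 0
    lem n a b = linarith
      (onCycle x₀ x₁ ⇒ᶠ x₁ ⊕ lit 1 ≡ᶠ x₂ ⊕ (x₀ ⊕ x₀) ⇒ᶠ lit 1 ⊕ x₁ ≡ᶠ x₀ ⊕ x₀ ∧ᶠ x₂ ≡ᶠ lit 0)
      refl (n ∷ a ∷ b ∷ [])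
    e = lem n (toℕ a) (toℕ b) (toℕ<n+n a) p

  cd⇒adjacent : ∀ a b → cd a b ≡ 1 → CycAdj m a b
  cd⇒adjacent a b e with subst (Apart n (toℕ a) (toℕ b)) e (apart a b)
  ... | _ , inj₁ p               = inj₁ (position⇒succ a b (inj₁ p))
  ... | _ , inj₂ (inj₁ p)        = inj₂ (position⇒succ b a (inj₁ p))
  ... | _ , inj₂ (inj₂ (inj₁ p)) = inj₁ (position⇒succ a b (inj₂ p))
  ... | _ , inj₂ (inj₂ (inj₂ p)) = inj₂ (position⇒succ b a (inj₂ p))

-- Products of even cycles

open Cycle using (cd; bt; Metric; Cross; bt-sym; bt-left; bt-right; metric-rotate)

Coord : (ms : List ℕ) → Fin (length ms) → Set
Coord ms i = Fin (cycLen (ms ! i))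

infixl 9 _∙_
_∙_ : ∀ {ms} → TorusV ms → (i : Fin (length ms)) → Coord ms i
_∙_ {m ∷ ms} (a , u) zero    = a
_∙_ {m ∷ ms} (a , u) (suc i) = u ∙ i

infixl 9 _[_≔_]
_[_≔_] : ∀ {ms} → TorusV ms → (i : Fin (length ms)) → Coord ms i → TorusV ms
_[_≔_] {m ∷ ms} (a , u) zero    τ = τ , u
_[_≔_] {m ∷ ms} (a , u) (suc i) τ = a , u [ i ≔ τ ]

coord-ext : ∀ {ms} {s t : TorusV ms} → (∀ i → s ∙ i ≡ t ∙ i) → s ≡ t
coord-ext {[]}     {tt}    {tt}    h = refl
coord-ext {m ∷ ms} {a , u} {b , v} h = cong₂ _,_ (h zero) (coord-ext (λ i → h (suc i)))

updated : ∀ {ms} (s : TorusV ms) i τ → s [ i ≔ τ ] ∙ i ≡ τ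
updated {m ∷ ms} s zero    τ = refl
updated {m ∷ ms} s (suc i) τ = updated (proj₂ s) i τ

unchanged : ∀ {ms} (s : TorusV ms) {i j} τ → i ≢ j → s [ i ≔ τ ] ∙ j ≡ s ∙ j
unchanged {m ∷ ms} s {zero}  {zero}  τ ne = ⊥-elim (ne refl)
unchanged {m ∷ ms} s {zero}  {suc j} τ ne = refl
unchanged {m ∷ ms} s {suc i} {zero}  τ ne = refl
unchanged {m ∷ ms} s {suc i} {suc j} τ ne = unchanged (proj₂ s) τ (λ e → ne (cong suc e))

is-update : ∀ {ms} {s r : TorusV ms} {i τ} → r ∙ i ≡ τ → (∀ j → i ≢ j → r ∙ j ≡ s ∙ j) → r ≡ s [ i ≔ τ ]
is-update {s = s} {r} {i} {τ} e h = coord-ext go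
  where
  go : ∀ j → r ∙ j ≡ s [ i ≔ τ ] ∙ j
  go j with i Fin.≟ j
  ... | yes refl = trans e (sym (updated s i τ))
  ... | no  i≢j  = trans (h j i≢j) (sym (unchanged s τ i≢j))

update-self : ∀ {ms} (s : TorusV ms) i → s [ i ≔ s ∙ i ] ≡ s
update-self s i = sym (is-update refl (λ _ _ → refl))

dT : ∀ {ms} → TorusV ms → TorusV ms → ℕ
dT {[]}     _       _       = 0
dT {m ∷ ms} (a , u) (b , v) = cd m a b + dT u v

dT-refl : ∀ {ms} (s : TorusV ms) → dT s s ≡ 0
dT-refl {[]}     s       = refl
dT-refl {m ∷ ms} (a , u) = cong₂ _+_ (Cycle.cd-refl m a) (dT-refl u)

dT-zero : ∀ {ms} (s t : TorusV ms) → dT s t ≡ 0 → s ≡ t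
dT-zero {[]}     tt      tt      e = refl
dT-zero {m ∷ ms} (a , u) (b , v) e =
  cong₂ _,_ (Cycle.cd-zero m a b (m+n≡0⇒m≡0 _ e)) (dT-zero u v (m+n≡0⇒n≡0 (cd m a b) e))

dT-triangle : ∀ {ms} (s t r : TorusV ms) → dT s r ≤ dT s t + dT t r
dT-triangle {[]}     s       t       r       = z≤n
dT-triangle {m ∷ ms} (a , u) (b , v) (c , w) = ≤-trans
  (+-mono-≤ (Cycle.cd-triangle m a b c) (dT-triangle u v w))
  (≤-reflexive (interchange (cd m a b) (cd m b c) (dT u v) (dT v w)))

dT-update : ∀ {ms} (s : TorusV ms) i σ τ → dT (s [ i ≔ σ ]) (s [ i ≔ τ ]) ≡ cd (ms ! i) σ τ
dT-update {m ∷ ms} (a , u) zero    σ τ = trans (cong (cd m σ τ +_) (dT-refl u)) (+-identityʳ _)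
dT-update {m ∷ ms} (a , u) (suc i) σ τ = trans (cong (_+ dT (u [ i ≔ σ ]) (u [ i ≔ τ ])) (Cycle.cd-refl m a))
  (dT-update u i σ τ)

dT-update-self : ∀ {ms} (s : TorusV ms) i τ → dT s (s [ i ≔ τ ]) ≡ cd (ms ! i) (s ∙ i) τ
dT-update-self s i τ = trans (cong (λ r → dT r (s [ i ≔ τ ])) (sym (update-self s i))) (dT-update s i _ τ)

BtT : ∀ {ms} → TorusV ms → TorusV ms → TorusV ms → Set
BtT s t r = dT s r + dT r t ≡ dT s t

+-tight : ∀ {a b x y} → a ≤ x → b ≤ y → x + y ≡ a + b → x ≡ a × y ≡ b
+-tight {a} {b} {x} {y} a≤x b≤y e = x≡a , +-cancelˡ-≡ a _ _ (trans (cong (_+ y) (sym x≡a)) e)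
  where
  x≡a : x ≡ a
  x≡a = ≤-antisym (+-cancelʳ-≤ b x a (≤-trans (+-monoʳ-≤ x b≤y) (≤-reflexive e))) a≤x

-- The triangle inequality holds in each coordinate, so equality of the sums forces equality in
-- every summand.
btT-coord : ∀ {ms} {s t r : TorusV ms} → BtT s t r → ∀ i → bt (ms ! i) (s ∙ i) (t ∙ i) (r ∙ i)
btT-coord {m ∷ ms} {a , u} {b , v} {c , w} e i = go i
  where
  both : cd m a c + cd m c b ≡ cd m a b × dT u w + dT w v ≡ dT u v
  both = +-tight (Cycle.cd-triangle m a c b) (dT-triangle u w v)
    (trans (sym (interchange (cd m a c) (dT u w) (cd m c b) (dT w v))) e)
  go : ∀ i → bt ((m ∷ ms) ! i) ((a , u) ∙ i) ((b , v) ∙ i) ((c , w) ∙ i)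
  go zero    = proj₁ both
  go (suc i) = btT-coord {s = u} {v} {w} (proj₂ both) i

coord-btT : ∀ {ms} {s t r : TorusV ms} → (∀ i → bt (ms ! i) (s ∙ i) (t ∙ i) (r ∙ i)) → BtT s t r
coord-btT {[]}     h = refl
coord-btT {m ∷ ms} {a , u} {b , v} {c , w} h =
  trans (interchange (cd m a c) (dT u w) (cd m c b) (dT w v))
        (cong₂ _+_ (h zero) (coord-btT {s = u} {v} {w} (λ i → h (suc i))))

endpoints-btT : ∀ {ms} {s t r : TorusV ms} → (∀ i → r ∙ i ≡ s ∙ i ⊎ r ∙ i ≡ t ∙ i) → BtT s t r
endpoints-btT {ms} {s} {t} {r} h = coord-btT {s = s} {t} {r} λ i → go i (h i)
  where
  go : ∀ i → r ∙ i ≡ s ∙ i ⊎ r ∙ i ≡ t ∙ i → bt (ms ! i) (s ∙ i) (t ∙ i) (r ∙ i)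
  go i (inj₁ e) = subst (bt (ms ! i) (s ∙ i) (t ∙ i)) (sym e) (Cycle.bt-left (ms ! i) (s ∙ i) (t ∙ i))
  go i (inj₂ e) = subst (bt (ms ! i) (s ∙ i) (t ∙ i)) (sym e) (Cycle.bt-right (ms ! i) (s ∙ i) (t ∙ i))

edge⇒update : ∀ {ms} {s t : TorusV ms} → TorusE ms s t → ∃[ i ] Σ (Coord ms i) λ τ →
  t ≡ s [ i ≔ τ ] × cd (ms ! i) (s ∙ i) τ ≡ 1
edge⇒update {m ∷ ms} {a , u} {b , v} (inj₁ (e , refl)) = zero , b , refl , Cycle.adjacent⇒cd m a b e
edge⇒update {m ∷ ms} {a , u} {b , v} (inj₂ (refl , e)) =
  let (i , τ , e₁ , e₂) = edge⇒update e in suc i , τ , cong (a ,_) e₁ , e₂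

update⇒edge : ∀ {ms} (s : TorusV ms) i τ → cd (ms ! i) (s ∙ i) τ ≡ 1 → TorusE ms s (s [ i ≔ τ ])
update⇒edge {m ∷ ms} (a , u) zero    τ e = inj₁ (Cycle.cd⇒adjacent m a τ e , refl)
update⇒edge {m ∷ ms} (a , u) (suc i) τ e = inj₂ (refl , update⇒edge u i τ e)

edge⇒dT : ∀ {ms} {s t : TorusV ms} → TorusE ms s t → dT s t ≡ 1
edge⇒dT {s = s} e with edge⇒update e
... | i , τ , refl , e′ = trans (dT-update-self s i τ) e′

torus-step : ∀ {ms} (s t : TorusV ms) {k} → dT s t ≡ suc k → ∃[ s′ ] (TorusE ms s s′ × dT s′ t ≡ k)
torus-step {m ∷ ms} (a , u) (b , v) {k} e with cd m a b in eq
... | suc l = let (a′ , e₁ , e₂) = Cycle.step-towards m a b eq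
              in (a′ , u) , inj₁ (Cycle.cd⇒adjacent m a a′ e₁ , refl) ,
                 trans (cong (_+ dT u v) e₂) (suc-injective e)
... | zero  = let (u′ , e₁ , e₂) = torus-step u v e
              in (a , u′) , inj₂ (refl , e₁) , trans (cong (_+ dT u′ v) eq) e₂

any-torus? : ∀ {ms} {P : TorusV ms → Set} → (∀ t → Dec (P t)) → Dec (∃[ t ] P t)
any-torus? {[]}     P? = map′ (tt ,_) proj₂ (P? tt)
any-torus? {m ∷ ms} P? = map′ (λ (a , u , p) → (a , u) , p) (λ ((a , u) , p) → a , u , p)
  (Fin.any? λ a → any-torus? λ u → P? (a , u))

-- One coordinate at a time: `(b , v)` lies between `(a , v)`, reached by induction within the slice
-- at `a`, and `(b , u)`, which is a hypothesis.
torus-hull : ∀ {ms} (P : TorusV ms → Set) → (∀ s t r → BtT s t r → P s → P t → P r) →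
  ∀ p t → P p → (∀ i → P (p [ i ≔ t ∙ i ])) → P t
torus-hull {[]}     P closed tt      tt      Pp h = Pp
torus-hull {m ∷ ms} P closed (a , u) (b , v) Pp h =
  closed (a , v) (b , u) (b , v)
    (endpoints-btT {s = a , v} {b , u} {b , v} λ { zero → inj₂ refl ; (suc i) → inj₁ refl })
    (torus-hull (λ w → P (a , w))
      (λ s t r e → closed (a , s) (a , t) (a , r) (trans (cong₂ _+_ (cong (_+ dT s r) (Cycle.cd-refl m a))
        (cong (_+ dT r t) (Cycle.cd-refl m a))) (trans e (cong (_+ dT s t) (sym (Cycle.cd-refl m a))))))
      u v Pp (λ i → h (suc i)))
    (h zero)

tabulateT : ∀ {ms} → (∀ i → Coord ms i) → TorusV ms
tabulateT {[]}     h = tt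
tabulateT {m ∷ ms} h = h zero , tabulateT {ms} (λ i → h (suc i))

coord-tabulate : ∀ {ms} (h : ∀ i → Coord ms i) i → tabulateT {ms} h ∙ i ≡ h i
coord-tabulate {m ∷ ms} h zero    = refl
coord-tabulate {m ∷ ms} h (suc i) = coord-tabulate {ms} (λ i → h (suc i)) i

fibre-btT : ∀ {ms} (s : TorusV ms) i {x y τ : Coord ms i} → bt (ms ! i) x y τ →
  BtT (s [ i ≔ x ]) (s [ i ≔ y ]) (s [ i ≔ τ ])
fibre-btT {ms} s i {x} {y} {τ} h = coord-btT {s = s [ i ≔ x ]} {s [ i ≔ y ]} {s [ i ≔ τ ]} go
  where
  go : ∀ j → bt (ms ! j) (s [ i ≔ x ] ∙ j) (s [ i ≔ y ] ∙ j) (s [ i ≔ τ ] ∙ j)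
  go j with i Fin.≟ j
  ... | yes refl rewrite updated s i x | updated s i y | updated s i τ = h
  ... | no  i≢j  rewrite unchanged s x i≢j | unchanged s y i≢j | unchanged s τ i≢j = Cycle.bt-left (ms ! j) _ _

update-update : ∀ {ms} (s : TorusV ms) i σ τ → s [ i ≔ σ ] [ i ≔ τ ] ≡ s [ i ≔ τ ]
update-update s i σ τ = is-update (updated (s [ i ≔ σ ]) i τ)
  (λ j i≢j → trans (unchanged (s [ i ≔ σ ]) τ i≢j) (unchanged s σ i≢j))

dT-update-both : ∀ {ms} (s t : TorusV ms) i σ τ →
  dT (s [ i ≔ σ ]) (t [ i ≔ σ ]) ≡ dT (s [ i ≔ τ ]) (t [ i ≔ τ ])
dT-update-both {m ∷ ms} (a , u) (b , v) zero    σ τ =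
  cong (_+ dT u v) (trans (Cycle.cd-refl m σ) (sym (Cycle.cd-refl m τ)))
dT-update-both {m ∷ ms} (a , u) (b , v) (suc i) σ τ = cong (cd m a b +_) (dT-update-both u v i σ τ)

bt-degenerate : ∀ m {a t} → bt m a a t → t ≡ a
bt-degenerate m {a} {t} e = sym (Cycle.cd-zero m a t (m+n≡0⇒m≡0 _ (trans e (Cycle.cd-refl m a))))

MetricT : ∀ {ms} → TorusV ms → TorusV ms → TorusV ms → Set
MetricT {ms} a b c = ∀ i → Metric (ms ! i) (a ∙ i) (b ∙ i) (c ∙ i)

-- S is the trace on a torus of a retract of the ambient graph, and ρ the retraction followed by a choice of coordinates.
module Trace {ms : List ℕ} (S : TorusV ms → Set) (ρ : TorusV ms → TorusV ms)
  (retract : ∀ {s s′ t} → S s → S s′ → BtT s s′ t → S (ρ t) × dT s (ρ t) ≡ dT s t × dT (ρ t) s′ ≡ dT t s′)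
  (advance : ∀ {s s′} → S s → S s′ → s ≢ s′ → ∃[ s₁ ] (S s₁ × TorusE ms s s₁ × BtT s s′ s₁))
  where

  retract-btT : ∀ {s s′ t} → S s → S s′ → BtT s s′ t → BtT s s′ (ρ t)
  retract-btT Ss Ss′ h = let (_ , e , e′) = retract Ss Ss′ h in trans (cong₂ _+_ e e′) h

  -- The point `s [ i ≔ s′ ∙ i ]` lies between `s` and `s′` and between `s` and `s″`, hence so does
  -- its image under `ρ`. The last hypothesis confines the image to direction `i`, and there its
  -- distance from `s`, which `ρ` preserves, makes it the point itself.
  extend : ∀ {s s′ s″ : TorusV ms} i → S s → S s′ → S s″ → bt (ms ! i) (s ∙ i) (s″ ∙ i) (s′ ∙ i) →
    (∀ j → i ≢ j → ∀ τ → bt (ms ! j) (s ∙ j) (s′ ∙ j) τ → bt (ms ! j) (s ∙ j) (s″ ∙ j) τ → τ ≡ s ∙ j) →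
    S (s [ i ≔ s′ ∙ i ])
  extend {s} {s′} {s″} i Ss Ss′ Ss″ hi hj = subst S r≡t (proj₁ (retract Ss Ss′ h′))
    where
    t = s [ i ≔ s′ ∙ i ]
    r = ρ t
    h′ : BtT s s′ t
    h′ = endpoints-btT {s = s} {s′} {t} go
      where
      go : ∀ j → t ∙ j ≡ s ∙ j ⊎ t ∙ j ≡ s′ ∙ j
      go j with i Fin.≟ j
      ... | yes refl = inj₂ (updated s i _)
      ... | no  i≢j  = inj₁ (unchanged s _ i≢j)
    h″ : BtT s s″ t
    h″ = coord-btT {s = s} {s″} {t} go
      where
      go : ∀ j → bt (ms ! j) (s ∙ j) (s″ ∙ j) (t ∙ j)
      go j with i Fin.≟ j
      ... | yes refl = subst (bt (ms ! i) (s ∙ i) (s″ ∙ i)) (sym (updated s i _)) hi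
      ... | no  i≢j  = subst (bt (ms ! j) (s ∙ j) (s″ ∙ j)) (sym (unchanged s _ i≢j)) (bt-left (ms ! j) _ _)
    b′ = btT-coord {s = s} {s′} {r} (retract-btT Ss Ss′ h′)
    b″ = btT-coord {s = s} {s″} {r} (retract-btT Ss Ss″ h″)
    r≡ : r ≡ s [ i ≔ r ∙ i ]
    r≡ = is-update refl (λ j i≢j → hj j i≢j (r ∙ j) (b′ j) (b″ j))
    same : cd (ms ! i) (s ∙ i) (r ∙ i) ≡ cd (ms ! i) (s ∙ i) (s′ ∙ i)
    same = trans (sym (dT-update-self s i (r ∙ i))) (trans (cong (dT s) (sym r≡))
             (trans (proj₁ (proj₂ (retract Ss Ss′ h′))) (dT-update-self s i (s′ ∙ i))))
    r≡t : r ≡ t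
    r≡t = trans r≡ (cong (s [ i ≔_]) (Cycle.cd-zero (ms ! i) _ _
      (m+n≡0⇒n≡0 0 (+-cancelˡ-≡ (cd (ms ! i) (s ∙ i) (s′ ∙ i)) _ 0
        (trans (cong (_+ cd (ms ! i) (r ∙ i) (s′ ∙ i)) (sym same)) (trans (b′ i) (sym (+-identityʳ _))))))))

  -- The new point lies between `c` and each of `a` and `a [ i ≔ b ∙ i ]`, and so does its image
  -- under `ρ`; this forces coordinate `i` of the image. The point is then between `a` and its
  -- image, yet both are equally far from `a`.
  third-corner : ∀ {a b c : TorusV ms} i → S a → S (a [ i ≔ b ∙ i ]) → S c →
    (∀ τ → bt (ms ! i) (b ∙ i) (c ∙ i) τ → bt (ms ! i) (a ∙ i) (c ∙ i) τ → τ ≡ c ∙ i) → S (a [ i ≔ c ∙ i ])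
  third-corner {a} {b} {c} i Sa Sb Sc hi = subst S r≡t (proj₁ (retract Sa Sc h))
    where
    b′ = a [ i ≔ b ∙ i ]
    t = a [ i ≔ c ∙ i ]
    r = ρ t
    h : BtT a c t
    h = endpoints-btT {s = a} {c} {t} go
      where
      go : ∀ j → t ∙ j ≡ a ∙ j ⊎ t ∙ j ≡ c ∙ j
      go j with i Fin.≟ j
      ... | yes refl = inj₂ (updated a i _)
      ... | no  i≢j  = inj₁ (unchanged a _ i≢j)
    h′ : BtT b′ c t
    h′ = endpoints-btT {s = b′} {c} {t} go
      where
      go : ∀ j → t ∙ j ≡ b′ ∙ j ⊎ t ∙ j ≡ c ∙ j
      go j with i Fin.≟ j
      ... | yes refl = inj₂ (updated a i _)
      ... | no  i≢j  = inj₁ (trans (unchanged a _ i≢j) (sym (unchanged a _ i≢j)))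
    ri≡ : r ∙ i ≡ c ∙ i
    ri≡ = hi (r ∙ i)
      (subst (λ x → bt (ms ! i) x (c ∙ i) (r ∙ i)) (updated a i _) (btT-coord {s = b′} {c} {r} (retract-btT Sb Sc h′) i))
      (btT-coord {s = a} {c} {r} (retract-btT Sa Sc h) i)
    bt-q : BtT a r t
    bt-q = endpoints-btT {s = a} {r} {t} go
      where
      go : ∀ j → t ∙ j ≡ a ∙ j ⊎ t ∙ j ≡ r ∙ j
      go j with i Fin.≟ j
      ... | yes refl = inj₂ (trans (updated a i _) (sym ri≡))
      ... | no  i≢j  = inj₁ (unchanged a _ i≢j)
    r≡t : r ≡ t
    r≡t = sym (dT-zero t r (+-cancelˡ-≡ (dT a t) _ 0
      (trans bt-q (trans (proj₁ (proj₂ (retract Sa Sc h))) (sym (+-identityʳ _))))))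

  -- The image under `ρ` stays in the fibre and keeps its distance from the end at `x`. The metric
  -- triangle makes the arc shorter than half the cycle, so this determines the point.
  arc : ∀ {a : TorusV ms} i {x y z τ : Coord ms i} → Metric (ms ! i) x y z → x ≢ y → S (a [ i ≔ x ]) → S (a [ i ≔ y ]) →
    bt (ms ! i) x y τ → S (a [ i ≔ τ ])
  arc {a} i {x} {y} {z} {τ} M x≢y Sx Sy b = subst S r≡t (proj₁ (retract Sx Sy h))
    where
    t = a [ i ≔ τ ]
    r = ρ t
    h : BtT (a [ i ≔ x ]) (a [ i ≔ y ]) t
    h = fibre-btT a i b
    br = btT-coord {s = a [ i ≔ x ]} {a [ i ≔ y ]} {r} (retract-btT Sx Sy h)
    r≡ : r ≡ a [ i ≔ r ∙ i ]
    r≡ = is-update refl (λ j i≢j → bt-degenerate (ms ! j)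
      (subst₂ (λ p q → bt (ms ! j) p q (r ∙ j)) (unchanged a x i≢j) (unchanged a y i≢j) (br j)))
    r≡t : r ≡ t
    r≡t = trans r≡ (cong (a [ i ≔_]) (Cycle.arc-unique (ms ! i) M x≢y
      (subst₂ (λ p q → bt (ms ! i) p q (r ∙ i)) (updated a i x) (updated a i y) (br i)) b
      (trans (sym (dT-update a i x (r ∙ i))) (trans (cong (dT (a [ i ≔ x ])) (sym r≡))
        (trans (proj₁ (proj₂ (retract Sx Sy h))) (dT-update a i x τ))))))

  fibre : ∀ {a : TorusV ms} i {x y z : Coord ms i} → Metric (ms ! i) x y z → x ≢ y → S (a [ i ≔ x ]) → S (a [ i ≔ y ]) → S (a [ i ≔ z ]) →
    ∀ τ → S (a [ i ≔ τ ])
  fibre {a} i {x} {y} {z} M x≢y Sx Sy Sz τ = go (Cycle.triangle-cover m M x≢y τ)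
    where
    m = ms ! i
    M′ = Cycle.metric-rotate m M
    y≢z = Cycle.metric-distinct m M x≢y
    go : bt m x y τ ⊎ bt m y z τ ⊎ bt m z x τ → S (a [ i ≔ τ ])
    go (inj₁ h)        = arc i M x≢y Sx Sy h
    go (inj₂ (inj₁ h)) = arc i M′ y≢z Sy Sz h
    go (inj₂ (inj₂ h)) = arc i (Cycle.metric-rotate m M′) (Cycle.metric-distinct m M′ y≢z) Sz Sx h

  -- A third corner `c` imposes no further condition: by `metric-collapse` it agrees with `a`
  -- wherever `b` does.
  Box : TorusV ms → TorusV ms → TorusV ms → Set
  Box a b t = ∀ i → a ∙ i ≡ b ∙ i → t ∙ i ≡ a ∙ i

  -- The induction on dT a b moves a within S towards b until a coordinate i of a is antipodal to that of c;
  -- then S contains the fibres in direction i through a, b and c, and i can be made constant.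
  box⊆trace : ∀ k {a b c} → dT a b ≤ k → S a → S b → S c → MetricT a b c → ∀ t → Box a b t → S t
  box⊆trace k {a} {b} {c} le Sa Sb Sc M t box with dT a b ≟ 0
  ... | yes e = subst S (sym (coord-ext (λ i → box i (cong (_∙ i) (dT-zero a b e))))) Sa
  box⊆trace zero le Sa Sb Sc M t box | no ne = ⊥-elim (ne (n≤0⇒n≡0 le))
  box⊆trace (suc k) {a} {b} {c} le Sa Sb Sc M t box | no ne
    with advance Sa Sb (λ { refl → ne (dT-refl a) })
  ... | a₁ , Sa₁ , edge , ab with edge⇒update edge
  ... | i , α , refl , aα = go (Cycle.step-to-triangle (ms ! i) (M i) a≢b aα (subst (bt (ms ! i) _ _) (updated a i α) (btT-coord {s = a} {b} ab i)))
    where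
    a≢b : a ∙ i ≢ b ∙ i
    a≢b e = 0≢1+n (trans (sym (Cycle.cd-refl (ms ! i) (a ∙ i))) (trans (cong (cd (ms ! i) (a ∙ i))
      (sym (bt-degenerate (ms ! i) (subst₂ (bt (ms ! i) (a ∙ i)) (sym e) (updated a i α) (btT-coord {s = a} {b} ab i))))) aα))
    closer : dT (a [ i ≔ α ]) b ≤ k
    closer = ≤-pred (≤-trans (≤-reflexive (trans (cong (_+ dT (a [ i ≔ α ]) b)
      (sym (trans (dT-update-self a i α) aα))) ab)) le)
    go : (Metric (ms ! i) α (b ∙ i) (c ∙ i) × α ≢ b ∙ i) ⊎ bt (ms ! i) α (c ∙ i) (b ∙ i) → S t
    go (inj₁ (Mα , α≢b)) = box⊆trace k closer Sa₁ Sb Sc M₁ t box₁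
      where
      M₁ : MetricT (a [ i ≔ α ]) b c
      M₁ j with i Fin.≟ j
      ... | yes refl rewrite updated a i α = Mα
      ... | no  i≢j  rewrite unchanged a α i≢j = M j
      box₁ : Box (a [ i ≔ α ]) b t
      box₁ j e with i Fin.≟ j
      ... | yes refl = ⊥-elim (α≢b (trans (sym (updated a i α)) e))
      ... | no  i≢j  = trans (box j (trans (sym (unchanged a α i≢j)) e)) (sym (unchanged a α i≢j))
    go (inj₂ opp) = box⊆trace k shorter (fibre-a τ) Sbτ (fibre-c τ) Mτ t boxτ
      where
      τ = t ∙ i
      m = ms ! i
      -- `extend` is applied at `a [ i ≔ α ]` rather than at `a`: only from `α`, the antipode of
      -- `c ∙ i`, does a geodesic to `c ∙ i` pass through `b ∙ i`.
      Sab : S (a [ i ≔ b ∙ i ])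
      Sab = subst S (update-update a i α _) (extend i Sa₁ Sb Sc
        (subst (λ x → bt m x (c ∙ i) (b ∙ i)) (sym (updated a i α)) opp) off)
        where
        off : ∀ j → i ≢ j → ∀ τ → bt (ms ! j) (a [ i ≔ α ] ∙ j) (b ∙ j) τ →
          bt (ms ! j) (a [ i ≔ α ] ∙ j) (c ∙ j) τ → τ ≡ a [ i ≔ α ] ∙ j
        off j i≢j τ h h′ rewrite unchanged a α i≢j = proj₂ (proj₂ (M j)) τ (bt-sym (ms ! j) h′) h
      Scb : S (c [ i ≔ b ∙ i ])
      Scb = extend i Sc Sb Sa₁ (subst (λ x → bt m (c ∙ i) x (b ∙ i)) (sym (updated a i α)) (bt-sym m opp)) off
        where
        off : ∀ j → i ≢ j → ∀ τ → bt (ms ! j) (c ∙ j) (b ∙ j) τ → bt (ms ! j) (c ∙ j) (a [ i ≔ α ] ∙ j) τ → τ ≡ c ∙ j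
        off j i≢j τ h h′ rewrite unchanged a α i≢j = proj₁ (proj₂ (M j)) τ (bt-sym (ms ! j) h) h′
      fibre-a : ∀ τ → S (a [ i ≔ τ ])
      fibre-a = fibre i (M i) a≢b (subst S (sym (update-self a i)) Sa) Sab
        (third-corner {a} {b} {c} i Sa Sab Sc λ τ h h′ → proj₁ (proj₂ (M i)) τ h (bt-sym m h′))
      fibre-c : ∀ τ → S (c [ i ≔ τ ])
      fibre-c = fibre i (M i) a≢b
        (third-corner {c} {b} {a} i Sc Scb Sa λ τ h h′ → proj₂ (proj₂ (M i)) τ h′ (bt-sym m h))
        Scb (subst S (sym (update-self c i)) Sc)
      -- The points at `τ` in the other two fibres share coordinate `i`, and in every other
      -- coordinate the intervals from `b` to `a` and to `c` meet only in `b`.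
      Sbτ : S (b [ i ≔ τ ])
      Sbτ = subst (λ x → S (b [ i ≔ x ])) (updated a i τ) (extend i Sb (fibre-a τ) (fibre-c τ)
        (subst₂ (bt m (b ∙ i)) (sym (updated c i τ)) (sym (updated a i τ)) (bt-right m _ _)) off)
        where
        off : ∀ j → i ≢ j → ∀ σ → bt (ms ! j) (b ∙ j) (a [ i ≔ τ ] ∙ j) σ →
          bt (ms ! j) (b ∙ j) (c [ i ≔ τ ] ∙ j) σ → σ ≡ b ∙ j
        off j i≢j σ h h′ rewrite unchanged a τ i≢j | unchanged c τ i≢j = proj₁ (M j) σ (bt-sym (ms ! j) h) h′
      Mτ : MetricT (a [ i ≔ τ ]) (b [ i ≔ τ ]) (c [ i ≔ τ ])
      Mτ j with i Fin.≟ j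
      ... | yes refl rewrite updated a i τ | updated b i τ | updated c i τ =
        (λ _ h _ → bt-degenerate m h) , (λ _ h _ → bt-degenerate m h) , (λ _ h _ → bt-degenerate m h)
      ... | no  i≢j  rewrite unchanged a τ i≢j | unchanged b τ i≢j | unchanged c τ i≢j = M j
      boxτ : Box (a [ i ≔ τ ]) (b [ i ≔ τ ]) t
      boxτ j e with i Fin.≟ j
      ... | yes refl = sym (updated a i τ)
      ... | no  i≢j  = trans (box j (trans (sym (unchanged a τ i≢j)) (trans e (unchanged b τ i≢j))))
                             (sym (unchanged a τ i≢j))
      -- The point `q` is a vertex other than `a` on a geodesic from `a` to `b`, and making
      -- coordinate `i` constant leaves just the distance from `q` to `b`.
      shorter : dT (a [ i ≔ τ ]) (b [ i ≔ τ ]) ≤ k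
      shorter = ≤-pred (≤-trans (s≤s (≤-reflexive (dT-update-both a b i τ (b ∙ i)))) (≤-trans
        (+-monoˡ-≤ (dT q (b [ i ≔ b ∙ i ])) positive) (≤-trans (≤-reflexive split) le)))
        where
        q = a [ i ≔ b ∙ i ]
        positive : 1 ≤ dT a q
        positive = ≤∧≢⇒< z≤n (λ e → a≢b (trans (cong (_∙ i) (dT-zero a q (sym e))) (updated a i _)))
        split : dT a q + dT q (b [ i ≔ b ∙ i ]) ≡ dT a b
        split = trans (cong (λ x → dT a q + dT q x) (update-self b i)) (endpoints-btT {s = a} {b} {q} corner)
          where
          corner : ∀ j → q ∙ j ≡ a ∙ j ⊎ q ∙ j ≡ b ∙ j
          corner j with i Fin.≟ j
          ... | yes refl = inj₂ (updated a i _)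
          ... | no  i≢j  = inj₁ (unchanged a _ i≢j)

-- Hypercubes and partial cubes

bool-third : ∀ {a b c : Bool} → a ≢ b → c ≢ b → c ≡ a
bool-third {a} {b} {c} p q = trans (¬-not q) (sym (¬-not p))

-- Inclusion up to double negation is enough because the inequality is decidable.
unique-length : ∀ {I : Set} {xs ys : List I} → Unique xs → (∀ {x} → x ∈ xs → ¬ ¬ (x ∈ ys)) → length xs ≤ length ys
unique-length {xs = []}     _        _   = z≤n
unique-length {xs = x ∷ xs} {ys} (x∉ ∷ u) sub =
  decidable-stable (_ ≤? _) λ ¬le → sub (here refl) λ x∈ → ¬le (shrink x∈)
  where
  shrink : x ∈ ys → suc (length xs) ≤ length ys
  shrink x∈ with ∈-∃++ x∈
  ... | ps , qs , refl = ≤-trans (s≤s (unique-length u sub′)) (≤-reflexive (trans (cong suc (length-++ ps))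
                           (trans (sym (+-suc (length ps) (length qs))) (sym (length-++ ps)))))
    where
    sub′ : ∀ {y} → y ∈ xs → ¬ ¬ (y ∈ ps ++ qs)
    sub′ {y} y∈ k = sub (there y∈) λ y∈′ → drop (∈-++⁻ ps y∈′)
      where
      drop : y ∈ ps ⊎ y ∈ x ∷ qs → ⊥
      drop (inj₁ p)           = k (∈-++⁺ˡ p)
      drop (inj₂ (here refl)) = All.lookup x∉ y∈ refl
      drop (inj₂ (there p))   = k (∈-++⁺ʳ ps p)

module Cube {I : Set} where

  -- Equality of coordinates need not be decidable, but a coordinate crossed by an edge comes with the
  -- function telling at which coordinates the ends of the edge differ.
  record Crossed : Set where
    constructor crossed
    field
      index : I
      at    : I → Bool
      hit   : at index ≡ true
      miss  : ∀ κ → κ ≢ index → at κ ≡ false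
  open Crossed public

  -- The length of `L` is the Hamming distance. Completeness is doubly negated because membership in
  -- a list of coordinates is undecidable.
  record Differ (f g : I → Bool) (L : List Crossed) : Set where
    field
      distinct : Unique (List.map index L)
      sound    : ∀ {κ} → κ ∈ List.map index L → f κ ≢ g κ
      complete : ∀ κ → f κ ≢ g κ → ¬ ¬ (κ ∈ List.map index L)
  open Differ public

  differ⇒walk : ∀ L {f g} → Differ f g L → CubeWalk I f g (length L)
  differ⇒walk [] {f} {g} D = nil λ κ → decidable-stable (f κ Bool.≟ g κ) λ ne → complete D κ ne λ ()
  differ⇒walk (c ∷ L) {f} {g} D = step (index c , flips , same) (differ⇒walk L rest)
    where
    h : I → Bool
    h κ = if at c κ then not (f κ) else f κ
    flips : f (index c) ≢ h (index c)
    flips e rewrite hit c = not-¬ refl e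
    same : ∀ κ → κ ≢ index c → f κ ≡ h κ
    same κ ne rewrite miss c κ ne = refl
    other : ∀ {κ} → κ ∈ List.map index L → κ ≢ index c
    other κ∈ refl with distinct D
    ... | c∉ ∷ _ = All.lookup c∉ κ∈ refl
    unique-tail : ∀ {x} {xs : List I} → Unique (x ∷ xs) → Unique xs
    unique-tail (_ ∷ u) = u
    rest : Differ h g L
    rest = record
      { distinct = unique-tail (distinct D)
      ; sound    = λ κ∈ e → sound D (there κ∈) (trans (same _ (other κ∈)) e)
      ; complete = λ κ ne k → later κ ne k (λ { refl → ne (bool-third (λ e → sound D (here refl) (sym e)) (λ e → flips (sym e))) })
      }
      where
      later : ∀ κ → h κ ≢ g κ → ¬ (κ ∈ List.map index L) → ¬ (κ ≢ index c)
      later κ ne k ne′ = complete D κ (λ e → ne (trans (sym (same κ ne′)) e))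
        λ { (here e) → ne′ e ; (there p) → k p }

  walk⇒list : ∀ {f g n} → CubeWalk I f g n → ∃[ W ] (length W ≡ n × (∀ κ → f κ ≢ g κ → ¬ ¬ (κ ∈ W)))
  walk⇒list (nil eq) = [] , refl , λ κ ne _ → ne (eq κ)
  walk⇒list (step (i , _ , same) w) with walk⇒list w
  ... | W , e , cov = i ∷ W , cong suc e , λ κ ne k →
    cov κ (λ e′ → ne (trans (same κ (λ { refl → k (here refl) })) e′)) (λ p → k (there p))

  differ⇒dist : ∀ {L f g} → Differ f g L → CubeDist I f g (length L)
  differ⇒dist {L} D = differ⇒walk L D , λ m w →
    let (W , e , cov) = walk⇒list w
    in subst₂ _≤_ (length-map index L) e (unique-length (distinct D) (λ p → cov _ (sound D p)))

  differ-refl : ∀ f → Differ f f []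
  differ-refl f = record { distinct = [] ; sound = λ () ; complete = λ κ ne → ⊥-elim (ne refl) }

  cross : ∀ {g g′ : I → Bool} (i : I) → g i ≢ g′ i → (∀ κ → κ ≢ i → g κ ≡ g′ κ) → Crossed
  cross {g} {g′} i ne same = crossed i (λ κ → not ⌊ g κ Bool.≟ g′ κ ⌋) hit′ miss′
    where
    hit′ : not ⌊ g i Bool.≟ g′ i ⌋ ≡ true
    hit′ with g i Bool.≟ g′ i
    ... | yes e = ⊥-elim (ne e)
    ... | no _  = refl
    miss′ : ∀ κ → κ ≢ i → not ⌊ g κ Bool.≟ g′ κ ⌋ ≡ false
    miss′ κ ne′ with g κ Bool.≟ g′ κ
    ... | yes _ = refl
    ... | no n  = ⊥-elim (n (same κ ne′))

  private
    remove : Crossed → List Crossed → List Crossed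
    remove c = filterᵇ λ d → not (at c (index d))

    ∈-remove⁻ : ∀ c L {κ} → κ ∈ List.map index (remove c L) → κ ∈ List.map index L × κ ≢ index c
    ∈-remove⁻ c (d ∷ L) {κ} κ∈ with at c (index d) in eq
    ... | true  = let (p , q) = ∈-remove⁻ c L κ∈ in there p , q
    ∈-remove⁻ c (d ∷ L) (here refl) | false = here refl , λ e → false≢true (trans (sym eq) (trans (cong (at c) e) (hit c)))
      where
      false≢true : false ≢ true
      false≢true ()
    ∈-remove⁻ c (d ∷ L) (there κ∈) | false = let (p , q) = ∈-remove⁻ c L κ∈ in there p , q

    ∈-remove⁺ : ∀ c L {κ} → κ ∈ List.map index L → κ ≢ index c → κ ∈ List.map index (remove c L)
    ∈-remove⁺ c (d ∷ L) (here refl) ne rewrite miss c (index d) ne = here refl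
    ∈-remove⁺ c (d ∷ L) (there κ∈)  ne with at c (index d)
    ... | true  = ∈-remove⁺ c L κ∈ ne
    ... | false = there (∈-remove⁺ c L κ∈ ne)

    remove-unique : ∀ c L → Unique (List.map index L) → Unique (List.map index (remove c L))
    remove-unique c []      u = []
    remove-unique c (d ∷ L) (d∉ ∷ u) with at c (index d)
    ... | true  = remove-unique c L u
    ... | false = All.tabulate (λ κ∈ → All.lookup d∉ (proj₁ (∈-remove⁻ c L κ∈))) ∷ remove-unique c L u

  -- Crossing coordinate `i` adds it to the list if `f` and `g` agree there and removes it
  -- otherwise. Following a walk in this way gives every two vertices of a connected graph a finite
  -- list, whatever the index set is.
  differ-step : ∀ {f g g′ L} → Differ f g L → (i : I) → g i ≢ g′ i → (∀ κ → κ ≢ i → g κ ≡ g′ κ) →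
    ∃[ L′ ] Differ f g′ L′
  differ-step {f} {g} {g′} {L} D i ne same with f i Bool.≟ g i
  ... | yes fi≡gi = cross i ne same ∷ L , record
    { distinct = All.tabulate (λ κ∈ e → sound D κ∈ (subst (λ κ → f κ ≡ g κ) e fi≡gi)) ∷ distinct D
    ; sound    = λ { (here refl) e → ne (trans (sym fi≡gi) e)
                   ; {κ} (there κ∈) e → sound D κ∈ (trans e (sym (same κ λ { refl → sound D κ∈ fi≡gi }))) }
    ; complete = λ κ ne′ k → complete D κ (λ e → ne′ (trans e (same κ λ κ≡i → k (here κ≡i)))) (λ p → k (there p))
    }
  ... | no fi≢gi = remove c L , record
    { distinct = remove-unique c L (distinct D)
    ; sound    = λ {κ} κ∈ e → let (p , q) = ∈-remove⁻ c L κ∈ in sound D p (trans e (sym (same κ q)))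
    ; complete = λ κ ne′ k →
        let κ≢i = λ { refl → ne′ (bool-third (λ e → ne (sym e)) fi≢gi) }
        in complete D κ (λ e → ne′ (trans e (same κ κ≢i))) (λ p → k (∈-remove⁺ c L p κ≢i))
    }
    where
    c = cross i ne same

-- Intervals of a partial cube in coordinates

walk-++ : ∀ {G x y z m n} → Walk G x y m → Walk G y z n → Walk G x z (m + n)
walk-++ nil        w = w
walk-++ (step e v) w = step e (walk-++ v w)

dist-unique : ∀ {G x y m n} → Dist G x y m → Dist G x y n → m ≡ n
dist-unique (w , min) (w′ , min′) = ≤-antisym (min _ w′) (min′ _ w)

dist-tail : ∀ {G x x′ y n} → E G x x′ → Walk G x′ y n → (∀ m → Walk G x y m → suc n ≤ m) →
  Dist G x x′ 1 × Dist G x′ y n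
dist-tail {n = n} e w min =
  (step e nil , λ m v → +-cancelʳ-≤ n 1 m (min _ (walk-++ v w))) , (w , λ m v → ≤-pred (min _ (step e v)))

module InPartialCube (G : Graph) (pc : PartialCube G) where

  open Cube

  private
    simple = proj₁ pc
    connected = proj₁ (proj₂ pc)

  I : Set
  I = proj₁ (proj₂ (proj₂ pc))

  φ : V G → I → Bool
  φ = proj₁ (proj₂ (proj₂ (proj₂ pc)))

  embed : ∀ x y → Vx G x → Vx G y → ∀ n →
    (Dist G x y n → CubeDist I (φ x) (φ y) n) × (CubeDist I (φ x) (φ y) n → Dist G x y n)
  embed = proj₂ (proj₂ (proj₂ (proj₂ pc)))

  E-sym : ∀ {x y} → E G x y → E G y x
  E-sym = proj₁ (proj₂ simple) _ _

  E-ends : ∀ {x y} → E G x y → Vx G x × Vx G y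
  E-ends = proj₁ simple _ _

  edge-dist : ∀ {a b} → E G a b → Dist G a b 1
  edge-dist {a} e = step e nil , λ { zero nil → ⊥-elim (proj₂ (proj₂ simple) a e) ; (suc m) _ → s≤s z≤n }

  edge-cross : ∀ {a b} → E G a b → ∃[ i ] (φ a i ≢ φ b i × (∀ κ → κ ≢ i → φ a κ ≡ φ b κ))
  edge-cross {a} {b} e with proj₁ (proj₁ (embed a b (proj₁ (E-ends e)) (proj₂ (E-ends e)) 1) (edge-dist e))
  ... | step (i , ne , same) (nil eq) = i , (λ e → ne (trans e (sym (eq i)))) , λ κ κ≢ → trans (same κ κ≢) (eq κ)

  edge-same : ∀ {a b κ κ′} → E G a b → φ a κ ≢ φ b κ → φ a κ′ ≢ φ b κ′ → ¬ ¬ (κ ≡ κ′)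
  edge-same e ne ne′ k with edge-cross e
  ... | i , _ , same = ne (same _ λ { refl → ne′ (same _ λ { refl → k refl }) })

  walk-Vx : ∀ {x y n} → Vx G x → Walk G x y n → Vx G y
  walk-Vx v nil        = v
  walk-Vx v (step e w) = walk-Vx (proj₂ (E-ends e)) w

  differ-walk : ∀ {f x y n L} → Differ f (φ x) L → Walk G x y n → ∃[ L′ ] Differ f (φ y) L′
  differ-walk D nil        = _ , D
  differ-walk D (step e w) = let (i , ne , same) = edge-cross e in differ-walk (proj₂ (differ-step D i ne same)) w

  differing : ∀ {x y} → Vx G x → Vx G y → ∃[ L ] (Differ (φ x) (φ y) L × Dist G x y (length L))
  differing {x} {y} vx vy =
    let (L , D) = differ-walk (differ-refl (φ x)) (proj₂ (connected x y vx vy))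
    in L , D , proj₂ (embed x y vx vy _) (differ⇒dist D)

  distance : ∀ {x y} → Vx G x → Vx G y → ∃[ n ] Dist G x y n
  distance vx vy = _ , proj₂ (proj₂ (differing vx vy))

  φ-injective : ∀ {x y} → Vx G x → Vx G y → (∀ κ → φ x κ ≡ φ y κ) → x ≡ y
  φ-injective vx vy eq with differing vx vy
  ... | []    , _ , nil , _ = refl
  ... | c ∷ L , D , _       = ⊥-elim (sound D (here refl) (eq _))

  -- For vertices this is membership of `z` in the interval of `x` and `y`, by `between⇒btw` and
  -- `btw⇒between`.
  Btw : V G → V G → V G → Set
  Btw x y z = ∀ κ → φ x κ ≡ φ y κ → φ z κ ≡ φ x κ

  btw-left : ∀ {x y} → Btw x y x
  btw-left κ e = refl

  btw-right : ∀ {x y} → Btw x y y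
  btw-right κ e = sym e

  btw-sym : ∀ {x y z} → Btw x y z → Btw y x z
  btw-sym h κ e = trans (h κ (sym e)) (sym e)

  btw-trans : ∀ {x y z w} → Btw x y z → Btw z y w → Btw x y w
  btw-trans h h′ κ e = trans (h′ κ (trans (h κ e) e)) (h κ e)

  between-Vx : ∀ {x y z} → Vx G x → InI G x y z → Vx G z
  between-Vx vx (_ , _ , (w , _) , _) = walk-Vx vx w

  -- If `z` left the common value of `x` and `y` at `κ`, the coordinates crossed on the way through
  -- `z` would include `κ` and all those in which `x` and `y` differ, more than the distance allows.
  between⇒btw : ∀ {x y z} → Vx G x → Vx G y → InI G x y z → Btw x y z
  between⇒btw {x} {y} {z} vx vy h@(a , b , xz , zy , xy) κ e =
    decidable-stable (φ z κ Bool.≟ φ x κ) λ ne → <-irrefl refl (too-long ne)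
    where
    vz = between-Vx vx h
    A = differing vx vz
    B = differing vz vy
    C = differing vx vy
    too-long : φ z κ ≢ φ x κ → a + b < a + b
    too-long ne = subst₂ (λ p q → suc p ≤ q)
      (trans (length-map index (proj₁ C)) (dist-unique (proj₂ (proj₂ C)) xy))
      (trans (length-++ (List.map index (proj₁ A))) (cong₂ _+_
        (trans (length-map index (proj₁ A)) (dist-unique (proj₂ (proj₂ A)) xz))
        (trans (length-map index (proj₁ B)) (dist-unique (proj₂ (proj₂ B)) zy))))
      (unique-length
        (All.tabulate (λ p q → sound (proj₁ (proj₂ C)) p (subst (λ κ → φ x κ ≡ φ y κ) q e)) ∷ distinct (proj₁ (proj₂ C)))
        covered)
      where
      covered : ∀ {κ′} → κ′ ∈ κ ∷ List.map index (proj₁ C) → ¬ ¬ (κ′ ∈ List.map index (proj₁ A) ++ List.map index (proj₁ B))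
      covered (here refl) k = complete (proj₁ (proj₂ A)) κ (λ e → ne (sym e)) λ p → k (∈-++⁺ˡ p)
      covered {κ′} (there p) k with φ x κ′ Bool.≟ φ z κ′
      ... | no ne′ = complete (proj₁ (proj₂ A)) κ′ ne′ λ q → k (∈-++⁺ˡ q)
      ... | yes e′ = complete (proj₁ (proj₂ B)) κ′ (λ e″ → sound (proj₁ (proj₂ C)) p (trans e′ e″))
                       λ q → k (∈-++⁺ʳ (List.map index (proj₁ A)) q)

  differ-++ : ∀ {x y z L M} → Btw x y z → Differ (φ x) (φ z) L → Differ (φ z) (φ y) M → Differ (φ x) (φ y) (L ++ M)
  differ-++ {x} {y} {z} {L} {M} h D D′ = record
    { distinct = disjoint L (distinct D) (λ p → p)
    ; sound    = λ p e → apart (∈-split L p) e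
    ; complete = λ κ ne k → cases κ ne k (φ x κ Bool.≟ φ z κ)
    }
    where
    ∈-join : ∀ L {κ} → κ ∈ List.map index L ⊎ κ ∈ List.map index M → κ ∈ List.map index (L ++ M)
    ∈-join []      (inj₂ p)           = p
    ∈-join (c ∷ L) (inj₁ (here e))    = here e
    ∈-join (c ∷ L) (inj₁ (there p))   = there (∈-join L (inj₁ p))
    ∈-join (c ∷ L) (inj₂ p)           = there (∈-join L (inj₂ p))
    ∈-split : ∀ L {κ} → κ ∈ List.map index (L ++ M) → κ ∈ List.map index L ⊎ κ ∈ List.map index M
    ∈-split []      p         = inj₂ p
    ∈-split (c ∷ L) (here e)  = inj₁ (here e)
    ∈-split (c ∷ L) (there p) with ∈-split L p
    ... | inj₁ q = inj₁ (there q)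
    ... | inj₂ q = inj₂ q
    disjoint : ∀ K → Unique (List.map index K) → (∀ {κ} → κ ∈ List.map index K → κ ∈ List.map index L) → Unique (List.map index (K ++ M))
    disjoint []      u        sub = distinct D′
    disjoint (c ∷ K) (c∉ ∷ u) sub = All.tabulate (λ p e → fresh e (∈-split K p)) ∷ disjoint K u (λ p → sub (there p))
      where
      fresh : ∀ {κ} → index c ≡ κ → κ ∈ List.map index K ⊎ κ ∈ List.map index M → ⊥
      fresh e    (inj₁ p) = All.lookup c∉ p e
      fresh refl (inj₂ p) = sound D (sub (here refl)) (sym (h (index c)
        (bool-third (λ e → sound D′ p (sym e)) (λ e → sound D (sub (here refl)) e))))
    apart : ∀ {κ} → κ ∈ List.map index L ⊎ κ ∈ List.map index M → φ x κ ≢ φ y κ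
    apart (inj₁ p) e = sound D p (sym (h _ e))
    apart (inj₂ p) e = sound D′ p (trans (h _ e) e)
    cases : ∀ κ → φ x κ ≢ φ y κ → ¬ (κ ∈ List.map index (L ++ M)) → Dec (φ x κ ≡ φ z κ) → ⊥
    cases κ ne k (no n)  = complete D κ n λ p → k (∈-join L (inj₁ p))
    cases κ ne k (yes e) = complete D′ κ (λ e′ → ne (trans e e′)) λ p → k (∈-join L (inj₂ p))

  btw⇒between : ∀ {x y z} → Vx G x → Vx G y → Vx G z → Btw x y z → InI G x y z
  btw⇒between {x} {y} vx vy vz h =
    let (L , D , d) = differing vx vz
        (M , D′ , d′) = differing vz vy
    in length L , length M , d , d′ ,
       subst (Dist G x y) (length-++ L) (proj₂ (embed x y vx vy _) (differ⇒dist (differ-++ h D D′)))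

  -- The edge changes only the coordinate `κ`, in which `c` and `b` differ.
  edge-btw : ∀ {a b c κ} → E G a b → φ a κ ≢ φ b κ → φ c κ ≡ φ a κ → Btw c b a
  edge-btw {a} {b} {c} {κ} e ne s κ′ e′ with φ a κ′ Bool.≟ φ b κ′
  ... | yes eq = trans eq (sym e′)
  ... | no ne′ = ⊥-elim (edge-same e ne ne′ λ { refl → ne (trans (sym s) e′) })

  crossing-edge : ∀ {x y n κ} → Vx G x → Vx G y → Dist G x y n → φ x κ ≢ φ y κ →
    ∃[ a ] ∃[ b ] (E G a b × Btw x y a × Btw x y b × φ a κ ≡ φ x κ × φ b κ ≡ φ y κ)
  crossing-edge vx vy (nil , _) ne = ⊥-elim (ne refl)
  crossing-edge {x} {y} {suc n} {κ} vx vy (step {y = x′} e w , min) ne = go (φ x′ κ Bool.≟ φ x κ)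
    where
    tail = dist-tail e w min
    vx′ = proj₂ (E-ends e)
    h : Btw x y x′
    h = between⇒btw vx vy (1 , n , proj₁ tail , proj₂ tail , (step e w , min))
    go : Dec (φ x′ κ ≡ φ x κ) → ∃[ a ] ∃[ b ] (E G a b × Btw x y a × Btw x y b × φ a κ ≡ φ x κ × φ b κ ≡ φ y κ)
    go (no n)  = x , x′ , e , btw-left {x} {y} , h , refl , bool-third (λ e → ne (sym e)) n
    go (yes q) =
      let (a , b , e′ , ha , hb , sa , sb) = crossing-edge vx′ vy (proj₂ tail) (λ e → ne (trans (sym q) e))
      in a , b , e′ , btw-trans {x} {y} {x′} {a} h ha , btw-trans {x} {y} {x′} {b} h hb , trans sa q , sb

  -- Isometric subgraphs

  sub : (V G → Set) → (V G → V G → Set) → Graph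
  sub P Q = record { V = V G ; Vx = P ; E = Q }

  -- This covers convex subgraphs of G, the retract, and convex subgraphs of the retract; in all of
  -- them intervals are described by the same `Btw`.
  record Isometric (P : V G → Set) (Q : V G → V G → Set) : Set where
    field
      vertices : P ⊆ Vx G
      edges    : ∀ {x y} → Q x y → E G x y
      ends     : ∀ {x y} → Q x y → P x × P y
      geodesic : ∀ {x y} → P x → P y → ∃[ n ] (Walk (sub P Q) x y n × Dist G x y n)

    walk-up : ∀ {x y n} → Walk (sub P Q) x y n → Walk G x y n
    walk-up nil        = nil
    walk-up (step q w) = step (edges q) (walk-up w)

    walk-inside : ∀ {x y n} → P x → Walk (sub P Q) x y n → P y
    walk-inside p nil        = p
    walk-inside p (step q w) = walk-inside (proj₂ (ends q)) w

    dist-up : ∀ {x y n} → P x → P y → Dist (sub P Q) x y n → Dist G x y n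
    dist-up p q (w , min) =
      let (n₀ , w₀ , d₀) = geodesic p q
      in subst (Dist G _ _) (≤-antisym (proj₂ d₀ _ (walk-up w)) (min _ w₀)) d₀

    dist-down : ∀ {x y n} → P x → P y → Dist G x y n → Dist (sub P Q) x y n
    dist-down p q d =
      let (n₀ , w₀ , d₀) = geodesic p q
      in subst (Walk (sub P Q) _ _) (dist-unique d₀ d) w₀ , λ m w → proj₂ d m (walk-up w)

    between-up : ∀ {x y z} → P x → P y → InI (sub P Q) x y z → P z × Btw x y z
    between-up p q (a , b , xz , zy , xy) =
      let r = walk-inside p (proj₁ xz)
      in r , between⇒btw (vertices _ p) (vertices _ q) (a , b , dist-up p r xz , dist-up r q zy , dist-up p q xy)

    between-down : ∀ {x y z} → P x → P y → P z → Btw x y z → InI (sub P Q) x y z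
    between-down p q r h =
      let (a , b , xz , zy , xy) = btw⇒between (vertices _ p) (vertices _ q) (vertices _ r) h
      in a , b , dist-down p r xz , dist-down r q zy , dist-down p q xy

  whole : Isometric (Vx G) (E G)
  whole = record
    { vertices = λ _ v → v ; edges = λ e → e ; ends = E-ends
    ; geodesic = λ p q → let (n , d) = distance p q in n , proj₁ d , d }

  convex-walk : ∀ {K} A → Convex K A → ∀ {x y n} → Dist K x y n → A x → A y → Walk (Induced K A) x y n
  convex-walk A conv (nil , _) ax ay = nil
  convex-walk {K} A conv {x} {y} (step {y = x′} {n = n} e w , min) ax ay =
    step (ax , ax′ , e) (convex-walk A conv (proj₂ tail) ax′ ay)
    where
    tail = dist-tail e w min
    ax′ : A x′
    ax′ = proj₂ conv x y x′ ax ay (1 , n , proj₁ tail , proj₂ tail , (step e w , min))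

  convex-isometric : ∀ {P Q} → Isometric P Q → ∀ A → Convex (sub P Q) A →
    Isometric (λ v → P v × A v) (λ x y → A x × A y × Q x y)
  convex-isometric {P} {Q} iso A conv = record
    { vertices = λ v p → vertices v (proj₁ p)
    ; edges    = λ q → edges (proj₂ (proj₂ q))
    ; ends     = λ (a , b , q) → (proj₁ (ends q) , a) , (proj₂ (ends q) , b)
    ; geodesic = λ (p , a) (q , b) → let (n , w , d) = geodesic p q
                                     in n , convex-walk {sub P Q} A conv (dist-down p q d) a b , d
    }
    where open Isometric iso

-- Gates in hypertori

finite-by-patterns : ∀ {V I : Set} (f : V → I → Bool) (L : List I) (A : V → Set) →
  (∀ {a b} → A a → A b → (∀ {κ} → κ ∈ L → f a κ ≡ f b κ) → a ≡ b) → ¬ ¬ Finite A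
-- Without coordinates `A` has at most one element. The refutation of finiteness is used twice: once
-- on the empty list, which fails only through some element `v`, and then on `v` alone.
finite-by-patterns f [] A inj k = k ([] , λ v a → ⊥-elim (k (v ∷ [] , λ w b → here (inj b a λ ()))))
finite-by-patterns f (κ ∷ L) A inj k =
  half true λ (xs , cx) → half false λ (ys , cy) → k (xs ++ ys , λ v a → cover xs ys cx cy v a (f v κ) refl)
  where
  half : ∀ b → ¬ ¬ Finite (λ v → A v × f v κ ≡ b)
  half b = finite-by-patterns f L (λ v → A v × f v κ ≡ b)
    λ (a , e) (a′ , e′) h → inj a a′ λ { (here refl) → trans e (sym e′) ; (there p) → h p }
  cover : ∀ xs ys → (∀ v → A v × f v κ ≡ true → v ∈ xs) → (∀ v → A v × f v κ ≡ false → v ∈ ys) →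
    ∀ v → A v → ∀ b → f v κ ≡ b → v ∈ xs ++ ys
  cover xs ys cx cy v a true  e = ∈-++⁺ˡ (cx v (a , e))
  cover xs ys cx cy v a false e = ∈-++⁺ʳ xs (cy v (a , e))

module InPeanoPartialCube (G : Graph) (peano : PeanoPartialCube G) where

  open InPartialCube G (proj₁ peano)
  open Cube

  -- A stands in for the convex hull of p, w and q.  It is finite only up to double negation: which of its
  -- finitely many coordinate patterns are those of vertices is undecidable.
  module Span {p w q : V G} (vp : Vx G p) (vw : Vx G w) (vq : Vx G q) where

    A : V G → Set
    A a = Vx G a × (∀ κ → φ p κ ≡ φ w κ → φ q κ ≡ φ p κ → φ a κ ≡ φ p κ)

    between-A : ∀ {a} → Vx G a → Btw p w a → A a
    between-A va h = va , λ κ e _ → h κ e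

    q∈A : A q
    q∈A = vq , λ κ _ e → e

    A-convex : Convex G A
    A-convex = (λ _ → proj₁) , λ x y z (vx , ax) (vy , ay) h →
      between-Vx vx h , λ κ e e′ → trans (between⇒btw vx vy h κ (trans (ax κ e e′) (sym (ay κ e e′)))) (ax κ e e′)

    A-finite : ¬ ¬ Finite A
    A-finite = finite-by-patterns φ (List.map index L ++ List.map index M) A inj
      where
      L = proj₁ (differing vp vw)
      M = proj₁ (differing vp vq)
      D = proj₁ (proj₂ (differing vp vw))
      D′ = proj₁ (proj₂ (differing vp vq))
      inj : ∀ {a b} → A a → A b → (∀ {κ} → κ ∈ List.map index L ++ List.map index M → φ a κ ≡ φ b κ) → a ≡ b
      inj {a} {b} (va , ha) (vb , hb) same = φ-injective va vb λ κ →
        decidable-stable (φ a κ Bool.≟ φ b κ) λ ne → go κ ne (φ p κ Bool.≟ φ w κ) (φ p κ Bool.≟ φ q κ)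
        where
        go : ∀ κ → φ a κ ≢ φ b κ → Dec (φ p κ ≡ φ w κ) → Dec (φ p κ ≡ φ q κ) → ⊥
        go κ ne (no n)  _       = complete D κ n λ i → ne (same (∈-++⁺ˡ i))
        go κ ne (yes _) (no n)  = complete D′ κ n λ i → ne (same (∈-++⁺ʳ (List.map index L) i))
        go κ ne (yes e) (yes f) = ne (trans (ha κ e (sym f)) (sym (hb κ e (sym f))))

    open Isometric (convex-isometric whole A A-convex) public using (between-up; between-down)

    prehull : ¬ ¬ PreHullAtMost (Induced G A) 1
    prehull k = A-finite λ fin → k (proj₂ peano A A-convex fin)

  -- p, p⁺, g, w lie in this order on one half of a convex cycle on which w is antipodal to p and g to p⁻.
  -- Suppose p fails to be the gate of u, at a coordinate ι.  Let q q′ be the edge of a shortest path from u to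
  -- g that crosses the coordinate c of p p⁺.  The c-side C of q′ in A is a copoint at q, and p⁻ is in the hull
  -- of C and q, so it is between q and some z in C.  Then z is on the cycle and must be w, which ι excludes.
  local-gate : ∀ {p p⁺ p⁻ w g u} → E G p p⁺ → E G p p⁻ → Vx G w → Vx G g → Vx G u →
    Btw p w p⁺ → Btw p w p⁻ → Btw p w g → Btw p g p⁺ → Btw p⁻ g p → Btw p⁻ g w →
    (∀ z → Vx G z → Btw p w z → Btw p z p⁺ → Btw p z p⁻ → z ≡ w) →
    Btw u p⁺ p → Btw u p⁻ p → Btw u w p
  local-gate {p} {p⁺} {p⁻} {w} {g} {u} e⁺ e⁻ vw vg vu pwp⁺ pwp⁻ pwg pgp⁺ p⁻gp p⁻gw far up⁺ up⁻ ι uι≡wι =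
    decidable-stable (φ p ι Bool.≟ φ u ι) contradiction′
    where
    vp = proj₁ (E-ends e⁺)
    vp⁺ = proj₂ (E-ends e⁺)
    vp⁻ = proj₂ (E-ends e⁻)
    c = proj₁ (edge-cross e⁺)
    p≢p⁺ : φ p c ≢ φ p⁺ c
    p≢p⁺ = proj₁ (proj₂ (edge-cross e⁺))
    d = proj₁ (edge-cross e⁻)
    p≢p⁻ : φ p d ≢ φ p⁻ d
    p≢p⁻ = proj₁ (proj₂ (edge-cross e⁻))
    w≡p⁺ : φ w c ≡ φ p⁺ c
    w≡p⁺ = bool-third (λ e → p≢p⁺ (sym e)) (λ e → p≢p⁺ (sym (pwp⁺ c (sym e))))
    g≡p⁺ : φ g c ≡ φ p⁺ c
    g≡p⁺ = bool-third (λ e → p≢p⁺ (sym e)) (λ e → p≢p⁺ (sym (pgp⁺ c (sym e))))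
    u≡p : φ u c ≡ φ p c
    u≡p = bool-third p≢p⁺ (λ e → p≢p⁺ (trans (up⁺ c e) e))
    ud≡pd : φ u d ≡ φ p d
    ud≡pd = bool-third p≢p⁻ (λ e → p≢p⁻ (trans (up⁻ d e) e))
    gd≡pd : φ g d ≡ φ p d
    gd≡pd = bool-third p≢p⁻ (λ e → p≢p⁻ (p⁻gp d (sym e)))
    close : φ p ι ≢ φ u ι → ∀ q q′ → E G q q′ → Btw u g q → φ q c ≡ φ p c → φ q′ c ≡ φ p⁺ c → ⊥
    close p≢u q q′ eq ugq q≡p q′≡p⁺ =
      prehull λ { (_ , z≤n , ph) → at-most-0 ph ; (_ , s≤s z≤n , ph) → at-most-1 ph }
      where
      p⁻≡p : φ p⁻ ι ≡ φ p ι
      p⁻≡p = decidable-stable (φ p⁻ ι Bool.≟ φ p ι) λ ne →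
        edge-same e⁻ p≢p⁻ (λ e → ne (sym e)) λ { refl → p≢u (sym ud≡pd) }
      -- As `w` lies between `p⁻` and `g`, a vertex `g` agreeing with `p` at `ι` would make `w`, and
      -- so `u`, agree with `p` there.
      g≡u : φ g ι ≡ φ u ι
      g≡u = bool-third (λ e → p≢u (sym e)) λ e → p≢u (trans (sym p⁻≡p)
        (trans (sym (p⁻gw ι (trans p⁻≡p (sym e)))) (sym uι≡wι)))
      q≢q′ : φ q c ≢ φ q′ c
      q≢q′ e = p≢p⁺ (trans (sym q≡p) (trans e q′≡p⁺))
      qι≢p : φ q ι ≢ φ p ι
      qι≢p e = p≢u (trans (sym e) (ugq ι (sym g≡u)))
      qd≡pd : φ q d ≡ φ p d
      qd≡pd = trans (ugq d (trans ud≡pd (sym gd≡pd))) ud≡pd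
      vq = proj₁ (E-ends eq)
      vq′ = proj₂ (E-ends eq)
      open Span vp vw vq
      q′∈A : A q′
      q′∈A = vq′ , λ κ e e′ → trans (decidable-stable (φ q′ κ Bool.≟ φ q κ) λ ne →
        edge-same eq q≢q′ (λ e → ne (sym e)) λ { refl → p≢p⁺ (trans e w≡p⁺) }) e′
      C : V G → Set
      C a = A a × φ a c ≡ φ p⁺ c
      q∉C : ¬ C q
      q∉C (_ , e) = p≢p⁺ (trans (sym q≡p) e)
      copoint : Copoint (Induced G A) C q
      copoint = (C⊆ , C-closed) , q∉C , maximal
        where
        C⊆ : C ⊆ Vx (Induced G A)
        C⊆ v (a , _) = (proj₁ a , a)
        C-closed : ∀ x y z → C x → C y → InI (Induced G A) x y z → C z
        C-closed x y z (ax , ex) (ay , ey) h =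
          let ((vz , az) , b) = between-up (proj₁ ax , ax) (proj₁ ay , ay) h
          in az , trans (b c (trans ex (sym ey))) ex
        maximal : ∀ (D : V G → Set) → Convex (Induced G A) D → C ⊆ D → ¬ D q → D ⊆ C
        maximal D (D⊆ , D-closed) C⊆D q∉D v Dv =
          -- A vertex `v` of `D` outside `C` is on the side of `q`, so the edge to `q′` puts `q`
          -- between `v` and `q′`, hence into `D`.
          av , decidable-stable (φ v c Bool.≟ φ p⁺ c) λ ne → q∉D (D-closed q′ v q (C⊆D q′ (q′∈A , q′≡p⁺)) Dv
            (between-down (vq′ , q′∈A) (D⊆ v Dv) (vq , q∈A)
              (btw-sym {v} {q′} {q} (edge-btw eq q≢q′ (trans (bool-third p≢p⁺ ne) (sym q≡p))))))
          where av = proj₂ (D⊆ v Dv)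
      Cq : V G → Set
      Cq v = C v ⊎ v ≡ q
      w∈C : C w
      w∈C = between-A vw (btw-right {p} {w}) , w≡p⁺
      p⁺∈C : C p⁺
      p⁺∈C = between-A vp⁺ pwp⁺ , refl
      p∈A : A p
      p∈A = between-A vp (btw-left {p} {w})
      p⁻∈A : A p⁻
      p⁻∈A = between-A vp⁻ pwp⁻
      p⁻≡pc : φ p⁻ c ≡ φ p c
      p⁻≡pc = decidable-stable (φ p⁻ c Bool.≟ φ p c) λ ne →
        ne (sym (p⁻gp c (trans (bool-third (λ e → p≢p⁺ (sym e)) ne) (sym g≡p⁺))))
      p⁻∈hull : Co (Induced G A) Cq p⁻
      -- Two rounds of intervals reach `p⁻`: `p` is between `q` and `p⁺`, and `p⁻` is between `p`
      -- and its antipode `w`.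
      p⁻∈hull = int (inc (inj₁ w∈C))
        (int (inc (inj₂ refl)) (inc (inj₁ p⁺∈C))
          (between-down (vq , q∈A) (vp⁺ , proj₁ p⁺∈C) (vp , p∈A) (edge-btw e⁺ p≢p⁺ q≡p)))
        (between-down (vw , proj₁ w∈C) (vp , p∈A) (vp⁻ , p⁻∈A) (btw-sym {p} {w} {p⁻} pwp⁻))
      p⁻∉C : ¬ C p⁻
      p⁻∉C (_ , e) = p≢p⁺ (trans (sym p⁻≡pc) e)
      p⁻∉Cq : ¬ Cq p⁻
      p⁻∉Cq (inj₁ h)    = p⁻∉C h
      p⁻∉Cq (inj₂ refl) = qι≢p p⁻≡p
      Hull⊆ : ℕ → Set₁
      Hull⊆ m = ∀ x (C : V G → Set) → Vx (Induced G A) x → Copoint (Induced G A) C x →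
        let Cx = λ v → C v ⊎ v ≡ x in
        (Co (Induced G A) Cx ⊆ 𝓘^ (Induced G A) m Cx) × (𝓘^ (Induced G A) m Cx ⊆ Co (Induced G A) Cx)
      at-most-0 : Hull⊆ 0 → ⊥
      at-most-0 ph = p⁻∉Cq (proj₁ (ph q C (vq , q∈A) copoint) p⁻ p⁻∈hull)
      impossible : ∀ {z} → C z → Btw q z p⁻ → ⊥
      impossible {z} ((vz , az) , zc) h = qι≢p (trans (sym (h ι q≡z)) p⁻≡p)
        where
        -- Where `p` and `w` agree but `q` differs from them, `z` cannot side with `q`, since `p⁻`
        -- would follow although it lies between `p` and `w`.
        pwz : Btw p w z
        pwz κ e with φ q κ Bool.≟ φ p κ
        ... | yes e′ = az κ e e′
        ... | no n   = decidable-stable (φ z κ Bool.≟ φ p κ) λ ne →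
          n (trans (sym (h κ (sym (bool-third n ne)))) (pwp⁻ κ e))
        pzp⁺ : Btw p z p⁺
        pzp⁺ = btw-sym {z} {p} {p⁺} (edge-btw (E-sym e⁺) (λ e → p≢p⁺ (sym e)) zc)
        zd : φ z d ≡ φ p⁻ d
        zd = bool-third (λ e → p≢p⁻ (sym e)) λ e → p≢p⁻ (sym (trans (h d (trans qd≡pd (sym e))) qd≡pd))
        pzp⁻ : Btw p z p⁻
        pzp⁻ = btw-sym {z} {p} {p⁻} (edge-btw (E-sym e⁻) (λ e → p≢p⁻ (sym e)) zd)
        z≡u : φ z ι ≡ φ u ι
        z≡u = trans (cong (λ v → φ v ι) (far z vz pwz pzp⁺ pzp⁻)) (sym uι≡wι)
        q≡z : φ q ι ≡ φ z ι
        q≡z = bool-third (λ e → p≢u (trans (sym e) z≡u)) qι≢p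
      at-most-1 : Hull⊆ 1 → ⊥
      at-most-1 ph with proj₁ (ph q C (vq , q∈A) copoint) p⁻ p⁻∈hull
      ... | x , y , inj₁ cx   , inj₁ cy   , h = p⁻∉C (proj₂ (proj₁ copoint) x y p⁻ cx cy h)
      ... | x , y , inj₁ cx   , inj₂ refl , h =
        impossible cx (btw-sym {x} {q} {p⁻} (proj₂ (between-up (proj₁ (proj₁ cx) , proj₁ cx) (vq , q∈A) h)))
      ... | x , y , inj₂ refl , inj₁ cy   , h =
        impossible cy (proj₂ (between-up (vq , q∈A) (proj₁ (proj₁ cy) , proj₁ cy) h))
      ... | x , y , inj₂ refl , inj₂ refl , h =
        qι≢p (trans (sym (proj₂ (between-up (vq , q∈A) (vq , q∈A) h) ι refl)) p⁻≡p)
    contradiction′ : φ p ι ≢ φ u ι → ⊥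
    contradiction′ p≢u =
      let (q , q′ , eq , ugq , _ , q≡u , q′≡g) = crossing-edge {κ = c} vu vg (proj₂ (distance vu vg))
                                                  (λ e → p≢p⁺ (trans (sym u≡p) (trans e g≡p⁺)))
      in close p≢u q q′ eq ugq (trans q≡u u≡p) (trans q′≡g g≡p⁺)

-- Convex hypertori in a partial cube

module TorusIn (G : Graph) (pc : PartialCube G) (T : V G → Set) (convex : Convex G T)
  {ms : List ℕ} (iso : IsoTorus (Induced G T) ms) where

  open InPartialCube G pc

  point : TorusV ms → V G
  point = proj₁ (proj₂ iso)

  coords : V G → TorusV ms
  coords = proj₁ iso

  point-coords : ∀ {v} → T v → point (coords v) ≡ v
  point-coords t = proj₁ (proj₂ (proj₂ iso)) _ (proj₁ convex _ t , t)

  coords-point : ∀ t → coords (point t) ≡ t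
  coords-point t = proj₂ (proj₁ (proj₂ (proj₂ (proj₂ iso))) t)

  point-T : ∀ t → T (point t)
  point-T t = proj₂ (proj₁ (proj₁ (proj₂ (proj₂ (proj₂ iso))) t))

  point-Vx : ∀ t → Vx G (point t)
  point-Vx t = proj₁ (proj₁ (proj₁ (proj₂ (proj₂ (proj₂ iso))) t))

  edge-torus : ∀ {u v} → T u → T v → E G u v → TorusE ms (coords u) (coords v)
  edge-torus tu tv e = proj₁ (proj₂ (proj₂ (proj₂ (proj₂ iso))) _ _ (proj₁ convex _ tu , tu) (proj₁ convex _ tv , tv))
    (tu , tv , e)

  torus-edge : ∀ {s t} → TorusE ms s t → E G (point s) (point t)
  torus-edge {s} {t} e = proj₂ (proj₂ (proj₂ (proj₂ (proj₂ (proj₂ (proj₂ iso))) (point s) (point t)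
    (point-Vx s , point-T s) (point-Vx t , point-T t))
    (subst₂ (TorusE ms) (sym (coords-point s)) (sym (coords-point t)) e)))

  torus-walk : ∀ k s t → dT s t ≡ k → Walk G (point s) (point t) k
  torus-walk zero    s t e with dT-zero s t e
  ... | refl = nil
  torus-walk (suc k) s t e =
    let (s′ , edge , e′) = torus-step s t e in step (torus-edge edge) (torus-walk k s′ t e′)

  walk-bound : ∀ {a b n} → Walk (Induced G T) a b n → dT (coords a) (coords b) ≤ n
  walk-bound {a} nil = ≤-reflexive (dT-refl (coords a))
  walk-bound {a} {b} (step {y = a′} (ta , ta′ , e) w) =
    ≤-trans (dT-triangle (coords a) (coords a′) (coords b))
      (+-mono-≤ (≤-reflexive (edge⇒dT (edge-torus ta ta′ e))) (walk-bound w))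

  -- Walks of the torus are walks of `G`, which bounds the distance from above; by convexity some
  -- geodesic of `G` stays in `T`, which bounds it from below.
  point-dist : ∀ s t → Dist G (point s) (point t) (dT s t)
  point-dist s t =
    let (n , w , d) = Isometric.geodesic (convex-isometric whole T convex)
                        (point-Vx s , point-T s) (point-Vx t , point-T t)
        le = subst₂ (λ p q → dT p q ≤ n) (coords-point s) (coords-point t) (walk-bound w)
    in subst (Dist G (point s) (point t)) (≤-antisym (proj₂ d _ (torus-walk _ s t refl)) le) d

  btT⇒between : ∀ {s t r} → BtT s t r → InI G (point s) (point t) (point r)
  btT⇒between {s} {t} {r} e = dT s r , dT r t , point-dist s r , point-dist r t ,
    subst (Dist G (point s) (point t)) (sym e) (point-dist s t)

  btT⇒btw : ∀ {s t r} → BtT s t r → Btw (point s) (point t) (point r)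
  btT⇒btw {s} {t} {r} e = between⇒btw (point-Vx s) (point-Vx t) (btT⇒between {s} {t} {r} e)

  btw⇒btT : ∀ {s t r} → Btw (point s) (point t) (point r) → BtT s t r
  btw⇒btT {s} {t} {r} h =
    let (a , b , da , db , d) = btw⇒between (point-Vx s) (point-Vx t) (point-Vx r) h
    in trans (cong₂ _+_ (dist-unique (point-dist s r) da) (dist-unique (point-dist r t) db))
             (dist-unique d (point-dist s t))

  between-point : ∀ {s t v} → Vx G v → Btw (point s) (point t) v → point (coords v) ≡ v
  between-point {s} {t} vv h = point-coords (proj₂ convex _ _ _ (point-T s) (point-T t)
    (btw⇒between (point-Vx s) (point-Vx t) vv h))

  -- A vertex `τ` in two intervals of one cycle yields `b [ i ≔ τ ]` in the two corresponding
  -- intervals of the torus, because the remaining coordinates are those of `b`.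
  metric-triangle : ∀ {a b c} → MetricTriangle G (point a) (point b) (point c) → MetricT a b c
  metric-triangle {a} {b} {c} (f , g , h) i = side a b c f , side b c a g , side c a b h
    where
    side : ∀ a b c → (∀ v → InI G (point a) (point b) v → InI G (point b) (point c) v → v ≡ point b) →
      ∀ τ → bt (ms ! i) (a ∙ i) (b ∙ i) τ → bt (ms ! i) (b ∙ i) (c ∙ i) τ → τ ≡ b ∙ i
    side a b c f τ h h′ = trans (sym (updated b i τ)) (cong (_∙ i) same)
      where
      p = b [ i ≔ τ ]
      go : ∀ j → bt (ms ! j) (a ∙ j) (b ∙ j) (p ∙ j) × bt (ms ! j) (b ∙ j) (c ∙ j) (p ∙ j)
      go j with i Fin.≟ j
      ... | yes refl rewrite updated b i τ = h , h′
      ... | no i≢j rewrite unchanged b τ i≢j = Cycle.bt-right (ms ! j) _ _ , Cycle.bt-left (ms ! j) _ _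
      same : p ≡ b
      same = trans (sym (coords-point p)) (trans (cong coords (f (point p)
        (btT⇒between {a} {b} {p} (coord-btT {s = a} {b} {p} λ j → proj₁ (go j)))
        (btT⇒between {b} {c} {p} (coord-btT {s = b} {c} {p} λ j → proj₂ (go j))))) (coords-point b))

-- Existence of gates and transport of Peano's axiom

module Gates (G : Graph) (peano : PeanoPartialCube G) (T : V G → Set) (convex : Convex G T)
  {ms : List ℕ} (iso : IsoTorus (Induced G T) ms) where

  open InPartialCube G (proj₁ peano)
  open InPeanoPartialCube G peano using (local-gate)
  open TorusIn G (proj₁ peano) T convex iso

  Gate : V G → TorusV ms → Set
  Gate u p = ∀ t → Btw u (point t) (point p)

  module _ {u : V G} (vu : Vx G u) where

    dist-to : TorusV ms → ℕ
    dist-to t = proj₁ (distance vu (point-Vx t))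

    nearest : ∀ n p → dist-to p ≤ n → ∃[ p ] (∀ q → dist-to p ≤ dist-to q)
    nearest n p le with any-torus? (λ q → dist-to q <? dist-to p)
    ... | no none = p , λ q → ≮⇒≥ λ lt → none (q , lt)
    nearest zero    p le | yes (q , lt) = ⊥-elim (<⇒≱ lt (≤-trans le z≤n))
    nearest (suc n) p le | yes (q , lt) = nearest n q (≤-pred (≤-trans lt le))

    -- Were `u` on the side of `q`, then `q` would lie between `u` and `p` and be nearer to `u`.
    gate-at-edge : ∀ {p q} → dist-to p ≤ dist-to q → E G (point p) (point q) → Btw u (point q) (point p)
    gate-at-edge {p} {q} le e =
      let (κ , ne , _) = edge-cross e
      in edge-btw e ne (decidable-stable (φ u κ Bool.≟ φ (point p) κ) λ n → <⇒≱ (closer κ ne n) le)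
      where
      closer : ∀ κ → φ (point p) κ ≢ φ (point q) κ → φ u κ ≢ φ (point p) κ → dist-to q < dist-to p
      closer κ ne n =
        let (a , b , da , db , d) = btw⇒between vu (point-Vx p) (point-Vx q)
              (edge-btw (E-sym e) (λ e → ne (sym e)) (bool-third (λ e → ne (sym e)) n))
        in ≤-reflexive (trans (+-comm 1 _) (trans
             (cong₂ _+_ (dist-unique (proj₂ (distance vu (point-Vx q))) da) (dist-unique (edge-dist (E-sym e)) db))
             (dist-unique d (proj₂ (distance vu (point-Vx p))))))

    gate-shrink : ∀ {p w t} → Btw u w p → Btw p w t → Btw u t p
    gate-shrink {p} {w} {t} upw pwt κ e = decidable-stable (φ p κ Bool.≟ φ u κ) λ ne →
      ne (sym (trans e (pwt κ (sym (bool-third (λ e → ne e) (λ e → ne (upw κ (sym e))) )))))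

    -- `local-gate` gives the claim for the antipode in the fibre cycle, and every vertex of that
    -- cycle lies between `p` and the antipode.
    gate-in-fibre : ∀ {p} → (∀ q → dist-to p ≤ dist-to q) → ∀ i → Cross (ms ! i) (p ∙ i) →
      ∀ τ → Btw u (point (p [ i ≔ τ ])) (point p)
    gate-in-fibre {p} min i χ τ =
      subst (λ q → Btw u (P τ) (point q)) (update-self p i)
        (gate-shrink {P a} {P far} {P τ} up-far (fibre-btw (all-far τ)))
      where
      m = ms ! i
      a = p ∙ i
      P : Coord ms i → V G
      P τ = point (p [ i ≔ τ ])
      open Cross χ
      fibre-btw : ∀ {x y τ} → bt m x y τ → Btw (P x) (P y) (P τ)
      fibre-btw {x} {y} {τ} h = btT⇒btw {p [ i ≔ x ]} {p [ i ≔ y ]} {p [ i ≔ τ ]} (fibre-btT p i h)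
      edge : ∀ τ → cd m a τ ≡ 1 → E G (P a) (P τ)
      edge τ e = subst (λ q → E G (point q) (P τ)) (sym (update-self p i)) (torus-edge (update⇒edge p i τ e))
      up-edge : ∀ τ → cd m a τ ≡ 1 → Btw u (P τ) (P a)
      up-edge τ e = gate-at-edge (≤-trans (≤-reflexive (cong dist-to (update-self p i))) (min _)) (edge τ e)
      far-only : ∀ z → Vx G z → Btw (P a) (P far) z → Btw (P a) z (P next) → Btw (P a) z (P prev) → z ≡ P far
      far-only z vz h h⁺ h⁻ = trans (sym z≡) (cong point (trans r≡ (cong (p [ i ≔_]) (far-unique (r ∙ i)
          (at-i (btw⇒btT {p [ i ≔ a ]} {r} {p [ i ≔ next ]} (subst (λ z → Btw (P a) z (P next)) (sym z≡) h⁺)))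
          (at-i (btw⇒btT {p [ i ≔ a ]} {r} {p [ i ≔ prev ]} (subst (λ z → Btw (P a) z (P prev)) (sym z≡) h⁻)))))))
        where
        r = coords z
        z≡ : point r ≡ z
        z≡ = between-point {p [ i ≔ a ]} {p [ i ≔ far ]} vz h
        r≡ : r ≡ p [ i ≔ r ∙ i ]
        r≡ = is-update refl λ j i≢j → bt-degenerate (ms ! j)
          (subst₂ (λ x y → bt (ms ! j) x y (r ∙ j)) (unchanged p a i≢j) (unchanged p far i≢j)
            (btT-coord {s = p [ i ≔ a ]} {p [ i ≔ far ]} {r}
              (btw⇒btT {p [ i ≔ a ]} {p [ i ≔ far ]} {r} (subst (Btw (P a) (P far)) (sym z≡) h)) j))
        at-i : ∀ {τ} → BtT (p [ i ≔ a ]) r (p [ i ≔ τ ]) → bt m a (r ∙ i) τ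
        at-i {τ} h = subst₂ (λ x y → bt m x (r ∙ i) y) (updated p i a) (updated p i τ)
          (btT-coord {s = p [ i ≔ a ]} {r} {p [ i ≔ τ ]} h i)
      up-far : Btw u (P far) (P a)
      up-far = local-gate (edge next next-adjacent) (edge prev prev-adjacent) (point-Vx _) (point-Vx _) vu
        (fibre-btw (all-far next)) (fibre-btw (all-far prev)) (fibre-btw (all-far beforeFar))
        (fibre-btw before-next) (fibre-btw (all-before a)) (fibre-btw (all-before far))
        far-only (up-edge next next-adjacent) (up-edge prev prev-adjacent)

    -- If `u` and `p` differ at `κ`, the gate property within the fibres through `p` puts all of
    -- these on the side of `p`. That side is closed under intervals, so by `torus-hull` it contains
    -- the whole torus.
    nearest⇒gate : ∀ {p} → (∀ q → dist-to p ≤ dist-to q) → Gate u p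
    nearest⇒gate {p} min t κ e = decidable-stable (φ (point p) κ Bool.≟ φ u κ) λ ne →
      ne (sym (trans e (torus-hull (λ s → φ (point s) κ ≡ φ (point p) κ)
        (λ s t r h es et → trans (btT⇒btw {s} {t} {r} h κ (trans es (sym et))) es) p t refl
        (λ i → decidable-stable (φ (point (p [ i ≔ t ∙ i ])) κ Bool.≟ φ (point p) κ) λ n →
          ne (gate-in-fibre min i (Cycle.cross (ms ! i) (p ∙ i)) (t ∙ i) κ (sym (bool-third (λ e → ne (sym e)) n)))))))

    gate : ∃[ p ] Gate u p
    gate = let (p , min) = nearest _ start ≤-refl in p , nearest⇒gate min
      where start = tabulateT {ms} (λ i → zero)

  Crosses : I → Set
  Crosses κ = ∃[ s ] ∃[ t ] φ (point s) κ ≢ φ (point t) κ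

  gate-agrees : ∀ {u p κ} → Gate u p → Crosses κ → φ u κ ≡ φ (point p) κ
  gate-agrees {u} {p} {κ} g (s , t , ne) with φ u κ Bool.≟ φ (point s) κ
  ... | yes e = sym (g s κ e)
  ... | no n  = sym (g t κ (bool-third (λ e → ne (sym e)) n))

  -- Betweenness inside the torus depends only on the coordinates that vary on it. There the five
  -- outer vertices agree with `p`, `a`, `b`, `q`, `c`, so both hypotheses pass to these points.
  -- `cycle-peano` then picks `a ∙ i` or `b ∙ i` in each cycle, which places the point between `a`
  -- and `b`.
  torus-peano : ∀ {u v w x y p q a b c} → Gate u p → Gate x q →
    MetricT c a b →
    (∀ {κ} → Crosses κ → φ v κ ≡ φ (point a) κ) → (∀ {κ} → Crosses κ → φ w κ ≡ φ (point b) κ) →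
    (∀ {κ} → Crosses κ → φ y κ ≡ φ (point c) κ) → Btw u v x → Btw w x y →
    ∃[ t ] (Btw (point a) (point b) (point t) × Btw u (point t) (point c))
  torus-peano {u} {v} {w} {x} {y} {p} {q} {a} {b} {c} gu gx M va wb yc uvx wxy =
    r , btT⇒btw {a} {b} {r} (endpoints-btT {s = a} {b} {r} corner) , urc
    where
    up : ∀ {κ} → Crosses κ → φ u κ ≡ φ (point p) κ
    up = gate-agrees {u} {p} gu
    xq : ∀ {κ} → Crosses κ → φ x κ ≡ φ (point q) κ
    xq = gate-agrees {x} {q} gx
    transfer : ∀ {x y z x′ y′ z′} → (∀ {κ} → Crosses κ → φ x κ ≡ φ (point x′) κ) →
      (∀ {κ} → Crosses κ → φ y κ ≡ φ (point y′) κ) → (∀ {κ} → Crosses κ → φ z κ ≡ φ (point z′) κ) →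
      Btw x y z → BtT x′ y′ z′
    transfer {x′ = x′} {y′} {z′} ex ey ez h = btw⇒btT {x′} {y′} {z′} λ κ e →
      decidable-stable (φ (point z′) κ Bool.≟ φ (point x′) κ) λ ne →
        let cr = z′ , x′ , ne
        in ne (trans (sym (ez cr)) (trans (h κ (trans (ex cr) (trans e (sym (ey cr))))) (ex cr)))
    choice : ∀ i → bt (ms ! i) (p ∙ i) (a ∙ i) (c ∙ i) ⊎ bt (ms ! i) (p ∙ i) (b ∙ i) (c ∙ i)
    choice i = Cycle.cycle-peano (ms ! i) (M i)
      (btT-coord {s = p} {a} {q} (transfer {u} {v} {x} up va xq uvx) i)
      (btT-coord {s = b} {q} {c} (transfer {w} {x} {y} wb xq yc wxy) i)
    pick : ∀ i → bt (ms ! i) (p ∙ i) (a ∙ i) (c ∙ i) ⊎ bt (ms ! i) (p ∙ i) (b ∙ i) (c ∙ i) →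
      Σ (Coord ms i) λ τ → (τ ≡ a ∙ i ⊎ τ ≡ b ∙ i) × bt (ms ! i) (p ∙ i) τ (c ∙ i)
    pick i (inj₁ h) = a ∙ i , inj₁ refl , h
    pick i (inj₂ h) = b ∙ i , inj₂ refl , h
    picked : ∀ i → Σ (Coord ms i) λ τ → (τ ≡ a ∙ i ⊎ τ ≡ b ∙ i) × bt (ms ! i) (p ∙ i) τ (c ∙ i)
    picked i = pick i (choice i)
    r = tabulateT {ms} (λ i → proj₁ (picked i))
    r≡ : ∀ i → r ∙ i ≡ proj₁ (picked i)
    r≡ = coord-tabulate {ms} (λ i → proj₁ (picked i))
    corner : ∀ i → r ∙ i ≡ a ∙ i ⊎ r ∙ i ≡ b ∙ i
    corner i = subst (λ τ → τ ≡ a ∙ i ⊎ τ ≡ b ∙ i) (sym (r≡ i)) (proj₁ (proj₂ (picked i)))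
    prc : BtT p r c
    prc = coord-btT {s = p} {r} {c} λ i →
      subst (λ τ → bt (ms ! i) (p ∙ i) τ (c ∙ i)) (sym (r≡ i)) (proj₂ (proj₂ (picked i)))
    urc : Btw u (point r) (point c)
    urc κ e = decidable-stable (φ (point c) κ Bool.≟ φ u κ) λ ne →
      let cr = c , r , λ e′ → ne (trans e′ (sym e))
      in ne (trans (btT⇒btw {p} {r} {c} prc κ (trans (sym (up cr)) e)) (sym (up cr)))

-- Retracts

tight₃ : ∀ {a b c x y z} → a ≤ x → b ≤ y → c ≤ z → x + y + z ≤ a + b + c → x ≡ a × y ≡ b × z ≡ c
tight₃ {a} {b} {c} {x} {y} {z} p q r h =
  let (e , e₃) = +-tight (+-mono-≤ p q) r (≤-antisym h (+-mono-≤ (+-mono-≤ p q) r))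
      (e₁ , e₂) = +-tight p q e
  in e₁ , e₂ , e₃

dist-parts : ∀ {G p a b q i j k} → Walk G p a i → Walk G a b j → Walk G b q k → Dist G p q (i + j + k) →
  Dist G p a i × Dist G a b j × Dist G b q k
dist-parts {i = i} {j} {k} u v w (_ , min) =
    (u , λ m u′ → +-cancelʳ-≤ j i m (+-cancelʳ-≤ k _ _ (min _ (walk-++ (walk-++ u′ v) w))))
  , (v , λ m v′ → +-cancelˡ-≤ i j m (+-cancelʳ-≤ k _ _ (min _ (walk-++ (walk-++ u v′) w))))
  , (w , λ m w′ → +-cancelˡ-≤ (i + j) k m (min _ (walk-++ (walk-++ u v) w′)))

split-split : ∀ {G u v a b x y} → Split3 G u a b v → Split3 G a x y b → Split3 G u x y v
split-split {G} {u} {v} (i , j , k , ua , ab , bv , uv) (i′ , j′ , k′ , ax , xy , yb , ab′) =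
  i + i′ , j′ , k′ + k , proj₁ parts , proj₁ (proj₂ parts) , proj₂ (proj₂ parts) , total
  where
  arith : i + j + k ≡ i + i′ + j′ + (k′ + k)
  arith = trans (cong (λ j → i + j + k) (dist-unique ab ab′)) (lem i i′ j′ k′ k)
    where
    lem : ∀ a b c d e → a + (b + c + d) + e ≡ a + b + c + (d + e)
    lem a b c d e = trans (cong (λ z → a + z + e) (+-assoc b c d)) (trans (cong (_+ e) (sym (+-assoc a b (c + d))))
      (trans (cong (_+ e) (sym (+-assoc (a + b) c d))) (+-assoc (a + b + c) d e)))
  total : Dist G u v (i + i′ + j′ + (k′ + k))
  total = subst (Dist G u v) arith uv
  parts = dist-parts (walk-++ (proj₁ ua) (proj₁ ax)) (proj₁ xy) (walk-++ (proj₁ yb) (proj₁ bv)) total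

module RetractOf (G : Graph) (B : Subset G) (hm : HyperMedianPartialCube G) (ret : Retract G B) where

  peano = proj₁ hm
  pc = proj₁ peano

  open InPartialCube G pc
  open CyclePositions using (linarith; ′_; lit; _⊕_; _≤ᶠ_; _≡ᶠ_; _⇒ᶠ_)

  r : V G → V G
  r = proj₁ (proj₂ ret)

  r-in : ∀ {v} → Vx G v → B (r v)
  r-in = proj₁ (proj₂ (proj₂ ret)) _

  r-fix : ∀ {v} → B v → r v ≡ v
  r-fix = proj₁ (proj₂ (proj₂ (proj₂ ret))) _

  B-Vx : ∀ {v} → B v → Vx G v
  B-Vx = proj₁ ret _

  H : Graph
  H = Induced G B

  -- The contraction fixes `x` and `y`, so their distance in `H` is at most that in `G`; walks of
  -- `H` are walks of `G`.
  H-geodesic : ∀ {x y n} → B x → B y → Dist G x y n → Dist H x y n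
  H-geodesic {x} {y} {n} bx by d =
    let (k , d′ , k≤n) = proj₂ (proj₂ (proj₂ (proj₂ ret))) x y n (B-Vx bx) (B-Vx by) d
        d″ = subst₂ (λ p q → Dist H p q k) (r-fix bx) (r-fix by) d′
    in subst (Dist H x y) (≤-antisym k≤n (proj₂ d _ (up (proj₁ d″)))) d″
    where
    up : ∀ {x y n} → Walk H x y n → Walk G x y n
    up nil = nil
    up (step (_ , _ , e) w) = step e (up w)

  isoH : Isometric (λ v → Vx G v × B v) (λ x y → B x × B y × E G x y)
  isoH = record
    { vertices = λ _ → proj₁
    ; edges    = λ e → proj₂ (proj₂ e)
    ; ends     = λ (bx , by , e) → (B-Vx bx , bx) , (B-Vx by , by)
    ; geodesic = λ (vx , bx) (vy , by) → let (n , d) = distance vx vy in n , proj₁ (H-geodesic bx by d) , d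
    }

  open Isometric isoH

  H-vertex : ∀ {v} → B v → Vx H v
  H-vertex b = B-Vx b , b

  H-partialCube : PartialCube H
  H-partialCube =
      ((λ x y e → ends e) , (λ x y (bx , by , e) → by , bx , E-sym e) , λ x (_ , _ , e) → proj₂ (proj₂ (proj₁ pc)) x e)
    , (λ x y vx vy → let (n , w , _) = geodesic vx vy in n , w)
    , I , φ , λ x y vx vy n →
        (λ d → proj₁ (embed x y (proj₁ vx) (proj₁ vy) n) (dist-up vx vy d))
      , (λ c → dist-down vx vy (proj₂ (embed x y (proj₁ vx) (proj₁ vy) n) c))

  contract : ∀ {x y n} → Vx G x → Vx G y → Dist G x y n → ∃[ k ] (Dist G (r x) (r y) k × k ≤ n)
  contract vx vy d =
    let (k , d′ , le) = proj₂ (proj₂ (proj₂ (proj₂ ret))) _ _ _ vx vy d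
    in k , dist-up (H-vertex (r-in vx)) (H-vertex (r-in vy)) d′ , le

  -- No part becomes longer, while `u` and `v` are fixed and their distance bounds the sum from
  -- below, so every part keeps its length.
  contract-split : ∀ {u v x y} → B u → B v → Vx G x → Vx G y → Split3 G u x y v → Split3 G u (r x) (r y) v
  contract-split {u} {v} {x} {y} bu bv vx vy (i , j , k , ux , xy , yv , uv) =
    let (i′ , d₁ , le₁) = contract (B-Vx bu) vx ux
        (j′ , d₂ , le₂) = contract vx vy xy
        (k′ , d₃ , le₃) = contract vy (B-Vx bv) yv
        d₁′ = subst (λ p → Dist G p (r x) i′) (r-fix bu) d₁
        d₃′ = subst (λ p → Dist G (r y) p k′) (r-fix bv) d₃
        (e₁ , e₂ , e₃) = tight₃ le₁ le₂ le₃ (proj₂ uv _ (walk-++ (walk-++ (proj₁ d₁′) (proj₁ d₂)) (proj₁ d₃′)))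
    in i , j , k , subst (Dist G u (r x)) (sym e₁) d₁′ , subst (Dist G (r x) (r y)) (sym e₂) d₂ ,
       subst (Dist G (r y) v) (sym e₃) d₃′ , uv

  contract-between : ∀ {s t v i j} → B s → B t → Vx G v → Dist G s v i → Dist G v t j → Dist G s t (i + j) →
    Dist G s (r v) i × Dist G (r v) t j
  contract-between {s} {t} {v} {i} {j} bs bt′ vv sv vt st =
    let (i′ , d₁ , le₁) = contract (B-Vx bs) vv sv
        (j′ , d₂ , le₂) = contract vv (B-Vx bt′) vt
        d₁′ = subst (λ p → Dist G p (r v) i′) (r-fix bs) d₁
        d₂′ = subst (λ p → Dist G (r v) p j′) (r-fix bt′) d₂
        (e₁ , e₂) = +-tight le₁ le₂ (≤-antisym (proj₂ st _ (walk-++ (proj₁ d₁′) (proj₁ d₂′))) (+-mono-≤ le₁ le₂))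
    in subst (Dist G s (r v)) (sym e₁) d₁′ , subst (Dist G (r v) t) (sym e₂) d₂′

  retract-between : ∀ {s t v} → B s → B t → Vx G v → Btw s t v → Btw s t (r v)
  retract-between bs bt′ vv h =
    let (i , j , d₁ , d₂ , d) = btw⇒between (B-Vx bs) (B-Vx bt′) vv h
        (d₁′ , d₂′) = contract-between bs bt′ vv d₁ d₂ d
    in between⇒btw (B-Vx bs) (B-Vx bt′) (i , j , d₁′ , d₂′ , d)

  split-btw : ∀ {p a b q} → Vx G p → Vx G q → Split3 G p a b q → Btw p q a × Btw p q b × Btw p b a × Btw a q b
  split-btw {p} {a} {b} {q} vp vq (i , j , k , pa , ab , bq , pq) = Btw-pq-a , Btw-pq-b , Btw-pb-a , Btw-aq-b
    where
    va = walk-Vx vp (proj₁ pa)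
    vb = walk-Vx va (proj₁ ab)
    pb : Dist G p b (i + j)
    pb = walk-++ (proj₁ pa) (proj₁ ab) , λ m w → +-cancelʳ-≤ k _ _ (proj₂ pq _ (walk-++ w (proj₁ bq)))
    aq : Dist G a q (j + k)
    aq = walk-++ (proj₁ ab) (proj₁ bq) , λ m w → +-cancelˡ-≤ i _ _
      (≤-trans (≤-reflexive (sym (+-assoc i j k))) (proj₂ pq _ (walk-++ (proj₁ pa) w)))
    Btw-pq-a = between⇒btw vp vq (i , j + k , pa , aq , subst (Dist G p q) (+-assoc i j k) pq)
    Btw-pq-b = between⇒btw vp vq (i + j , k , pb , bq , pq)
    Btw-pb-a = between⇒btw vp vb (i , j , pa , ab , pb)
    Btw-aq-b = between⇒btw va vq (j , k , ab , bq , aq)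

  btw-convex : ∀ {u v a b m} → Btw u v a → Btw u v b → Btw a b m → Btw u v m
  btw-convex ha hb hm κ e = trans (hm κ (trans (ha κ e) (sym (hb κ e)))) (ha κ e)

  Splits : V G → V G → V G → V G → V G → V G → Set
  Splits u v w a b c = Split3 G u a b v × Split3 G v b c w × Split3 G w c a u

  -- The hypertorus is still a hull in `G`; `HullOf` shows that the hull in `H` is the same.
  record Core (u v w : V G) : Set where
    field
      {a b c}    : V G
      a∈B        : B a
      b∈B        : B b
      c∈B        : B c
      splits     : Splits u v w a b c
      triangle   : MetricTriangle G a b c
      hypertorus : IsHypertorus (Induced G (Co G (λ t → t ≡ a ⊎ t ≡ b ⊎ t ≡ c)))

  middle : ∀ {p a b q} → Split3 G p a b q → ℕ
  middle (_ , j , _) = j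

  module _ {u v w : V G} (u∈B : B u) (v∈B : B v) (w∈B : B w) where

    private
      vu = B-Vx u∈B
      vv = B-Vx v∈B
      vw = B-Vx w∈B

    retract-median : ∀ {m} → Vx G m → Btw u v m → Btw v w m → Btw w u m → Median H u v w (r m)
    retract-median vm h₁ h₂ h₃ = vm′ ,
        between-down (H-vertex u∈B) (H-vertex v∈B) vm′ (retract-between u∈B v∈B vm h₁)
      , between-down (H-vertex v∈B) (H-vertex w∈B) vm′ (retract-between v∈B w∈B vm h₂)
      , between-down (H-vertex w∈B) (H-vertex u∈B) vm′ (retract-between w∈B u∈B vm h₃)
      where vm′ = H-vertex (r-in vm)

    perimeter : ∀ {a b c} → Splits u v w a b c → ℕ
    perimeter (s₁ , s₂ , s₃) = middle s₁ + middle s₂ + middle s₃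

    -- A hyper-median of (a,b,c) other than (a,b,c) is mapped by r to a triple of smaller perimeter.
    search : ∀ N {a b c} → B a → B b → B c → (s : Splits u v w a b c) → perimeter s ≤ N →
      (∃[ m ] Median H u v w m) ⊎ Core u v w
    search N {a} {b} {c} a∈B b∈B c∈B s le with proj₂ hm a b c (B-Vx a∈B) (B-Vx b∈B) (B-Vx c∈B)
    search N {a} {b} {c} a∈B b∈B c∈B s@(s₁ , s₂ , s₃) le | inj₁ (m , vm , ab , bc , ca) =
      let (A₁ , B₁ , _) = split-btw vu vv s₁
          (B₂ , C₂ , _) = split-btw vv vw s₂
          (C₃ , A₃ , _) = split-btw vw vu s₃
      in inj₁ (r m , retract-median vm
           (btw-convex {u} {v} {a} {b} A₁ B₁ (between⇒btw (B-Vx a∈B) (B-Vx b∈B) ab))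
           (btw-convex {v} {w} {b} {c} B₂ C₂ (between⇒btw (B-Vx b∈B) (B-Vx c∈B) bc))
           (btw-convex {w} {u} {c} {a} C₃ A₃ (between⇒btw (B-Vx c∈B) (B-Vx a∈B) ca)))
    search N {a} {b} {c} a∈B b∈B c∈B s@(s₁ , s₂ , s₃) le
      | inj₂ (x , y , z , vx , vy , vz , (tri , t₁ , t₂ , t₃) , torus) = go N t₁ t₂ t₃ le _ refl
      where
      next : Splits a b c x y z → Splits u v w (r x) (r y) (r z)
      next (t₁ , t₂ , t₃) = contract-split u∈B v∈B vx vy (split-split s₁ t₁)
        , contract-split v∈B w∈B vy vz (split-split s₂ t₂) , contract-split w∈B u∈B vz vx (split-split s₃ t₃)
      shrink : ∀ {p q x y j} → Dist G p q j → (t : Split3 G p x y q) → middle t + proj₁ t ≤ j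
      shrink d (i , j′ , k , _ , _ , _ , d′) =
        ≤-trans (≤-trans (≤-reflexive (+-comm j′ i)) (m≤m+n (i + j′) k)) (≤-reflexive (dist-unique d′ d))
      finish : a ≡ x → b ≡ y → c ≡ z → Core u v w
      finish refl refl refl =
        record { a∈B = a∈B ; b∈B = b∈B ; c∈B = c∈B ; splits = s ; triangle = tri ; hypertorus = torus }
      start : ∀ {p x y q} (t : Split3 G p x y q) → proj₁ t ≡ 0 → p ≡ x
      start (zero , _ , _ , (nil , _) , _) refl = refl
      shorter : ∀ N j₁ j₂ j₃ m₁ m₂ m₃ i₁ i₂ i₃ d → m₁ + i₁ ≤ j₁ → m₂ + i₂ ≤ j₂ → m₃ + i₃ ≤ j₃ →
        i₁ + i₂ + i₃ ≡ suc d → j₁ + j₂ + j₃ ≤ N → 1 + (m₁ + m₂ + m₃) ≤ N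
      shorter N j₁ j₂ j₃ m₁ m₂ m₃ i₁ i₂ i₃ d = linarith
        (′ # 4 ⊕ ′ # 7 ≤ᶠ ′ # 1 ⇒ᶠ ′ # 5 ⊕ ′ # 8 ≤ᶠ ′ # 2 ⇒ᶠ ′ # 6 ⊕ ′ # 9 ≤ᶠ ′ # 3 ⇒ᶠ
          ′ # 7 ⊕ ′ # 8 ⊕ ′ # 9 ≡ᶠ lit 1 ⊕ ′ # 10 ⇒ᶠ ′ # 1 ⊕ ′ # 2 ⊕ ′ # 3 ≤ᶠ ′ # 0 ⇒ᶠ
          lit 1 ⊕ (′ # 4 ⊕ ′ # 5 ⊕ ′ # 6) ≤ᶠ ′ # 0)
        refl (N ∷ j₁ ∷ j₂ ∷ j₃ ∷ m₁ ∷ m₂ ∷ m₃ ∷ i₁ ∷ i₂ ∷ i₃ ∷ d ∷ [])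
      side : ∀ {p x y q} → Split3 G p x y q → ∃[ j ] Dist G x y j
      side (_ , j , _ , _ , d , _) = j , d
      go : ∀ N → (t₁ : Split3 G a x y b) (t₂ : Split3 G b y z c) (t₃ : Split3 G c z x a) →
        perimeter s ≤ N → ∀ k → proj₁ t₁ + proj₁ t₂ + proj₁ t₃ ≡ k → (∃[ m ] Median H u v w m) ⊎ Core u v w
      -- The first parts of the three splittings are the distances from `a` to `x`, `b` to `y` and
      -- `c` to `z`; if their sum is 0, the triple is its own hyper-median.
      go N t₁ t₂ t₃ le zero e = inj₂ (finish
        (start t₁ (m+n≡0⇒m≡0 _ (m+n≡0⇒m≡0 _ e))) (start t₂ (m+n≡0⇒n≡0 (proj₁ t₁) (m+n≡0⇒m≡0 _ e)))
        (start t₃ (m+n≡0⇒n≡0 (proj₁ t₁ + proj₁ t₂) e)))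
      go N t₁ t₂ t₃ le (suc d) e = descend N
        (shorter N (middle s₁) (middle s₂) (middle s₃) (middle t₁) (middle t₂) (middle t₃) _ _ _ d
          (shrink (proj₂ (side s₁)) t₁) (shrink (proj₂ (side s₂)) t₂) (shrink (proj₂ (side s₃)) t₃) e le)
        where
        descend : ∀ N → suc (middle t₁ + middle t₂ + middle t₃) ≤ N → (∃[ m ] Median H u v w m) ⊎ Core u v w
        descend (suc N) (s≤s le′) = search N (r-in vx) (r-in vy) (r-in vz) (next (t₁ , t₂ , t₃)) le′

-- The hull of a triple that is its own hyper-median

module HullOf (G : Graph) (B : Subset G) (hm : HyperMedianPartialCube G) (ret : Retract G B)
  {a b c : V G} (a∈B : B a) (b∈B : B b) (c∈B : B c) (triangle : MetricTriangle G a b c)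
  {ms : List ℕ} (iso : IsoTorus (Induced G (Co G (λ t → t ≡ a ⊎ t ≡ b ⊎ t ≡ c))) ms) where

  open RetractOf G B hm ret
  open InPartialCube G pc

  Corner : V G → Set
  Corner t = t ≡ a ⊎ t ≡ b ⊎ t ≡ c

  T : V G → Set
  T = Co G Corner

  corner-B : ∀ {t} → Corner t → B t
  corner-B (inj₁ refl)        = a∈B
  corner-B (inj₂ (inj₁ refl)) = b∈B
  corner-B (inj₂ (inj₂ refl)) = c∈B

  T-Vx : T ⊆ Vx G
  T-Vx v (inc h)     = B-Vx (corner-B h)
  T-Vx v (int p q h) = between-Vx (T-Vx _ p) h

  T-convex : Convex G T
  T-convex = T-Vx , λ x y z → int

  open TorusIn G pc T T-convex iso public

  α β γ : TorusV ms
  α = coords a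
  β = coords b
  γ = coords c

  point-α : point α ≡ a
  point-α = point-coords (inc (inj₁ refl))

  point-β : point β ≡ b
  point-β = point-coords (inc (inj₂ (inj₁ refl)))

  point-γ : point γ ≡ c
  point-γ = point-coords (inc (inj₂ (inj₂ refl)))

  metric-αβγ : MetricT α β γ
  metric-αβγ = metric-triangle (subst₂ (λ p q → MetricTriangle G p q (point γ)) (sym point-α) (sym point-β)
    (subst (MetricTriangle G a b) (sym point-γ) triangle))

  private
    S : TorusV ms → Set
    S t = B (point t)

    ρ : TorusV ms → TorusV ms
    ρ t = coords (r (point t))

    retract : ∀ {s s′ t} → S s → S s′ → BtT s s′ t → S (ρ t) × dT s (ρ t) ≡ dT s t × dT (ρ t) s′ ≡ dT t s′
    retract {s} {s′} {t} Ss Ss′ h =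
      let (d₁ , d₂) = contract-between Ss Ss′ (point-Vx t) (point-dist s t) (point-dist t s′)
                        (subst (Dist G (point s) (point s′)) (sym h) (point-dist s s′))
          e : point (ρ t) ≡ r (point t)
          e = between-point {s} {s′} (B-Vx (r-in (point-Vx t)))
                (retract-between Ss Ss′ (point-Vx t) (btT⇒btw {s} {s′} {t} h))
      in subst B (sym e) (r-in (point-Vx t))
       , dist-unique (point-dist s (ρ t)) (subst (λ p → Dist G (point s) p (dT s t)) (sym e) d₁)
       , dist-unique (point-dist (ρ t) s′) (subst (λ p → Dist G p (point s′) (dT t s′)) (sym e) d₂)

    advance : ∀ {s s′} → S s → S s′ → s ≢ s′ → ∃[ s₁ ] (S s₁ × TorusE ms s s₁ × BtT s s′ s₁)
    advance {s} {s′} Ss Ss′ ne = go _ refl (H-geodesic Ss Ss′ (point-dist s s′))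
      where
      go : ∀ n → dT s s′ ≡ n → Dist H (point s) (point s′) n → ∃[ s₁ ] (S s₁ × TorusE ms s s₁ × BtT s s′ s₁)
      go zero    e d = ⊥-elim (ne (dT-zero s s′ e))
      go (suc n) e (step {y = x} edge w , min) =
        coords x , subst B (sym x≡) (proj₁ (proj₂ edge)) ,
        subst (λ t → TorusE ms t (coords x)) (coords-point s)
          (edge-torus (point-T s) (subst T x≡ (point-T (coords x))) (proj₂ (proj₂ edge))) ,
        btw⇒btT {s} {s′} {coords x} (subst (Btw (point s) (point s′)) (sym x≡) h)
        where
        open Isometric isoH
        tail = dist-tail edge w min
        vx = H-vertex (proj₁ (proj₂ edge))
        h : Btw (point s) (point s′) x
        h = proj₂ (between-up (H-vertex Ss) (H-vertex Ss′) (1 , n , proj₁ tail , proj₂ tail , (step edge w , min)))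
        x≡ : point (coords x) ≡ x
        x≡ = between-point {s} {s′} (proj₁ vx) h

    open Trace S ρ retract advance

    -- A coordinate in which two corners of the metric triangle agree is the same in all three, and
    -- intervals preserve a common value.
    box-α : ∀ {v} → T v → Box α β (coords v)
    box-α (inc (inj₁ refl))        i e = refl
    box-α (inc (inj₂ (inj₁ refl))) i e = sym e
    box-α (inc (inj₂ (inj₂ refl))) i e = sym (trans e (Cycle.metric-collapse (ms ! i) (metric-αβγ i) e))
    box-α {z} (int {x} {y} p q h)  i e = bt-degenerate (ms ! i)
      (subst₂ (λ k l → bt (ms ! i) k l (coords z ∙ i)) (box-α p i e) (box-α q i e)
        (btT-coord {s = coords x} {coords y} {coords z} (btw⇒btT {coords x} {coords y} {coords z}
          (subst₂ (λ k l → Btw k l (point (coords z))) (sym (point-coords p)) (sym (point-coords q))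
            (subst (Btw x y) (sym (point-coords (int p q h))) (between⇒btw (T-Vx x p) (T-Vx y q) h)))) i))

  T⊆B : ∀ {v} → T v → B v
  T⊆B {v} t = subst B (point-coords t) (box⊆trace _ ≤-refl
    (subst B (sym point-α) a∈B) (subst B (sym point-β) b∈B) (subst B (sym point-γ) c∈B)
    metric-αβγ (coords v) (box-α t))

  open Isometric isoH

  hull-up : ∀ {v} → Co H Corner v → T v × B v
  hull-up (inc h)     = inc h , corner-B h
  hull-up (int p q h) =
    let (tp , bp) = hull-up p
        (tq , bq) = hull-up q
        ((vz , bz) , k) = between-up (H-vertex bp) (H-vertex bq) h
    in int tp tq (btw⇒between (B-Vx bp) (B-Vx bq) vz k) , bz

  -- `T⊆B` is what makes this possible: each interval step in `G` stays inside the retract and is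
  -- thus an interval step of `H`.
  hull-down : ∀ {v} → T v → Co H Corner v
  hull-down (inc h)     = inc h
  hull-down (int p q h) = int (hull-down p) (hull-down q)
    (between-down (H-vertex (T⊆B p)) (H-vertex (T⊆B q)) (H-vertex (T⊆B (int p q h)))
      (between⇒btw (T-Vx _ p) (T-Vx _ q) h))

  iso-H : IsoTorus (Induced H (Co H Corner)) ms
  iso-H = coords , point
    , (λ v (_ , h) → point-coords (proj₁ (hull-up h)))
    , (λ t → (H-vertex (T⊆B (point-T t)) , hull-down (point-T t)) , coords-point t)
    , λ u v (_ , hu) (_ , hv) →
        (λ (_ , _ , _ , _ , e) → edge-torus (proj₁ (hull-up hu)) (proj₁ (hull-up hv)) e)
      , (λ e → hu , hv , proj₂ (hull-up hu) , proj₂ (hull-up hv) ,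
          subst₂ (E G) (point-coords (proj₁ (hull-up hu))) (point-coords (proj₁ (hull-up hv))) (torus-edge e))

-- Peano's axiom in the retract and the conclusion

module RetractTheorem (G : Graph) (B : Subset G) (hm : HyperMedianPartialCube G) (ret : Retract G B) where

  open RetractOf G B hm ret
  open InPartialCube G pc
  open Isometric isoH

  split-down : ∀ {p a b q} → B p → B a → B b → B q → Split3 G p a b q → Split3 H p a b q
  split-down bp ba bb bq (i , j , k , d₁ , d₂ , d₃ , d) = i , j , k ,
    dist-down (H-vertex bp) (H-vertex ba) d₁ , dist-down (H-vertex ba) (H-vertex bb) d₂ ,
    dist-down (H-vertex bb) (H-vertex bq) d₃ , dist-down (H-vertex bp) (H-vertex bq) d

  core : ∀ {u v w} → B u → B v → B w → (∃[ m ] Median H u v w m) ⊎ Core u v w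
  -- The descent starts from the triple itself, whose outer parts have length 0.
  core {u} {v} {w} bu bv bw = search bu bv bw _ bu bv bw (trivial bu bv , trivial bv bw , trivial bw bu) ≤-refl
    where
    self : ∀ {x} → Dist G x x 0
    self = nil , λ _ _ → z≤n
    trivial : ∀ {x y} → B x → B y → Split3 G x x y y
    trivial bx by = let (n , d) = distance (B-Vx bx) (B-Vx by)
                    in 0 , n , 0 , self , d , self , subst (Dist G _ _) (sym (+-identityʳ n)) d

  core-hypermedian : ∀ {u v w} → B u → B v → B w → (k : Core u v w) →
    let open Core k in HyperMedian H u v w a b c
  core-hypermedian bu bv bw k = let (ms , ne , big , iso) = hypertorus in
    va , vb , vc ,
    ( ( (λ x h h′ → proj₁ triangle x (up va vb h) (up vb vc h′))
      , (λ x h h′ → proj₁ (proj₂ triangle) x (up vb vc h) (up vc va h′))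
      , (λ x h h′ → proj₂ (proj₂ triangle) x (up vc va h) (up va vb h′)))
    , split-down bu a∈B b∈B bv (proj₁ splits) , split-down bv b∈B c∈B bw (proj₁ (proj₂ splits))
    , split-down bw c∈B a∈B bu (proj₂ (proj₂ splits))) ,
    ms , ne , big , HullOf.iso-H G B hm ret a∈B b∈B c∈B triangle iso
    where
    open Core k
    va = H-vertex a∈B
    vb = H-vertex b∈B
    vc = H-vertex c∈B
    up : ∀ {x y z} → Vx H x → Vx H y → InI H x y z → InI G x y z
    up vx vy h = let (vz , h′) = between-up vx vy h in btw⇒between (proj₁ vx) (proj₁ vy) (proj₁ vz) h′

  -- Where y differs from u and y′, the vertices v and w agree with u, hence so do x and y.
  shadow : ∀ {u v w x y y′} → Btw u v x → Btw w x y → Btw y v y′ → Btw y w y′ → Btw u y′ y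
  shadow {u} {v} {w} {x} {y} {y′} hx hy hv hw κ e = decidable-stable (φ y κ Bool.≟ φ u κ) λ ne →
    let y′≢y = λ e′ → ne (sym (trans e e′))
        v≡u = bool-third {φ u κ} {φ y κ} (λ e → ne (sym e)) λ e′ → y′≢y (hv κ (sym e′))
        w≡u = bool-third {φ u κ} {φ y κ} (λ e → ne (sym e)) λ e′ → y′≢y (hw κ (sym e′))
    in ne (trans (hy κ (trans w≡u (sym (hx κ (sym v≡u))))) w≡u)

  H-peano : ∀ {u v w x y} → B u → B v → B w → B x → B y → Btw u v x → Btw w x y →
    ∃[ z ] (B z × Btw v w z × Btw u z y)
  H-peano {u} {v} {w} {x} {y} bu bv bw bx by hx hy with core bv bw by
  ... | inj₁ (m , vm , vwm , wym , yvm) =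
    let vwm′ = proj₂ (between-up (H-vertex bv) (H-vertex bw) vwm)
        wym′ = proj₂ (between-up (H-vertex bw) (H-vertex by) wym)
        yvm′ = proj₂ (between-up (H-vertex by) (H-vertex bv) yvm)
    in m , proj₂ vm , vwm′ , shadow hx hy yvm′ (btw-sym {w} {y} {m} wym′)
  ... | inj₂ k = peano-in-hull (proj₂ (proj₂ (proj₂ hypertorus)))
    where
    open Core k
    s₁ = split-btw (B-Vx bv) (B-Vx bw) (proj₁ splits)
    s₂ = split-btw (B-Vx bw) (B-Vx by) (proj₁ (proj₂ splits))
    s₃ = split-btw (B-Vx by) (B-Vx bv) (proj₂ (proj₂ splits))
    peano-in-hull : ∀ {ms} → IsoTorus (Induced G (Co G (λ t → t ≡ a ⊎ t ≡ b ⊎ t ≡ c))) ms →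
      ∃[ z ] (B z × Btw v w z × Btw u z y)
    peano-in-hull {ms} iso = conclude (torus-peano {u} {v} {w} {x} {y} {a = α} {β} {γ}
        (proj₂ (gate (B-Vx bu))) (proj₂ (gate (B-Vx bx)))
        (λ i → metric-rotate (ms ! i) (metric-rotate (ms ! i) (metric-αβγ i)))
        -- `a` lies between `v` and each of `b` and `c`. Where `v` differs from `a`, the three
        -- corners therefore agree, and the coordinate is constant on `T`. The same holds for `w`
        -- with `b` and for `y` with `c`.
        (λ cr → trans (agrees (proj₁ (proj₂ (proj₂ s₁))) (btw-sym {c} {v} {a} (proj₂ (proj₂ (proj₂ s₃)))) (varies cr)) (at point-α))
        (λ cr → trans (agrees (proj₁ (proj₂ (proj₂ s₂))) (btw-sym {a} {w} {b} (proj₂ (proj₂ (proj₂ s₁)))) (λ e e′ → varies cr (sym e′) (trans e (sym e′)))) (at point-β))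
        (λ cr → trans (agrees (proj₁ (proj₂ (proj₂ s₃))) (btw-sym {b} {y} {c} (proj₂ (proj₂ (proj₂ s₂)))) (λ e e′ → varies cr (trans e′ (sym e)) (sym e))) (at point-γ))
        hx hy)
      where
      open HullOf G B hm ret a∈B b∈B c∈B triangle iso
      open Gates G peano T T-convex iso
      at : ∀ {p q κ} → point p ≡ q → φ q κ ≡ φ (point p) κ
      at e = cong (λ v → φ v _) (sym e)
      constant : ∀ {κ v} → φ b κ ≡ φ a κ → φ c κ ≡ φ a κ → T v → φ v κ ≡ φ a κ
      constant eb ec (inc (inj₁ refl))        = refl
      constant eb ec (inc (inj₂ (inj₁ refl))) = eb
      constant eb ec (inc (inj₂ (inj₂ refl))) = ec
      constant {κ} eb ec (int {p} {q} tp tq h) =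
        let ep = constant eb ec tp
        in trans (between⇒btw (T-Vx p tp) (T-Vx q tq) h κ (trans ep (sym (constant eb ec tq)))) ep
      varies : ∀ {κ} → Crosses κ → φ b κ ≡ φ a κ → φ c κ ≡ φ a κ → ⊥
      varies (s , t , ne) eb ec = ne (trans (constant eb ec (point-T s)) (sym (constant eb ec (point-T t))))
      agrees : ∀ {p q q′ q″ κ} → Btw p q′ q → Btw p q″ q → (φ q′ κ ≡ φ q κ → φ q″ κ ≡ φ q κ → ⊥) → φ p κ ≡ φ q κ
      agrees {p} {q} {q′} {q″} {κ} h h′ varies = decidable-stable (φ p κ Bool.≟ φ q κ) λ ne → varies
        (bool-third (λ e → ne (sym e)) (λ e → ne (sym (h κ (sym e)))))
        (bool-third (λ e → ne (sym e)) (λ e → ne (sym (h′ κ (sym e)))))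
      conclude : ∃[ t ] (Btw (point α) (point β) (point t) × Btw u (point t) (point γ)) →
        ∃[ z ] (B z × Btw v w z × Btw u z y)
      conclude (t , h , h′) = point t , T⊆B (point-T t) ,
        btw-convex {v} {w} {a} {b} (proj₁ s₁) (proj₁ (proj₂ s₁))
          (subst₂ (λ p q → Btw p q (point t)) point-α point-β h) ,
        -- The corner `c` lies between `u` and the new point, and by `shadow` `y` lies between `u`
        -- and `c`.
        λ κ e → let c≡u = trans (cong (λ v → φ v κ) (sym point-γ)) (h′ κ e)
                in shadow {u} {v} {w} {x} {y} {c} hx hy (proj₁ s₃)
                     (btw-sym {w} {y} {c} (proj₁ (proj₂ s₂))) κ (sym c≡u)

  -- Peano's axiom gives join-hull commutativity: the points between x and a convex set C form a convex set.
  H-prehull : ∀ (A : V G → Set) → Convex H A → PreHullAtMost (Induced H A) 1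
  H-prehull A convex = 1 , ≤-refl , λ x C vx cop → hull⊆ vx (proj₁ cop) , 𝓘⊆hull
    where
    K = Induced H A
    isoK = convex-isometric isoH A convex
    open Isometric isoK using () renaming (between-up to K-up; between-down to K-down)
    𝓘⊆hull : ∀ {P} → 𝓘 K P ⊆ Co K P
    𝓘⊆hull z (p , q , hp , hq , h) = int (inc hp) (inc hq) h
    module _ {x : V G} {C : V G → Set} (vx : Vx K x) (C-convex : Convex K C) where
      -- The vertex `x` is listed separately because `C` may be empty.
      Cone : V G → Set
      Cone z = z ≡ x ⊎ ∃[ c ] (C c × Btw x c z)
      C-K : ∀ {c} → C c → Vx K c
      C-K h = proj₁ C-convex _ h
      B-K : ∀ {v} → Vx K v → B v
      B-K ((_ , b) , _) = b
      cone-closed : ∀ {p q z} → Vx K p → Vx K q → Vx K z → Cone p → Cone q → Btw p q z → Cone z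
      cone-closed vp vq vz (inj₁ refl) (inj₁ refl) h =
        inj₁ (φ-injective (proj₁ (proj₁ vz)) (proj₁ (proj₁ vx)) (λ κ → h κ refl))
      cone-closed {q = q} {z} vp vq vz (inj₁ refl) (inj₂ (c , hc , xcq)) h =
        inj₂ (c , hc , btw-convex {x} {c} {x} {q} (btw-left {x} {c}) xcq h)
      cone-closed {p} {z = z} vp vq vz (inj₂ (c , hc , xcp)) (inj₁ refl) h =
        inj₂ (c , hc , btw-convex {x} {c} {p} {x} xcp (btw-left {x} {c}) h)
      cone-closed {p} {q} {z} vp vq vz (inj₂ (c , hc , xcp)) (inj₂ (c′ , hc′ , xcq)) h =
        -- Peano's axiom is used twice: it moves `z` to some `s` between `c` and `q`, and then `s`
        -- to some `t` between `c′` and `c`, which is in `C`. Thus `z` is between `x` and `s`, and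
        -- `s` between `x` and `t`.
        let (s , bs , cqs , xsz) = H-peano (B-K vx) (B-K (C-K hc)) (B-K vq) (B-K vp) (B-K vz) xcp (btw-sym {p} {q} {z} h)
            (t , bt′ , ct , xts) = H-peano (B-K vx) (B-K (C-K hc′)) (B-K (C-K hc)) (B-K vq) bs xcq cqs
            tH = H-vertex bt′
            vt = tH , proj₂ convex c′ c t (proj₂ (C-K hc′)) (proj₂ (C-K hc))
                        (between-down (proj₁ (C-K hc′)) (proj₁ (C-K hc)) tH ct)
        in inj₂ (t , proj₂ C-convex c′ c t hc′ hc (K-down (C-K hc′) (C-K hc) vt ct) ,
                 btw-convex {x} {t} {x} {s} (btw-left {x} {t}) xts xsz)
      hull-cone : ∀ {z} → Co K (λ v → C v ⊎ v ≡ x) z → Vx K z × Cone z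
      hull-cone {z} (inc (inj₁ h)) = C-K h , inj₂ (z , h , btw-right {x} {z})
      hull-cone (inc (inj₂ refl)) = vx , inj₁ refl
      hull-cone (int p q h) =
        let (vp , cp) = hull-cone p
            (vq , cq) = hull-cone q
            (vz , h′) = K-up vp vq h
        in vz , cone-closed vp vq vz cp cq h′
      hull⊆ : Co K (λ v → C v ⊎ v ≡ x) ⊆ 𝓘 K (λ v → C v ⊎ v ≡ x)
      hull⊆ z h with hull-cone h
      ... | vz , inj₁ refl          = x , x , inj₂ refl , inj₂ refl , K-down vx vx vx (btw-left {x} {x})
      ... | vz , inj₂ (c , hc , b)  = x , c , inj₂ refl , inj₁ hc , K-down vx (C-K hc) vz b

theorem6p10 : (G : Graph) (B : Subset G) →
    HyperMedianPartialCube G → Retract G B →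
    HyperMedianPartialCube (Induced G B)
theorem6p10 G B hm ret =
    (RetractOf.H-partialCube G B hm ret , λ A convex _ → H-prehull A convex)
  , λ u v w vu vv vw → classify (proj₂ vu) (proj₂ vv) (proj₂ vw)
  where
  open RetractTheorem G B hm ret
  H = Induced G B
  classify : ∀ {u v w} → B u → B v → B w →
    (∃[ m ] Median H u v w m) ⊎ (∃[ x ] ∃[ y ] ∃[ z ] HyperMedian H u v w x y z)
  classify bu bv bw with core bu bv bw
  ... | inj₁ m = inj₁ m
  ... | inj₂ k = inj₂ (_ , _ , _ , core-hypermedian bu bv bw k)
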